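{- For each of the four types $\widetilde{W}/W\in\{\widetilde{C}_n/C_n,\widetilde{B}_n/B_n,\widetilde{B}_n/D_n,\widetilde{D}_n/D_n\}$, the map $w\mapsto\mathcal{A}(w)$ is a bijection from $\widetilde{W}/W$ to the following set of abaci: all balanced flush abaci in types $\widetilde{C}/C$ and $\widetilde{B}/D$; all even balanced flush abaci in types $\widetilde{B}/B$ and $\widetilde{D}/D$.
   Context: Groups. Let $N=2n+1$. A mirrored $\mathbb{Z}$-permutation is a bijection $w:\mathbb{Z}\to\mathbb{Z}$ with $w(i+N)=w(i)+N$ and $w(-i)=-w(i)$ for all $i\in\mathbb{Z}$; it is determined by $(w(1),\dots,w(n))$, and its base window is $[w(1),\dots,w(2n)]$. Under composition these form the affine Coxeter group $\widetilde{C}_n$. Define elements by their images $(w(1),\dots,w(n))$: $s_i=(1,\dots,i-1,i+1,i,i+2,\dots,n)$ for $1\le i\le n-1$; $s_0^C=(-1,2,3,\dots,n)$; $s_0^D=(-2,-1,3,\dots,n)$; $s_n^C=(1,\dots,n-1,n+1)$; $s_n^D=(1,\dots,n-2,n+1,n+2)$. The four types are: - $\widetilde{C}/C$: $\widetilde{W}=\widetilde{C}_n$ is all mirrored $\mathbb{Z}$-permutations, with Coxeter generators $s_0=s_0^C,s_1,\dots,s_{n-1},s_n=s_n^C$ ($n\ge2$). - $\widetilde{B}/B$: $\widetilde{W}=\widetilde{B}_n$ is those with $|\{i\le0:w(i)\ge1\}|$ even, generators $s_0=s_0^D,s_1,\dots,s_{n-1},s_n=s_n^C$ ($n\ge3$).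 - $\widetilde{B}/D$: $\widetilde{W}=\widetilde{B}_n$ is those with $|\{i\le n:w(i)\ge n+1\}|$ even, generators $s_0=s_0^C,s_1,\dots,s_{n-1},s_n=s_n^D$ ($n\ge3$). - $\widetilde{D}/D$: $\widetilde{W}=\widetilde{D}_n$ is those satisfying both parity conditions, generators $s_0=s_0^D,s_1,\dots,s_{n-1},s_n=s_n^D$ ($n\ge4$). $W$ is the parabolic subgroup generated by $s_1,\dots,s_n$, and $\widetilde{W}/W$ denotes the set of minimal length representatives of the cosets $wW$; these are the $w\in\widetilde{W}$ with $w(1)<\cdots<w(n)<w(n+1)$ in types $\widetilde{C}/C,\widetilde{B}/B$, and with $w(1)<\cdots<w(n)<w(n+2)$ in types $\widetilde{B}/D,\widetilde{D}/D$. Abaci. An abacus has $2n$ columns called runners $1,\dots,2n$; runner $i$ has entries labeled $mN+i$ for each level $m\in\mathbb{Z}$ (so the entries are the integers not divisible by $N$). Some entries are circled (beads); the others are gaps. Reading order is the order of the labels; "lowest" means largest label. The abacus is flush if no bead is preceded in reading order by a gap on the same runner. It is balanced if every runner has at least one bead and, for all $1\le i\le 2n$, the labels of the lowest beads on runners $i$ and $N-i$ sum to $N$. It is even if the number of gaps preceding $N$ in reading order is even. For a mirrored $\mathbb{Z}$-permutation $w$, $\mathcal{A}(w)$ is the flush abacus whose lowest bead in each runner is an element of $\{w(1),\dots,w(2n)\}$. -}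

module Defs where

open import Data.Bool.Base using (Bool; true; false; if_then_else_)
open import Data.Fin.Base as Fin using (Fin; toℕ; opposite)
open import Data.Integer.Base 
  using (ℤ; +_; -_; 0ℤ; 1ℤ; _+_; _-_; _*_; _≤_; _<_; _/ℕ_; _%ℕ_)
open import Data.List.Base using (List; []; _∷_; length; map)
open import Data.List.Membership.Propositional using (_∈_)
open import Data.List.Relation.Unary.Unique.Propositional using (Unique)
open import Data.Nat.Base as ℕ using (ℕ; zero; suc)
open import Data.Nat.Divisibility using (_∣_)
open import Data.Product using (Σ-syntax; ∃-syntax; _×_; _,_; proj₁)
open import Data.Unit.Base using (⊤)
open import Function.Base using (id; _∘_)
open import Function.Bundles using (_⇔_)
open import Function.Definitions using (Bijective)
open import Level using (0ℓ)
open import Relation.Binary.Bundles using (Setoid)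
open import Relation.Binary.PropositionalEquality
  using (_≡_; _≗_; _→-setoid_)
open import Relation.Nullary.Negation.Core using (¬_)
import Relation.Binary.Construct.On as On

-- The set { x | P x } is finite with an even number of elements.
EvenCardinality : {A : Set} → (A → Set) → Set
EvenCardinality P =
  ∃[ xs ] Unique xs × (∀ x → x ∈ xs ⇔ P x) × 2 ∣ length xs

period : ℕ → ℕ
period n = suc (2 ℕ.* n)

record MirroredPermutation (n : ℕ) : Set where
  field
    fun       : ℤ → ℤ
    bijective : Bijective _≡_ _≡_ fun
    shift     : ∀ i → fun (i + + period n) ≡ fun i + + period n
    mirror    : ∀ i → fun (- i) ≡ - fun i

open MirroredPermutation public

data AffineType : Set where
  C̃/C B̃/B B̃/D D̃/D : AffineType

minRank : AffineType → ℕ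
minRank C̃/C = 2
minRank B̃/B = 3
minRank B̃/D = 3
minRank D̃/D = 4

-- With N = period n, the values g 1, …, g n are extended to ℤ by
-- w (q N + r) = q N + g r                  for 1 ≤ r ≤ n,
-- w (q N + r) = (q + 1) N - g (N - r)      for n < r ≤ 2n,
-- w (q N) = q N.
-- This is forced by w (i + N) = w i + N and w (- i) = - w i.
extend : (n : ℕ) → (ℕ → ℤ) → ℤ → ℤ
extend n g x = go (x %ℕ period n)
  where
  N q : ℤ
  N = + period n
  q = x /ℕ period n

  go : ℕ → ℤ
  go zero      = q * N
  go r@(suc _) = if r ℕ.≤ᵇ n
                 then q * N + g r
                 else (q + 1ℤ) * N - g (period n ℕ.∸ r)

-- The functions below are windows j ↦ s j of generators, meaningful for
-- 1 ≤ j ≤ n only; generator extends them to ℤ.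

swapWindow : ℕ → ℕ → ℤ
swapWindow i j =
  if j ℕ.≡ᵇ i then + suc i
  else if j ℕ.≡ᵇ suc i then + i
  else + j

s₀ᶜ s₀ᴰ : ℕ → ℤ
s₀ᶜ 1 = - + 1
s₀ᶜ j = + j
s₀ᴰ 1 = - + 2
s₀ᴰ 2 = - + 1
s₀ᴰ j = + j

sₙᶜ sₙᴰ : ℕ → ℕ → ℤ
sₙᶜ n j =
  if j ℕ.≡ᵇ n then + suc n
  else + j
sₙᴰ n j =
  if j ℕ.≡ᵇ n then + (2 ℕ.+ n)
  else if suc j ℕ.≡ᵇ n then + suc n
  else + j

firstWindow : AffineType → ℕ → ℤ
firstWindow C̃/C = s₀ᶜ
firstWindow B̃/B = s₀ᴰ
firstWindow B̃/D = s₀ᶜ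
firstWindow D̃/D = s₀ᴰ

lastWindow : AffineType → ℕ → ℕ → ℤ
lastWindow C̃/C = sₙᶜ
lastWindow B̃/B = sₙᶜ
lastWindow B̃/D = sₙᴰ
lastWindow D̃/D = sₙᴰ

generatorWindow : AffineType → (n : ℕ) → Fin (suc n) → ℕ → ℤ
generatorWindow t n Fin.zero = firstWindow t
generatorWindow t n i@(Fin.suc _) =
  if toℕ i ℕ.≡ᵇ n then lastWindow t n else swapWindow (toℕ i)

generator : AffineType → (n : ℕ) → Fin (suc n) → ℤ → ℤ
generator t n i = extend n (generatorWindow t n i)

eval : AffineType → (n : ℕ) → List (Fin (suc n)) → ℤ → ℤ
eval t n []       = id
eval t n (i ∷ is) = generator t n i ∘ eval t n is

EvenAtZero EvenAtN : ∀ {n} → MirroredPermutation n → Set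
EvenAtZero {n} w = EvenCardinality λ i → i ≤ 0ℤ × 1ℤ ≤ fun w i
EvenAtN    {n} w = EvenCardinality λ i → i ≤ + n × + suc n ≤ fun w i

InAffineGroup : AffineType → ∀ {n} → MirroredPermutation n → Set
InAffineGroup C̃/C w = ⊤
InAffineGroup B̃/B w = EvenAtZero w
InAffineGroup B̃/D w = EvenAtN w
InAffineGroup D̃/D w = EvenAtZero w × EvenAtN w

-- Words without inverses suffice here, as the generators are involutions.
InParabolic : AffineType → (n : ℕ) → (ℤ → ℤ) → Set
InParabolic t n v = ∃[ is ] eval t n (map Fin.suc is) ≗ v

HasLength : AffineType → (n : ℕ) → (ℤ → ℤ) → ℕ → Set
HasLength t n w k =
    (∃[ is ] eval t n is ≗ w × length is ≡ k)
  × (∀ is → eval t n is ≗ w → k ℕ.≤ length is)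

IsMinimalRep : AffineType → (n : ℕ) → (ℤ → ℤ) → Set
IsMinimalRep t n w =
  ∃[ k ] HasLength t n w k
       × (∀ v → InParabolic t n v → ∀ l → HasLength t n (w ∘ v) l → k ℕ.≤ l)

MinimalReps : AffineType → ℕ → Setoid 0ℓ 0ℓ
MinimalReps t n = On.setoid (ℤ →-setoid ℤ) λ (w : Carrier) → fun (proj₁ w)
  where
  Carrier : Set
  Carrier = Σ[ w ∈ MirroredPermutation n ]
              (InAffineGroup t w × IsMinimalRep t n (fun w))

-- An entry is given by its level and its runner; runners 1, …, 2n are
-- indexed by Fin (2 * n) starting from 0, so that runner N - i is the
-- opposite of runner i.
Entry : ℕ → Set
Entry n = ℤ × Fin (2 ℕ.* n)

label : ∀ n → Entry n → ℤ
label n (m , i) = m * + period n + + suc (toℕ i)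

Abacus : ℕ → Set
Abacus n = Entry n → Bool

module _ (n : ℕ) (a : Abacus n) where

  Bead Gap : Entry n → Set
  Bead e = a e ≡ true
  Gap  e = a e ≡ false

  Lowest : Fin (2 ℕ.* n) → ℤ → Set
  Lowest i m = Bead (m , i) × (∀ m′ → Bead (m′ , i) → label n (m′ , i) ≤ label n (m , i))

  Flush : Set
  Flush = ∀ i m m′ → Bead (m , i) → Gap (m′ , i) → ¬ label n (m′ , i) < label n (m , i)

  -- Every runner is required to have a lowest bead, so neither empty
  -- runners nor runners consisting only of beads are allowed.
  Balanced : Set
  Balanced = ∀ i → ∃[ m ] ∃[ m′ ] Lowest i m × Lowest (opposite i) m′
    × label n (m , i) + label n (m′ , opposite i) ≡ + period n

  EvenGaps : Set
  EvenGaps = EvenCardinality λ e → Gap e × label n e < + period n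

-- a is 𝒜(w); given w, these conditions determine a.
IsAbacusOf : ∀ n → MirroredPermutation n → Abacus n → Set
IsAbacusOf n w a = Flush n a
  × (∀ i → ∃[ m ] Lowest n a i m
         × Σ[ j ∈ Fin (2 ℕ.* n) ] label n (m , i) ≡ fun w (+ suc (toℕ j)))

IsAdmissible : AffineType → ∀ n → Abacus n → Set
IsAdmissible C̃/C n a = Flush n a × Balanced n a
IsAdmissible B̃/B n a = Flush n a × Balanced n a × EvenGaps n a
IsAdmissible B̃/D n a = Flush n a × Balanced n a
IsAdmissible D̃/D n a = Flush n a × Balanced n a × EvenGaps n a

AdmissibleAbaci : AffineType → ℕ → Setoid 0ℓ 0ℓ
AdmissibleAbaci t n = On.setoid (Entry n →-setoid Bool) λ (a : Carrier) → proj₁ a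
  where
  Carrier : Set
  Carrier = Σ[ a ∈ Abacus n ] IsAdmissible t n a

-- A generator reverses the order of a pair in the orbit of its own root only if it interchanges the
-- two members.  Following the pair a < b of a descent w b < w a of w along a word of w, one letter
-- must reverse it; that letter is the reflection in the current pair and can be deleted, giving a
-- shorter word for w s (the exchange property).  Hence minimal representatives have no descents
-- among s₁, …, sₙ.  Conversely, removing descents lowers the squared displacement of the window,
-- which yields words for all group elements, and sorts a coset without lengthening words, so that a
-- sorted element is minimal once it is known to be the only sorted element of its coset.
--
-- The beads of 𝒜 w are the numbers w z with z < N.  If v and w have the same beads then v⁻¹ w
-- preserves the window; it is increasing on it when v and w are sorted, hence the identity.  In
-- the types /D the window is sorted only up to sₙᶜ, and the parity condition at n decides between
-- the two candidates.  The gaps before N correspond to the i ≤ 0 with w i ≥ 1.  Surjectivity: the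
-- lowest beads of a balanced abacus define a translation of the runners, which is then sorted.

module Submission where

open import Defs hiding (shift; mirror)
open import Data.Bool.Base using (Bool; true; false; if_then_else_)
open import Data.Empty using (⊥; ⊥-elim)
open import Data.Fin.Base as Fin using (Fin; toℕ; fromℕ<; opposite)
open import Data.Fin.Properties using (any?; toℕ<n; toℕ-fromℕ<; opposite-prop; toℕ-injective)
open import Data.Integer.Base as ℤ hiding (suc; ∣_∣)
open import Data.Integer.DivMod using (n%ℕd<d; a≡a%ℕn+[a/ℕn]*n)
open import Data.Integer.Properties
open import Data.Integer.Tactic.RingSolver using (solve; solve-∀)
open import Data.List.Base as List using (List; []; _∷_; _++_; length; filter; upTo)
open import Data.List.Membership.Propositional using (_∈_)
open import Data.List.Membership.Propositional.Properties
  using (∈-map⁺; ∈-map⁻; ∈-filter⁺; ∈-filter⁻; ∈-upTo⁺)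
open import Data.List.Membership.Propositional.Properties.WithK using (unique∧set⇒bag)
open import Data.List.Properties using (length-++; length-map; map-++)
open import Data.List.Relation.Binary.BagAndSetEquality using (∼bag⇒↭)
open import Data.List.Relation.Binary.Permutation.Propositional.Properties using (↭-length)
import Data.List.Relation.Unary.All as All
import Data.List.Relation.Unary.AllPairs as AllPairs
open import Data.List.Relation.Unary.Any using (here; there)
open import Data.List.Relation.Unary.Unique.Propositional using (Unique)
import Data.List.Relation.Unary.Unique.Propositional.Properties as Unique
open import Data.Nat.Base as ℕ using (ℕ; suc)
open import Data.Nat.Divisibility using (_∣_; _∣?_; _∣0; ∣1⇒≡1; ∣m∣n⇒∣m+n; ∣m+n∣m⇒∣n; ∣-refl)
open import Data.Nat.Induction using (<-wellFounded)
import Data.Nat.Properties as ℕ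
open import Data.Product using (Σ-syntax; ∃-syntax; _×_; _,_; proj₁; proj₂)
open import Data.Sum.Base using (_⊎_; inj₁; inj₂; map; [_,_]′)
open import Data.Unit.Base using (⊤; tt)
open import Function.Base using (_∘_; id)
open import Function.Bundles using (Bijection; _⇔_; mk⇔; Equivalence)
open import Induction.WellFounded using (Acc; acc)
open import Relation.Binary.Bundles using (Setoid)
open import Relation.Binary.Definitions using (tri<; tri≈; tri>)
open import Relation.Binary.PropositionalEquality
open import Relation.Nullary using (Dec; does; yes; no; ¬_; contradiction)
open import Relation.Nullary.Decidable using (dec-true; dec-false)

-- Length is given through words only, so exchange is proved for concrete permutations, a reflection
-- being recorded by a pair of integers that it interchanges. The obstacle is that a letter can
-- reverse a pair without interchanging it: `s₀ᴰ` sends -1 to 2 and 1 to -2, so it reverses (-1, 1),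
-- and `sₙᴰ` does the same to (n, n + 1). Roots therefore carry a kind, and a letter is tested only
-- against kinds that occur in its own type, where these two failures cannot arise. The two parities
-- behave differently. Since `sₙᶜ` permutes the integers below N, it changes no bead: evenness at n
-- is invisible on the abacus and can be arranged freely. Evenness at 0 is visible as evenness of
-- the gaps. Accordingly `s₀ᶜ` and `sₙᶜ` are used in every type, also where they lie outside the
-- group, as maps that flip one parity each.

infixr 5 _⊹_
_⊹_ : ∀ {a b c d} → a ≤ b → c ≤ d → a + c ≤ b + d
_⊹_ = +-mono-≤

infix 6 ↑_
↑_ : ∀ {a b} → a < b → 1ℤ + a ≤ b
↑_ = i<j⇒suc[i]≤j

-- Linear inequalities follow from a sum of hypotheses whose two sides have the right difference, which
-- is a ring identity.
≤-by : ∀ {a b c d} → a ≤ b → b - a ≡ d - c → c ≤ d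
≤-by p e = 0≤i-j⇒j≤i (subst (0ℤ ≤_) e (i≤j⇒0≤j-i p))

<-by : ∀ {a b c d} → a ≤ b → b - a ≡ d - (1ℤ + c) → c < d
<-by p e = suc[i]≤j⇒i<j (≤-by p e)

⊥-by : ∀ k {a b} → a ≤ b → b - a ≡ -[1+ k ] → ⊥
⊥-by k p e with () ← subst (0ℤ ≤_) e (i≤j⇒0≤j-i p)

≡-by : ∀ {a b c d : ℤ} → a ≡ b → b - a ≡ d - c → c ≡ d
≡-by {a} refl e = sym (i-j≡0⇒i≡j _ _ (trans (sym e) (+-inverseʳ a)))

≤-slack : ∀ k {a b c d} → a ≤ b → b - a + + k ≡ d - c → c ≤ d
≤-slack k {a} {b} {c} {d} p e = ≤-trans (i≤i+j c (+ k)) (≤-by p (aux a b c d (+ k) e))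
  where
  aux : ∀ a b c d k → b - a + k ≡ d - c → b - a ≡ d - (c + k)
  aux a b c d k e = ≡-by e (solve (a ∷ b ∷ c ∷ d ∷ k ∷ []))

≡⇒≤ : ∀ {a b : ℤ} → a ≡ b → a ≤ b
≡⇒≤ = ≤-reflexive

involutive⇒injective : ∀ {A : Set} {f : A → A} → (∀ x → f (f x) ≡ x) → ∀ {x y} → f x ≡ f y → x ≡ y
involutive⇒injective {f = f} ff {x} {y} e = trans (sym (ff x)) (trans (cong f e) (ff y))

-- Maps of the integers with the two mirror symmetries.

record Mirrored (N : ℤ) (f : ℤ → ℤ) : Set where
  field
    shift  : ∀ x → f (x + N) ≡ f x + N
    mirror : ∀ x → f (- x) ≡ - f x

  private
    shift-nat : ∀ m x → f (x + + m * N) ≡ f x + + m * N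
    shift-nat ℕ.zero x = trans (cong f (+-identityʳ x)) (sym (+-identityʳ (f x)))
    shift-nat (ℕ.suc m) x = begin
      f (x + + ℕ.suc m * N) ≡⟨ cong f (step x (+ m) N) ⟩
      f (x + + m * N + N)   ≡⟨ shift _ ⟩
      f (x + + m * N) + N   ≡⟨ cong (_+ N) (shift-nat m x) ⟩
      f x + + m * N + N     ≡⟨ step (f x) (+ m) N ⟨
      f x + + ℕ.suc m * N   ∎
      where
      open ≡-Reasoning
      step : ∀ x k N → x + (1ℤ + k) * N ≡ x + k * N + N
      step = solve-∀

  shift* : ∀ k x → f (x + k * N) ≡ f x + k * N
  shift* (+ m) x = shift-nat m x
  -- A negative shift is undone by the positive case applied at the shifted point `y`.
  shift* -[1+ m ] x = begin
    f y                                ≡⟨ back (f y) k N ⟩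
    f y + k * N + (- k) * N            ≡⟨ cong (_+ (- k) * N) (shift-nat (ℕ.suc m) y) ⟨
    f (y + k * N) + (- k) * N          ≡⟨ cong (λ z → f z + (- k) * N) (forth x k N) ⟩
    f x + (- k) * N                    ∎
    where
    open ≡-Reasoning
    k = + ℕ.suc m
    y = x + (- k) * N
    back : ∀ z k N → z ≡ z + k * N + (- k) * N
    back = solve-∀
    forth : ∀ x k N → x + (- k) * N + k * N ≡ x
    forth = solve-∀

  fixes-0 : f 0ℤ ≡ 0ℤ
  fixes-0 = aux (f 0ℤ) (mirror 0ℤ)
    where
    aux : ∀ z → z ≡ - z → z ≡ 0ℤ
    aux (+ 0) _ = refl

  fixes-multiple : ∀ k → f (k * N) ≡ k * N
  fixes-multiple k = begin
    f (k * N)        ≡⟨ cong f (+-identityˡ _) ⟨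
    f (0ℤ + k * N)   ≡⟨ shift* k 0ℤ ⟩
    f 0ℤ + k * N     ≡⟨ cong (_+ k * N) fixes-0 ⟩
    0ℤ + k * N       ≡⟨ +-identityˡ _ ⟩
    k * N            ∎
    where open ≡-Reasoning

  mirror-shift* : ∀ k x → f (- x + k * N) ≡ - f x + k * N
  mirror-shift* k x = trans (shift* k (- x)) (cong (_+ k * N) (mirror x))

  reflect : ∀ x → f (N - x) ≡ N - f x
  reflect x = begin
    f (N - x)     ≡⟨ cong f (+-comm N (- x)) ⟩
    f (- x + N)   ≡⟨ shift (- x) ⟩
    f (- x) + N   ≡⟨ cong (_+ N) (mirror x) ⟩
    - f x + N     ≡⟨ +-comm (- f x) N ⟩
    N - f x       ∎
    where open ≡-Reasoning

open Mirrored public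

∘-mirrored : ∀ {N f g} → Mirrored N f → Mirrored N g → Mirrored N (f ∘ g)
∘-mirrored {f = f} F G .shift x = trans (cong f (G .shift x)) (F .shift _)
∘-mirrored {f = f} F G .mirror x = trans (cong f (G .mirror x)) (F .mirror _)

id-mirrored : ∀ {N} → Mirrored N id
id-mirrored .shift _ = refl
id-mirrored .mirror _ = refl

-- Orbits under negation and translation by N, and reflections.

module Reflections (N : ℤ) where

  -- A mirrored map is determined on this orbit by its value at `a`.
  data Orbit (a z : ℤ) : Set where
    plus : ∀ k → z ≡ a + k * N → Orbit a z
    minus : ∀ k → z ≡ - a + k * N → Orbit a z

  orbit-shift : ∀ {a z} k → Orbit a z → Orbit a (z + k * N)
  orbit-shift {a} k (plus l refl) = plus (l + k) (solve (a ∷ k ∷ l ∷ N ∷ []))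
  orbit-shift {a} k (minus l refl) = minus (l + k) (solve (a ∷ k ∷ l ∷ N ∷ []))

  orbit-neg : ∀ {a z} → Orbit a z → Orbit a (- z)
  orbit-neg {a} (plus l refl) = minus (- l) (solve (a ∷ l ∷ N ∷ []))
  orbit-neg {a} (minus l refl) = plus (- l) (solve (a ∷ l ∷ N ∷ []))

  orbit-trans : ∀ {a x z} → Orbit a x → Orbit a z → Orbit x z
  orbit-trans {a} (plus k refl) (plus l refl) = plus (l - k) (solve (a ∷ k ∷ l ∷ N ∷ []))
  orbit-trans {a} (plus k refl) (minus l refl) = minus (l + k) (solve (a ∷ k ∷ l ∷ N ∷ []))
  orbit-trans {a} (minus k refl) (plus l refl) = minus (l + k) (solve (a ∷ k ∷ l ∷ N ∷ []))
  orbit-trans {a} (minus k refl) (minus l refl) = plus (l - k) (solve (a ∷ k ∷ l ∷ N ∷ []))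

  orbit-map : ∀ {f a z} → Mirrored N f → Orbit a z → Orbit (f a) (f z)
  orbit-map {a = a} F (plus k refl) = plus k (shift* F k a)
  orbit-map {a = a} F (minus k refl) = minus k (mirror-shift* F k a)

  orbit-map⁻ : ∀ {f a z} → Mirrored N f → (∀ {x y} → f x ≡ f y → x ≡ y) →
               Orbit (f a) (f z) → Orbit a z
  orbit-map⁻ {a = a} F inj (plus k e) = plus k (inj (trans e (sym (shift* F k a))))
  orbit-map⁻ {a = a} F inj (minus k e) = minus k (inj (trans e (sym (mirror-shift* F k a))))

  -- A reflection given by one pair that it interchanges. By `rest` only the orbits of the two
  -- members can move, so the pair determines `f`.
  record Reflects (f : ℤ → ℤ) (a b : ℤ) : Set where
    field
      mirrored : Mirrored N f
      left     : f a ≡ b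
      right    : f b ≡ a
      rest     : ∀ z → (Orbit a z ⊎ Orbit b z) ⊎ f z ≡ z

  open Reflects public

  reflects-sym : ∀ {f a b} → Reflects f a b → Reflects f b a
  reflects-sym R .mirrored = R .mirrored
  reflects-sym R .left = R .right
  reflects-sym R .right = R .left
  reflects-sym R .rest z with R .rest z
  ... | inj₁ (inj₁ p) = inj₁ (inj₂ p)
  ... | inj₁ (inj₂ p) = inj₁ (inj₁ p)
  ... | inj₂ e = inj₂ e

  -- The base pair of a reflection is not canonical: translating or negating it gives another one.
  reflects-orbit : ∀ {f a b x} → Reflects f a b → Orbit a x → Reflects f x (f x)
  reflects-orbit {f} {a} {b} R o .mirrored = R .mirrored
  reflects-orbit {f} {a} {b} R o .left = refl
  reflects-orbit {f} {a} {b} R (plus k refl) .right = begin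
    f (f (a + k * N)) ≡⟨ cong f (shift* (R .mirrored) k a) ⟩
    f (f a + k * N)   ≡⟨ shift* (R .mirrored) k (f a) ⟩
    f (f a) + k * N   ≡⟨ cong (_+ k * N) (trans (cong f (R .left)) (R .right)) ⟩
    a + k * N ∎
    where open ≡-Reasoning
  reflects-orbit {f} {a} {b} R (minus k refl) .right = begin
    f (f (- a + k * N))  ≡⟨ cong f (mirror-shift* (R .mirrored) k a) ⟩
    f (- f a + k * N)    ≡⟨ mirror-shift* (R .mirrored) k (f a) ⟩
    - f (f a) + k * N    ≡⟨ cong (λ z → - z + k * N) (trans (cong f (R .left)) (R .right)) ⟩
    - a + k * N ∎
    where open ≡-Reasoning
  reflects-orbit {f} {a} {b} {x} R o .rest z with R .rest z
  ... | inj₁ (inj₁ p) = inj₁ (inj₁ (orbit-trans o p))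
  ... | inj₁ (inj₂ p) =
        inj₁ (inj₂ (orbit-trans (subst (λ c → Orbit c (f x)) (R .left) (orbit-map (R .mirrored) o)) p))
  ... | inj₂ e = inj₂ e

  -- This recognises a letter as the reflection in a pair met along a word: it is enough that the
  -- letter sends one member to the other.
  reflects-moved : ∀ {f a b x} → Reflects f a b → f x ≢ x → Reflects f x (f x)
  reflects-moved {x = x} R moved with R .rest x
  ... | inj₁ (inj₁ o) = reflects-orbit R o
  ... | inj₁ (inj₂ o) = reflects-orbit (reflects-sym R) o
  ... | inj₂ e = contradiction e moved

  involutive : ∀ {f a b} → Reflects f a b → ∀ z → f (f z) ≡ z
  involutive {f} R z with f z ≟ z
  ... | yes e = trans (cong f e) e
  ... | no moved = reflects-moved R moved .right

  -- On the orbits of `a` and `b` both sides are mirrored and agree at the base points; elsewhere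
  -- both equal `u z`.
  conjugate : ∀ {g h u a b} → Mirrored N u → (∀ {x y} → u x ≡ u y → x ≡ y) →
              Reflects g a b → Reflects h (u a) (u b) → ∀ z → h (u z) ≡ u (g z)
  conjugate {g} {h} {u} {a} {b} U inj G H z = on-rest (G .rest z) (H .rest (u z))
    where
    open ≡-Reasoning
    on-orbit : ∀ {a b} → Reflects g a b → Reflects h (u a) (u b) → Orbit a z → h (u z) ≡ u (g z)
    on-orbit {a} {b} G H (plus k refl) = begin
      h (u (a + k * N))  ≡⟨ shift* (∘-mirrored (H .mirrored) U) k a ⟩
      h (u a) + k * N    ≡⟨ cong (_+ k * N) (trans (H .left) (cong u (sym (G .left)))) ⟩
      u (g a) + k * N    ≡⟨ shift* (∘-mirrored U (G .mirrored)) k a ⟨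
      u (g (a + k * N))  ∎
    on-orbit {a} {b} G H (minus k refl) = begin
      h (u (- a + k * N))  ≡⟨ mirror-shift* (∘-mirrored (H .mirrored) U) k a ⟩
      - h (u a) + k * N    ≡⟨ cong (λ y → - y + k * N) (trans (H .left) (cong u (sym (G .left)))) ⟩
      - u (g a) + k * N    ≡⟨ mirror-shift* (∘-mirrored U (G .mirrored)) k a ⟨
      u (g (- a + k * N))  ∎
    on-orbits : Orbit a z ⊎ Orbit b z → h (u z) ≡ u (g z)
    on-orbits (inj₁ o) = on-orbit G H o
    on-orbits (inj₂ o) = on-orbit (reflects-sym G) (reflects-sym H) o
    on-rest : (Orbit a z ⊎ Orbit b z) ⊎ g z ≡ z →
              (Orbit (u a) (u z) ⊎ Orbit (u b) (u z)) ⊎ h (u z) ≡ u z → h (u z) ≡ u (g z)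
    on-rest (inj₁ o) _ = on-orbits o
    -- The alternatives of `rest` are not exclusive, so `h` may report an orbit where `g` reports a
    -- fixed point; injectivity of `u` pulls the orbit back.
    on-rest (inj₂ _) (inj₁ o) = on-orbits (map (orbit-map⁻ U inj) (orbit-map⁻ U inj) o)
    on-rest (inj₂ e) (inj₂ e′) = trans e′ (cong u (sym e))

-- The kind of the pair (a, b) swapped by a generator: b = - a for s₀ᶜ, b = N - a for sₙᶜ, and generic
-- for the others.  The kind is preserved by mirrored permutations.
data Kind : Set where
  generic central half : Kind

-- Roots, simple reflections and the pairs that they reverse.

module Roots (ν N : ℤ) (N≡ : N ≡ 1ℤ + (ν + ν)) (0<ν : 0ℤ < ν) where

  open Reflections N

  private
    1+2ν≤N : 1ℤ + (ν + ν) ≤ N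
    1+2ν≤N = ≡⇒≤ (sym N≡)

    N≤1+2ν : N ≤ 1ℤ + (ν + ν)
    N≤1+2ν = ≡⇒≤ N≡

    instance
      N-nonNeg : NonNegative N
      N-nonNeg = nonNegative (≤-slack 3 (1+2ν≤N ⊹ ↑ 0<ν ⊹ ↑ 0<ν) (solve (N ∷ ν ∷ [])))

  multiple<N : ∀ k → k * N < N → k ≤ 0ℤ
  multiple<N k p = ≤-by (↑ *-cancelʳ-<-nonNeg {k} {1ℤ} N (subst (k * N <_) (sym (*-identityˡ N)) p))
        (solve (k ∷ []))

  -N<multiple : ∀ k → - N < k * N → 0ℤ ≤ k
  -N<multiple k p = ≤-by (↑ *-cancelʳ-<-nonNeg { -1ℤ} {k} N (subst (_< k * N) (sym (-1*i≡-i N)) p))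
        (solve (k ∷ []))

  ¬multiple-between : ∀ k → 0ℤ < k * N → k * N < N → ⊥
  ¬multiple-between k p q = <⇒≱ (*-cancelʳ-<-nonNeg {0ℤ} {k} N p) (multiple<N k q)

  doubled≤ : ∀ {x} → x < N - x → x ≤ ν
  doubled≤ {x} p with x ≤? ν
  ... | yes q = q
  ... | no q = ⊥-elim (⊥-by 1 (↑ p ⊹ ↑ ≰⇒> q ⊹ ↑ ≰⇒> q ⊹ N≤1+2ν) (solve (x ∷ ν ∷ N ∷ [])))

  -- A generic pair has two distinct orbits, neither made of multiples of N. Each condition survives
  -- injective mirrored maps, so the kind persists while a pair is carried along a word.
  IsRoot : Kind → ℤ → ℤ → Set
  IsRoot generic x y = (∀ k → x ≢ k * N) × (∀ k → y ≢ k * N)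
                     × (∀ k → y ≢ x + k * N) × (∀ k → y ≢ - x + k * N)
  IsRoot central x y = y ≡ - x
  IsRoot half x y = y ≡ N - x

  root-map : ∀ {f} κ → Mirrored N f → (∀ {x y} → f x ≡ f y → x ≡ y) →
             ∀ {x y} → IsRoot κ x y → IsRoot κ (f x) (f y)
  root-map generic F inj (p , q , r , s) =
      (λ k e → p k (inj (trans e (sym (fixes-multiple F k)))))
    , (λ k e → q k (inj (trans e (sym (fixes-multiple F k)))))
    , (λ k e → r k (inj (trans e (sym (shift* F k _)))))
    , (λ k e → s k (inj (trans e (sym (mirror-shift* F k _)))))
  root-map central F inj refl = F .mirror _
  root-map half F inj refl = reflect F _

  -- `narrow` separates the translates of the pair, and `between` says that everything strictly
  -- inside it moves, except possibly 0. The inner point -1 of (-2, 1) for `s₀ᴰ` and the inner point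
  -- n of (n - 1, n + 1) for `sₙᴰ` do move.
  record Simple (f : ℤ → ℤ) (a b : ℤ) : Set where
    field
      reflects : Reflects f a b
      ordered  : a < b
      narrow   : b - a < N
      between  : ∀ y → a < y → y < b → f y ≡ y → y ≡ 0ℤ

  open Simple public

  simple-neg : ∀ {f a b} → Simple f a b → Simple f (- b) (- a)
  simple-neg {f} {a} {b} S .reflects =
    subst (Reflects f (- b)) (trans (S .reflects .mirrored .mirror b) (cong -_ (S .reflects .right)))
      (reflects-orbit (reflects-sym (S .reflects)) (minus 0ℤ (solve (b ∷ N ∷ []))))
  simple-neg S .ordered = neg-mono-< (S .ordered)
  simple-neg {a = a} {b} S .narrow = <-by (↑ S .narrow) (solve (a ∷ b ∷ N ∷ []))
  simple-neg {f} {a} {b} S .between y p q e = trans (sym (neg-involutive y)) (cong -_ -y≡0)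
    where
    -y≡0 : - y ≡ 0ℤ
    -y≡0 = S .between (- y) (<-by (↑ q) (solve (a ∷ y ∷ []))) (<-by (↑ p) (solve (b ∷ y ∷ [])))
             (trans (S .reflects .mirrored .mirror y) (cong -_ e))

  data Up (a b x fx : ℤ) : Set where
    plus  : ∀ k → x ≡ a + k * N → fx ≡ b + k * N → Up a b x fx
    minus : ∀ k → x ≡ - b + k * N → fx ≡ - a + k * N → Up a b x fx

  -- Moved points are translates of `a`, `b`, `- a` or `- b`; as `a < b`, those of `b` and `- a` go
  -- down.
  up : ∀ {f a b} → Simple f a b → ∀ {x} → x < f x → Up a b x (f x)
  up {f} {a} {b} S {x} p with S .reflects .rest x
  ... | inj₂ e = contradiction (sym e) (<⇒≢ p)
  ... | inj₁ (inj₁ (plus k refl)) =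
        plus k refl (trans (shift* (S .reflects .mirrored) k a) (cong (_+ k * N) (S .reflects .left)))
  ... | inj₁ (inj₂ (minus k refl)) =
        minus k refl (trans (mirror-shift* (S .reflects .mirrored) k b)
        (cong (λ z → - z + k * N) (S .reflects .right)))
  ... | inj₁ (inj₁ (minus k refl)) =
        ⊥-elim (go _ p (trans (mirror-shift* (S .reflects .mirrored) k a)
        (cong (λ z → - z + k * N) (S .reflects .left))))
    where
    go : ∀ z → - a + k * N < z → z ≡ - b + k * N → ⊥
    go z p refl = ⊥-by 1 (↑ p ⊹ ↑ S .ordered) (solve (a ∷ b ∷ k ∷ N ∷ []))
  ... | inj₁ (inj₂ (plus k refl)) =
        ⊥-elim (go _ p (trans (shift* (S .reflects .mirrored) k b) (cong (_+ k * N) (S .reflects .right))))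
    where
    go : ∀ z → b + k * N < z → z ≡ a + k * N → ⊥
    go z p refl = ⊥-by 1 (↑ p ⊹ ↑ S .ordered) (solve (a ∷ b ∷ k ∷ N ∷ []))

  Obeys : (ℤ → ℤ) → Kind → Set
  Obeys f κ = ∀ {x y} → IsRoot κ x y → x < y → f y < f x → f x ≡ y

  private
    -- A fixed `y` would lie inside the translated root and so be a multiple of N; a `y` in the
    -- orbit of `a` is not generic to `x`; for a translate of `- b` the two inequalities contradict
    -- each other. This leaves a translate of `b`, and the width below N forces it to be the same
    -- translate as for `x`.
    obeys-up : ∀ {f a b} → Simple f a b → ∀ {x y} → IsRoot generic x y → x < y → f y < f x →
               ∀ k → x ≡ a + k * N → f x ≡ b + k * N → f x ≡ y
    obeys-up {f} {a} {b} S {x} {y} (x≢ , y≢ , y≢x+ , y≢-x+) x<y fy<fx k refl fx≡ =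
          by-orbit (S .reflects .rest y)
      where
      by-orbit : (Orbit a y ⊎ Orbit b y) ⊎ f y ≡ y → f x ≡ y
      by-orbit (inj₂ fy≡y) = contradiction y≡kN (y≢ k)
        where
        below : ∀ z → y < z → z ≡ b + k * N → (y + (- k) * N) < b
        below z p refl = <-by (↑ p) (solve (y ∷ b ∷ k ∷ N ∷ []))
        y′≡0 : (y + (- k) * N) ≡ 0ℤ
        y′≡0 = S .between (y + (- k) * N) (<-by (↑ x<y) (solve (y ∷ a ∷ k ∷ N ∷ [])))
                 (below _ (subst (_< f x) fy≡y fy<fx) fx≡)
                 (trans (shift* (S .reflects .mirrored) (- k) y) (cong (_+ (- k) * N) fy≡y))
        y≡kN : y ≡ k * N
        y≡kN = ≡-by y′≡0 (solve (y ∷ k ∷ N ∷ []))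
      by-orbit (inj₁ (inj₁ (plus l refl))) = ⊥-elim (y≢x+ (l - k) (solve (a ∷ k ∷ l ∷ N ∷ [])))
      by-orbit (inj₁ (inj₁ (minus l refl))) = ⊥-elim (y≢-x+ (l + k) (solve (a ∷ k ∷ l ∷ N ∷ [])))
      by-orbit (inj₁ (inj₂ (plus l refl))) = trans fx≡ (cong (λ k → b + k * N) k≡l)
        where
        fy≡ : f y ≡ a + l * N
        fy≡ = trans (shift* (S .reflects .mirrored) l b) (cong (_+ l * N) (S .reflects .right))
        fy<fx′ : a + l * N < b + k * N
        fy<fx′ = subst₂ _<_ fy≡ fx≡ fy<fx
        k≡l : k ≡ l
        k≡l = sym (≡-by (≤-antisym
          (multiple<N (l - k) (<-by (↑ fy<fx′ ⊹ <⇒≤ (S .narrow)) (solve (a ∷ b ∷ k ∷ l ∷ N ∷ []))))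
          (-N<multiple (l - k) (<-by (↑ x<y ⊹ <⇒≤ (S .narrow)) (solve (a ∷ b ∷ k ∷ l ∷ N ∷ [])))))
          (solve (k ∷ l ∷ [])))
      by-orbit (inj₁ (inj₂ (minus l refl))) =
            ⊥-elim (⊥-by 1 (↑ x<y ⊹ ↑ fy<fx′) (solve (a ∷ b ∷ k ∷ l ∷ N ∷ [])))
        where
        fy≡ : f y ≡ - a + l * N
        fy≡ = trans (mirror-shift* (S .reflects .mirrored) l b) (cong (λ z → - z + l * N) (S .reflects .right))
        fy<fx′ : - a + l * N < b + k * N
        fy<fx′ = subst₂ _<_ fy≡ fx≡ fy<fx

    obeys-rising : ∀ {f a b} → Simple f a b → ∀ {x y} → IsRoot generic x y → x < y → f y < f x →
                   x < f x → f x ≡ y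
    obeys-rising S r x<y fy<fx x<fx with up S x<fx
    ... | plus k x≡ fx≡ = obeys-up S r x<y fy<fx k x≡ fx≡
    -- Here `x` is a translate of `- b`, the left end of the negated simple pair.
    ... | minus k x≡ fx≡ = obeys-up (simple-neg S) r x<y fy<fx k x≡ fx≡

    root-neg : ∀ {x y} → IsRoot generic x y → IsRoot generic (- y) (- x)
    root-neg {x} {y} (p , q , r , s) =
        (λ k e → q (- k) (≡-by (sym e) (solve (y ∷ k ∷ N ∷ []))))
      , (λ k e → p (- k) (≡-by (sym e) (solve (x ∷ k ∷ N ∷ []))))
      , (λ k e → r k (≡-by e (solve (x ∷ y ∷ k ∷ N ∷ []))))
      , (λ k e → s (- k) (≡-by (sym e) (solve (x ∷ y ∷ k ∷ N ∷ []))))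

  obeys-generic : ∀ {f a b} → Simple f a b → Obeys f generic
  obeys-generic {f} S {x} {y} r x<y fy<fx with x <? f x
  ... | yes x<fx = obeys-rising S r x<y fy<fx x<fx
  -- If `x` does not rise then `y` falls, so `- y < - x` is a reversed pair whose left end rises.
  ... | no x≮fx = trans (cong f (sym fy≡x)) (involutive (S .reflects) y)
    where
    F = S .reflects .mirrored
    fy<y : f y < y
    fy<y = <-trans fy<fx (≤-<-trans (≮⇒≥ x≮fx) x<y)
    f[-y]≡-x : f (- y) ≡ - x
    f[-y]≡-x = obeys-rising S (root-neg r) (neg-mono-< x<y)
      (subst₂ _<_ (sym (F .mirror x)) (sym (F .mirror y)) (neg-mono-< fy<fx))
      (subst (- y <_) (sym (F .mirror y)) (neg-mono-< fy<y))
    fy≡x : f y ≡ x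
    fy≡x = neg-injective (trans (sym (F .mirror y)) f[-y]≡-x)

  -- These locate a root away from one of the two thresholds, n and 0. The letters `s₁`, ..., up to
  -- index n - 1 are both low and high, the first letters are low and the last letters are high.
  Low High : ℤ → ℤ → Set
  Low a b = - ν ≤ a × b ≤ ν
  High a b = 0ℤ < a × b < N

  -- A translate of the pair straddling the threshold would need a multiple of N strictly between 0
  -- and N.
  low-preserves : ∀ {f a b} → Simple f a b → Low a b → ∀ {x} → x ≤ ν → f x ≤ ν
  low-preserves {f} {a} {b} S (-ν≤a , b≤ν) {x} x≤ν = ≮⇒≥ λ ν<fx → crossing ν<fx (up S (≤-<-trans x≤ν ν<fx))
    where
    crossing : ∀ {y} → ν < y → Up a b x y → ⊥
    crossing ν<y (plus k refl refl) = ¬multiple-between k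
      (<-by (↑ ν<y ⊹ b≤ν) (solve (a ∷ b ∷ k ∷ N ∷ ν ∷ [])))
      (<-by (x≤ν ⊹ -ν≤a ⊹ 1+2ν≤N) (solve (a ∷ b ∷ k ∷ N ∷ ν ∷ [])))
    crossing ν<y (minus k refl refl) = ¬multiple-between k
      (<-by (↑ ν<y ⊹ -ν≤a) (solve (a ∷ b ∷ k ∷ N ∷ ν ∷ [])))
      (<-by (x≤ν ⊹ b≤ν ⊹ 1+2ν≤N) (solve (a ∷ b ∷ k ∷ N ∷ ν ∷ [])))

  high-preserves : ∀ {f a b} → Simple f a b → High a b → ∀ {x} → x ≤ 0ℤ → f x ≤ 0ℤ
  high-preserves {f} {a} {b} S (0<a , b<N) {x} x≤0 = ≮⇒≥ λ 0<fx → crossing 0<fx (up S (≤-<-trans x≤0 0<fx))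
    where
    crossing : ∀ {y} → 0ℤ < y → Up a b x y → ⊥
    crossing 0<y (plus k refl refl) = ¬multiple-between (- k)
      (<-by (x≤0 ⊹ ↑ 0<a) (solve (a ∷ b ∷ k ∷ N ∷ [])))
      (<-by (0<y′ ⊹ ↑ b<N) (solve (a ∷ b ∷ k ∷ N ∷ [])))
      where
      0<y′ : 0ℤ ≤ b + k * N
      0<y′ = <⇒≤ 0<y
    crossing 0<y (minus k refl refl) = ¬multiple-between k
      (<-by (↑ 0<y ⊹ <⇒≤ 0<a) (solve (a ∷ b ∷ k ∷ N ∷ [])))
      (<-by (x≤0 ⊹ ↑ b<N) (solve (a ∷ b ∷ k ∷ N ∷ [])))

  central<0 : ∀ {x} → x < - x → x < 0ℤ
  central<0 {x} p = ≰⇒> λ (0≤x : 0ℤ ≤ x) → ⊥-by 0 (↑ p ⊹ 0≤x ⊹ 0≤x) (solve (x ∷ []))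

  central>0 : ∀ {x} → - x < x → 0ℤ < x
  central>0 {x} p = ≰⇒> λ (x≤0 : x ≤ 0ℤ) → ⊥-by 0 (↑ p ⊹ x≤0 ⊹ x≤0) (solve (x ∷ []))

  half>ν : ∀ {x} → N - x < x → ν < x
  half>ν {x} p = ≰⇒> λ (x≤ν : x ≤ ν) → ⊥-by 1 (↑ p ⊹ x≤ν ⊹ x≤ν ⊹ 1+2ν≤N) (solve (x ∷ ν ∷ N ∷ []))

  -- Vacuous: reversing `x < - x` carries `x` from the negative to the positive side, which a high
  -- letter cannot do.
  obeys-central-high : ∀ {f a b} → Simple f a b → High a b → Obeys f central
  obeys-central-high {f} S H {x} refl x<-x fy<fx =
    contradiction (high-preserves S H (<⇒≤ (central<0 x<-x)))
      (<⇒≱ (central>0 (subst (_< f x) (S .reflects .mirrored .mirror x) fy<fx)))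

  obeys-half-low : ∀ {f a b} → Simple f a b → Low a b → Obeys f half
  obeys-half-low {f} S L {x} refl x<N-x fy<fx =
    contradiction (low-preserves S L (doubled≤ x<N-x))
      (<⇒≱ (half>ν (subst (_< f x) (reflect (S .reflects .mirrored) x) fy<fx)))

  -- Only -1 can be carried across 0, so the reversed pair is (-1, 1) itself.
  obeys-central : ∀ {f} → Simple f -1ℤ 1ℤ → Obeys f central
  obeys-central {f} S {x} refl x<-x fy<fx = finish 0<fx (up S (<-trans x<0 0<fx))
    where
    x<0 : x < 0ℤ
    x<0 = central<0 x<-x
    0<fx : 0ℤ < f x
    0<fx = central>0 (subst (_< f x) (S .reflects .mirrored .mirror x) fy<fx)
    at : ∀ k → x ≡ -1ℤ + k * N → 0ℤ < 1ℤ + k * N → 1ℤ + k * N ≡ - x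
    at k refl p = ≡-by (cong₂ _+_ kN≡0 kN≡0) (solve (k ∷ N ∷ []))
      where
      0≤kN : 0ℤ ≤ k * N
      0≤kN = ≤-by (↑ p) (solve (k ∷ N ∷ []))
      kN≤0 : k * N ≤ 0ℤ
      kN≤0 = ≤-by (↑ x<0) (solve (k ∷ N ∷ []))
      kN≡0 : k * N ≡ 0ℤ
      kN≡0 = ≤-antisym kN≤0 0≤kN
    finish : ∀ {y} → 0ℤ < y → Up -1ℤ 1ℤ x y → y ≡ - x
    finish 0<y (plus k x≡ refl) = at k x≡ 0<y
    finish 0<y (minus k x≡ refl) = at k x≡ 0<y

  -- Raised points move by one only, so crossing the threshold forces `x` to be `ν`.
  obeys-half : ∀ {f} → Simple f ν (1ℤ + ν) → Obeys f half
  obeys-half {f} S {x} refl x<N-x fy<fx = finish ν<fx (up S (≤-<-trans x≤ν ν<fx))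
    where
    x≤ν : x ≤ ν
    x≤ν = doubled≤ x<N-x
    ν<fx : ν < f x
    ν<fx = half>ν (subst (_< f x) (reflect (S .reflects .mirrored) x) fy<fx)
    at : ∀ {y} → ν < y → y ≡ 1ℤ + x → y ≡ N - x
    at ν<y refl = ≡-by (trans (cong₂ (λ x y → 1ℤ + (x + y)) x≡ν x≡ν) (sym N≡)) (solve (x ∷ ν ∷ N ∷ []))
      where
      x≡ν : x ≡ ν
      x≡ν = ≤-antisym x≤ν (≤-by (↑ ν<y) (solve (x ∷ ν ∷ [])))
    finish : ∀ {y} → ν < y → Up ν (1ℤ + ν) x y → y ≡ N - x
    finish ν<y (plus k refl refl) = at ν<y (solve (ν ∷ k ∷ N ∷ []))
    finish ν<y (minus k refl refl) = at ν<y (solve (ν ∷ k ∷ N ∷ []))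

  NotMultiple : ℤ → Set
  NotMultiple z = ∀ k → z ≢ k * N

  between⇒notMultiple : ∀ {z} → 0ℤ < z → z < N → NotMultiple z
  between⇒notMultiple p q k refl = ¬multiple-between k p q

  neg-notMultiple : ∀ {z} → NotMultiple (- z) → NotMultiple z
  neg-notMultiple {z} p k refl = p (- k) (solve (k ∷ N ∷ []))

  root-generic : ∀ {a b} → NotMultiple a → NotMultiple b → NotMultiple (b - a) → NotMultiple (b + a) →
                 IsRoot generic a b
  root-generic {a} {b} p q r s = p , q
    , (λ k e → r k (≡-by e (solve (a ∷ b ∷ k ∷ N ∷ []))))
    , (λ k e → s k (≡-by e (solve (a ∷ b ∷ k ∷ N ∷ []))))

  private
    ν<N : ν < N
    ν<N = <-by (1+2ν≤N ⊹ <⇒≤ 0<ν) (solve (ν ∷ N ∷ []))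

  1<N : 1ℤ < N
  1<N = ≤-<-trans (i<j⇒suc[i]≤j 0<ν) ν<N

  2<N : + 2 < N
  2<N = <-by (1+2ν≤N ⊹ ↑ 0<ν ⊹ ↑ 0<ν) (solve (ν ∷ N ∷ []))

  private
    1≡1+i-i : ∀ i → 1ℤ ≡ 1ℤ + i - i
    1≡1+i-i i = solve (i ∷ [])

    2≡ : + 2 ≡ 1ℤ + ν - (ν - 1ℤ)
    2≡ = solve (ν ∷ [])

  root-adjacent : ∀ {i} → 0ℤ < i → i < ν → IsRoot generic i (1ℤ + i)
  root-adjacent {i} 0<i i<ν = root-generic
    (between⇒notMultiple 0<i (<-trans i<ν ν<N))
    (between⇒notMultiple 0<1+i (≤-<-trans (i<j⇒suc[i]≤j i<ν) ν<N))
    (subst NotMultiple (1≡1+i-i i) (between⇒notMultiple (+<+ (ℕ.s≤s ℕ.z≤n)) 1<N))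
    (between⇒notMultiple {1ℤ + i + i} (<-by (<⇒≤ 0<1+i ⊹ ↑ 0<i) (solve (i ∷ [])))
      (<-by (↑ i<ν ⊹ <⇒≤ i<ν ⊹ 1+2ν≤N) (solve (i ∷ ν ∷ N ∷ []))))
    where
    0<1+i : 0ℤ < 1ℤ + i
    0<1+i = <-by (<⇒≤ 0<i) (solve (i ∷ []))

  simple-adjacent : ∀ {f i} → Reflects f i (1ℤ + i) → Simple f i (1ℤ + i)
  simple-adjacent R .reflects = R
  simple-adjacent {i = i} R .ordered = <-by (≤-refl {i}) (solve (i ∷ []))
  simple-adjacent {i = i} R .narrow = subst (_< N) (1≡1+i-i i) 1<N
  simple-adjacent {i = i} R .between y p q _ = ⊥-elim (⊥-by 0 (↑ p ⊹ ↑ q) (solve (i ∷ y ∷ [])))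

  simple-firstC : ∀ {f} → Reflects f -1ℤ 1ℤ → Simple f -1ℤ 1ℤ
  simple-firstC R .reflects = R
  simple-firstC R .ordered = -<+
  simple-firstC R .narrow = 2<N
  simple-firstC R .between y p q _ =
    ≤-antisym (≤-by (↑ q) (solve (y ∷ []))) (≤-by (↑ p) (solve (y ∷ [])))

  module _ (1<ν : 1ℤ < ν) where

    private
      3<N : + 3 < N
      3<N = <-by (1+2ν≤N ⊹ ↑ 1<ν ⊹ <⇒≤ 1<ν) (solve (ν ∷ N ∷ []))

    root-firstD : IsRoot generic (- + 2) 1ℤ
    root-firstD = root-generic
      (neg-notMultiple (between⇒notMultiple (+<+ (ℕ.s≤s ℕ.z≤n)) 2<N))
      (between⇒notMultiple (+<+ (ℕ.s≤s ℕ.z≤n)) 1<N)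
      (between⇒notMultiple (+<+ (ℕ.s≤s ℕ.z≤n)) 3<N)
      (neg-notMultiple (between⇒notMultiple (+<+ (ℕ.s≤s ℕ.z≤n)) 1<N))

    simple-firstD : ∀ {f} → Reflects f (- + 2) 1ℤ → Simple f (- + 2) 1ℤ
    simple-firstD R .reflects = R
    simple-firstD R .ordered = -<+
    simple-firstD R .narrow = 3<N
    simple-firstD {f} R .between y p q e with y ≟ -1ℤ
    -- The inner point -1 is not fixed: it goes to 2, the negative of the image of 1.
    ... | yes refl = contradiction (trans (sym e) (trans (R .mirrored .mirror 1ℤ) (cong -_ (R .right)))) λ ()
    ... | no y≢-1 = ≤-antisym (≤-by (↑ q) (solve (y ∷ []))) (≤-by (↑ -1<y) (solve (y ∷ [])))
      where
      -1<y : -1ℤ < y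
      -1<y = ≤∧≢⇒< (i<j⇒suc[i]≤j p) (y≢-1 ∘ sym)

    root-lastD : IsRoot generic (ν - 1ℤ) (1ℤ + ν)
    root-lastD = root-generic
      (between⇒notMultiple {ν - 1ℤ} (<-by (↑ 1<ν) (solve (ν ∷ [])))
            (suc[i]≤j⇒i<j {ν - 1ℤ} (≤-slack 1 {c = 1ℤ + (ν - 1ℤ)} (1+2ν≤N ⊹ <⇒≤ 0<ν) (solve (ν ∷ N ∷ [])))))
      (between⇒notMultiple {1ℤ + ν} (<-by (<⇒≤ 0<ν) (solve (ν ∷ [])))
        (<-by (1+2ν≤N ⊹ ↑ 0<ν) (solve (ν ∷ N ∷ []))))
      (subst NotMultiple 2≡ (between⇒notMultiple (+<+ (ℕ.s≤s ℕ.z≤n)) 2<N))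
      (between⇒notMultiple {1ℤ + ν + (ν - 1ℤ)} (<-by (↑ 0<ν ⊹ <⇒≤ 0<ν) (solve (ν ∷ [])))
        (<-by 1+2ν≤N (solve (ν ∷ N ∷ []))))

    simple-lastD : ∀ {f} → Reflects f (ν - 1ℤ) (1ℤ + ν) → Simple f (ν - 1ℤ) (1ℤ + ν)
    simple-lastD R .reflects = R
    simple-lastD R .ordered =
          suc[i]≤j⇒i<j {ν - 1ℤ} (≤-slack 1 {c = 1ℤ + (ν - 1ℤ)} (≤-refl {ν}) (solve (ν ∷ [])))
    simple-lastD R .narrow = subst (_< N) 2≡ 2<N
    -- The only inner point `ν` equals `N - (1ℤ + ν)` and goes to `N - (ν - 1ℤ)`, which is ν + 2.
    simple-lastD {f} R .between y p q e = ⊥-elim (⊥-by 1 (≡⇒≤ N-[ν-1]≡ν ⊹ 1+2ν≤N) (solve (ν ∷ N ∷ [])))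
      where
      y≡ν : y ≡ ν
      y≡ν = ≤-antisym (≤-by (↑ q) (solve (y ∷ ν ∷ []))) (≤-by (↑ p) (solve (y ∷ ν ∷ [])))
      ν≡ : ν ≡ N - (1ℤ + ν)
      ν≡ = ≡-by (sym N≡) (solve (ν ∷ N ∷ []))
      N-[ν-1]≡ν : N - (ν - 1ℤ) ≡ ν
      N-[ν-1]≡ν = begin
        N - (ν - 1ℤ)         ≡⟨ cong (λ z → N - z) (R .right) ⟨
        N - f (1ℤ + ν)       ≡⟨ reflect (R .mirrored) (1ℤ + ν) ⟨
        f (N - (1ℤ + ν))     ≡⟨ cong f ν≡ ⟨
        f ν                  ≡⟨ cong f y≡ν ⟨
        f y                  ≡⟨ e ⟩
        y                    ≡⟨ y≡ν ⟩
        ν                    ∎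
        where open ≡-Reasoning

  quotient-unique : ∀ {q q′ r r′} → 0ℤ ≤ r → r < N → 0ℤ ≤ r′ → r′ < N →
                    r + q * N ≡ r′ + q′ * N → q ≡ q′
  quotient-unique {q} {q′} {r} {r′} 0≤r r<N 0≤r′ r′<N e = ≡-by (≤-antisym
    (multiple<N (q - q′) (<-by (≡⇒≤ e ⊹ ↑ r′<N ⊹ 0≤r) (solve (q ∷ q′ ∷ r ∷ r′ ∷ N ∷ []))))
    (-N<multiple (q - q′) (<-by (≡⇒≤ (sym e) ⊹ ↑ r<N ⊹ 0≤r′) (solve (q ∷ q′ ∷ r ∷ r′ ∷ N ∷ [])))))
    (solve (q ∷ q′ ∷ []))

  remainder-unique : ∀ {q q′ r r′} → q ≡ q′ → r + q * N ≡ r′ + q′ * N → r ≡ r′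
  remainder-unique {q} {r = r} {r′} refl e = ≡-by e (solve (q ∷ r ∷ r′ ∷ N ∷ []))

  crosses-0 : ∀ {f x} → Simple f -1ℤ 1ℤ → x ≤ 0ℤ → 0ℤ < f x → x ≡ -1ℤ
  crosses-0 {f} {x} S x≤0 0<fx = at (up S (≤-<-trans x≤0 0<fx)) 0<fx
    where
    k≡0 : ∀ k → -1ℤ + k * N ≤ 0ℤ → 0ℤ < 1ℤ + k * N → k ≡ 0ℤ
    k≡0 k p q = ≤-antisym
      (multiple<N k (<-by (p ⊹ <⇒≤ 2<N) (solve (k ∷ N ∷ []))))
      (-N<multiple k (<-by (↑ q ⊹ <⇒≤ 1<N) (solve (k ∷ N ∷ []))))
    at : ∀ {y} → Up -1ℤ 1ℤ x y → 0ℤ < y → x ≡ -1ℤ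
    at (plus k refl refl) q rewrite k≡0 k x≤0 q = refl
    at (minus k refl refl) q rewrite k≡0 k x≤0 q = refl

  crosses-ν : ∀ {f x} → Simple f ν (1ℤ + ν) → x ≤ ν → ν < f x → x ≡ ν
  crosses-ν {f} {x} S x≤ν ν<fx = at (up S (≤-<-trans x≤ν ν<fx)) ν<fx
    where
    at : ∀ {y} → Up ν (1ℤ + ν) x y → ν < y → x ≡ ν
    at (plus k refl refl) q = ≤-antisym x≤ν (≤-by (↑ q) (solve (ν ∷ k ∷ N ∷ [])))
    at (minus k refl refl) q = ≤-antisym x≤ν (≤-by (↑ q) (solve (ν ∷ k ∷ N ∷ [])))

-- Words and length

Injective : (ℤ → ℤ) → Set
Injective f = ∀ {x y} → f x ≡ f y → x ≡ y

mirrored-fun : ∀ {n} (w : MirroredPermutation n) → Mirrored (+ period n) (fun w)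
mirrored-fun w .shift = MirroredPermutation.shift w
mirrored-fun w .mirror = MirroredPermutation.mirror w

injective-fun : ∀ {n} (w : MirroredPermutation n) → Injective (fun w)
injective-fun w = bijective w .proj₁

infixr 9 _∙_
_∙_ : ∀ {n} → MirroredPermutation n → MirroredPermutation n → MirroredPermutation n
fun (v ∙ w) = fun v ∘ fun w
bijective (v ∙ w) = w .bijective .proj₁ ∘ v .bijective .proj₁ , λ z →
  let y , y↦ = v .bijective .proj₂ z
      x , x↦ = w .bijective .proj₂ y
  in x , λ e → y↦ (x↦ e)
MirroredPermutation.shift (v ∙ w) = Mirrored.shift (∘-mirrored (mirrored-fun v) (mirrored-fun w))
MirroredPermutation.mirror (v ∙ w) = Mirrored.mirror (∘-mirrored (mirrored-fun v) (mirrored-fun w))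

identity : ∀ {n} → MirroredPermutation n
fun identity = id
bijective identity = id , λ y → y , id
MirroredPermutation.shift identity _ = refl
MirroredPermutation.mirror identity _ = refl

reflectionᵖ : ∀ {n f a b} → Reflections.Reflects (+ period n) f a b → MirroredPermutation n
fun (reflectionᵖ {f = f} R) = f
bijective (reflectionᵖ {n} {f} R) = involutive⇒injective ff , λ y → f y , λ { refl → ff y }
  where
  ff : ∀ z → f (f z) ≡ z
  ff = Reflections.involutive (+ period n) R
MirroredPermutation.shift (reflectionᵖ {n} R) = Mirrored.shift (Reflections.mirrored {+ period n} R)
MirroredPermutation.mirror (reflectionᵖ {n} R) = Mirrored.mirror (Reflections.mirrored {+ period n} R)

period≡ : ∀ n → + period n ≡ 1ℤ + (+ n + + n)
period≡ n = cong (λ m → + suc (n ℕ.+ m)) (ℕ.+-identityʳ n)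

module Words (t : AffineType) (n : ℕ) (0<n : 0 ℕ.< n) where

  open Reflections (+ period n)
  open Roots (+ n) (+ period n) (period≡ n) (+<+ 0<n)

  Letter : Set
  Letter = Fin (suc n)

  g : Letter → ℤ → ℤ
  g = generator t n

  -- What exchange uses about the generators. `obeys` tests every letter against the kind of every
  -- root of the same type.
  record RootDatum : Set where
    field
      a b    : Letter → ℤ
      kind   : Letter → Kind
      simple : ∀ i → Simple (g i) (a i) (b i)
      root   : ∀ i → IsRoot (kind i) (a i) (b i)
      obeys  : ∀ i j → Obeys (g j) (kind i)

    g-mirrored : ∀ i → Mirrored (+ period n) (g i)
    g-mirrored i = simple i .reflects .mirrored

    g-involutive : ∀ i z → g i (g i z) ≡ z
    g-involutive i = involutive (simple i .reflects)

    g-injective : ∀ i → Injective (g i)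
    g-injective i = involutive⇒injective (g-involutive i)

    generatorᵖ : Letter → MirroredPermutation n
    generatorᵖ i = reflectionᵖ (simple i .reflects)

    evalᵖ : List Letter → MirroredPermutation n
    evalᵖ [] = identity
    evalᵖ (i ∷ is) = generatorᵖ i ∙ evalᵖ is

    eval-evalᵖ : ∀ is → fun (evalᵖ is) ≗ eval t n is
    eval-evalᵖ [] z = refl
    eval-evalᵖ (i ∷ is) z = cong (g i) (eval-evalᵖ is z)

    eval-mirrored : ∀ is → Mirrored (+ period n) (eval t n is)
    eval-mirrored [] = id-mirrored
    eval-mirrored (i ∷ is) = ∘-mirrored (g-mirrored i) (eval-mirrored is)

    eval-injective : ∀ is → Injective (eval t n is)
    eval-injective [] e = e
    eval-injective (i ∷ is) e = eval-injective is (g-injective i e)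

    eval-++ : ∀ is js z → eval t n (is ++ js) z ≡ eval t n is (eval t n js z)
    eval-++ [] js z = refl
    eval-++ (i ∷ is) js z = cong (g i) (eval-++ is js z)

    Descent : (ℤ → ℤ) → Letter → Set
    Descent w i = w (b i) < w (a i)

    -- The pair a i < b i is carried along the word; the letter that reverses it is the reflection
    -- in the current pair, so that it can be cancelled against g i.
    exchange : ∀ i is → Descent (eval t n is) i →
               ∃[ js ] length is ≡ suc (length js) × eval t n js ≗ eval t n is ∘ g i
    exchange i [] d = contradiction d (<-asym (simple i .ordered))
    exchange i (j ∷ is) d with <-cmp (eval t n is (a i)) (eval t n is (b i))
    ... | tri> _ _ d′ =
      let js , len , e = exchange i is d′
      in j ∷ js , cong suc len , λ z → cong (g j) (e z)
    ... | tri≈ _ e _ = contradiction (eval-injective is e) (<⇒≢ (simple i .ordered))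
    ... | tri< x<y _ _ = is , refl , λ z → begin
        u z               ≡⟨ g-involutive j (u z) ⟨
        g j (g j (u z))   ≡⟨ cong (g j) (conjugate (eval-mirrored is) (eval-injective is)
                               (simple i .reflects) swaps z) ⟩
        g j (u (g i z))   ∎
      where
      open ≡-Reasoning
      u : ℤ → ℤ
      u = eval t n is
      gx≡y : g j (u (a i)) ≡ u (b i)
      gx≡y = obeys i j (root-map (kind i) (eval-mirrored is) (eval-injective is) (root i)) x<y d
      swaps : Reflects (g j) (u (a i)) (u (b i))
      swaps = subst (Reflects (g j) (u (a i))) gx≡y
        (reflects-moved (simple j .reflects) λ e → <⇒≢ x<y (trans (sym e) gx≡y))

    exchange′ : ∀ {w} i is → eval t n is ≗ w → Descent w i →
                ∃[ js ] length is ≡ suc (length js) × eval t n js ≗ w ∘ g i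
    exchange′ i is e d =
      let js , len , e′ = exchange i is (subst₂ _<_ (sym (e _)) (sym (e _)) d)
      in js , len , λ z → trans (e′ z) (e _)

    append : ∀ {w} i is → eval t n is ≗ w ∘ g i → eval t n (is ++ i ∷ []) ≗ w
    append {w} i is e z =
      trans (eval-++ is (i ∷ []) z) (trans (e (g i z)) (cong w (g-involutive i z)))

    length-snoc : ∀ (is : List Letter) {i} → length (is ++ i ∷ []) ≡ suc (length is)
    length-snoc is = trans (length-++ is) (ℕ.+-comm (length is) 1)

    -- The lower bound comes from exchange: every word of `w` yields a word of `w ∘ g i` with one
    -- letter less.
    length-descent : ∀ {w k} i → HasLength t n (w ∘ g i) k → Descent w i → HasLength t n w (suc k)
    length-descent {w} {k} i ((is , e , len) , least) d =
        (is ++ i ∷ [] , append i is e , trans (length-snoc is) (cong suc len))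
      , λ js e′ → let ks , len′ , e″ = exchange′ i js e′ d
                  in subst (suc k ℕ.≤_) (sym len′) (ℕ.s≤s (least ks e″))

    minimal⇒sorted : ∀ {w} → IsMinimalRep t n w → ∀ i → ¬ Descent w (Fin.suc i)
    minimal⇒sorted {w} (k , ((is , e , len) , least) , minimal) i d =
      ℕ.<-irrefl refl (ℕ.≤-trans (ℕ.≤-reflexive (trans (sym shorter) len))
            (minimal (g (Fin.suc i)) (i ∷ [] , λ _ → refl) _ short))
      where
      exchanged = exchange′ (Fin.suc i) is e d
      js = exchanged .proj₁
      shorter : length is ≡ suc (length js)
      shorter = exchanged .proj₂ .proj₁
      -- Minimality compares exact lengths, so `js` must be shown shortest: a word of
      -- `w ∘ g (Fin.suc i)` followed by that letter is a word of `w`, and `k` is least among those.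
      short : HasLength t n (w ∘ g (Fin.suc i)) (length js)
      short = (js , exchanged .proj₂ .proj₂ , refl) , λ ks e′ →
        ℕ.s≤s⁻¹ (subst₂ ℕ._≤_ (trans (sym len) shorter) (length-snoc ks)
          (least (ks ++ Fin.suc i ∷ []) (append (Fin.suc i) ks e′)))

    Sorted : (ℤ → ℤ) → Set
    Sorted w = ∀ i → ¬ Descent w (Fin.suc i)

    module _ (Φ : (ℤ → ℤ) → ℕ)
             (Φ-descent : ∀ w i → Descent (fun w) i → Φ (fun (w ∙ generatorᵖ i)) ℕ.< Φ (fun w))
      where

      -- Besides the sorted element, a conversion of all words of `w` is kept, so that it can be
      -- applied to a shortest word of a coset member.
      Sorting : MirroredPermutation n → Set
      Sorting w = ∃[ is ] Sorted (fun w ∘ eval t n (List.map Fin.suc is))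
        × (∀ js → eval t n js ≗ fun w →
           ∃[ ks ] eval t n ks ≗ fun w ∘ eval t n (List.map Fin.suc is) × length ks ℕ.≤ length js)

      sort : ∀ w → Sorting w
      sort w = go w (<-wellFounded (Φ (fun w)))
        where
        go : ∀ w → Acc ℕ._<_ (Φ (fun w)) → Sorting w
        go w (acc rec) with any? (λ i → fun w (b (Fin.suc i)) <? fun w (a (Fin.suc i)))
        ... | no none = [] , (λ i d → none (i , d)) , λ js e → js , e , ℕ.≤-refl
        ... | yes (i , d) =
          let is , sorted , shorten = go (w ∙ generatorᵖ (Fin.suc i)) (rec (Φ-descent w (Fin.suc i) d))
          in i ∷ is , sorted , λ js e →
            let js′ , len , e′ = exchange′ (Fin.suc i) js e d
                ks , e″ , len′ = shorten js′ e′
            in ks , e″ , ℕ.≤-trans len′ (ℕ.≤-trans (ℕ.n≤1+n _) (ℕ.≤-reflexive (sym len)))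

      module _ (G : MirroredPermutation n → Set)
               (G-∙ : ∀ w i → G w → G (w ∙ generatorᵖ i))
               (G-cong : ∀ {v w} → fun v ≗ fun w → G v → G w)
               (G-id : ∀ w → G w → (∀ i → ¬ Descent (fun w) i) → fun w ≗ id)
               (G-unique : ∀ v w → G v → G w → Sorted (fun v) → Sorted (fun w) → ∀ is →
                           fun w ≗ fun v ∘ eval t n (List.map Fin.suc is) → fun w ≗ fun v)
        where

        -- Removing a descent lowers `Φ` and accounts for exactly one letter; where no descent is
        -- left, the element is the identity and the empty word is shortest.
        hasLength : ∀ w → G w → ∃[ k ] HasLength t n (fun w) k
        hasLength w = go w (<-wellFounded (Φ (fun w)))
          where
          go : ∀ w → Acc ℕ._<_ (Φ (fun w)) → G w → ∃[ k ] HasLength t n (fun w) k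
          go w (acc rec) G-w with any? (λ i → fun w (b i) <? fun w (a i))
          ... | no none = 0 , ([] , (λ z → sym (G-id w G-w (λ i d → none (i , d)) z)) , refl) , λ _ _ → ℕ.z≤n
          ... | yes (i , d) =
            let k , len = go (w ∙ generatorᵖ i) (rec (Φ-descent w i d)) (G-∙ w i G-w)
            in suc k , length-descent i len d

        G-∙* : ∀ w is → G w → G (w ∙ evalᵖ is)
        G-∙* w [] = G-cong λ _ → refl
        G-∙* w (i ∷ is) G-w = G-cong (λ _ → refl) (G-∙* (w ∙ generatorᵖ i) is (G-∙ w i G-w))

        sorted⇒minimal : ∀ w → G w → Sorted (fun w) → IsMinimalRep t n (fun w)
        sorted⇒minimal w G-w sorted = k , len , least
          where
          k = hasLength w G-w .proj₁
          len = hasLength w G-w .proj₂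
          least : ∀ v → InParabolic t n v → ∀ l → HasLength t n (fun w ∘ v) l → k ℕ.≤ l
          least v (js , e) l ((es , e′ , refl) , _) = ℕ.≤-trans (len .proj₂ ks ks≗w) ks≤es
            where
            js⁺ = List.map Fin.suc js
            w′ = w ∙ evalᵖ js⁺
            is = sort w′ .proj₁
            is⁺ = List.map Fin.suc is
            w″ = w′ ∙ evalᵖ is⁺
            w″≗ : fun w″ ≗ fun w′ ∘ eval t n is⁺
            w″≗ z = cong (fun w′) (eval-evalᵖ is⁺ z)
            in-coset : fun w″ ≗ fun w ∘ eval t n (List.map Fin.suc (js ++ is))
            in-coset z = cong (fun w) (trans (eval-evalᵖ js⁺ _) (trans (cong (eval t n js⁺) (eval-evalᵖ is⁺ z))
              (trans (sym (eval-++ js⁺ is⁺ z)) (cong (λ ls → eval t n ls z) (sym (map-++ Fin.suc js is))))))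
            sorted″ : Sorted (fun w″)
            sorted″ i d = sort w′ .proj₂ .proj₁ i (subst₂ _<_ (w″≗ _) (w″≗ _) d)
            w″≗w : fun w″ ≗ fun w
            w″≗w = G-unique w w″ G-w (G-∙* w′ is⁺ (G-∙* w js⁺ G-w)) sorted sorted″ (js ++ is) in-coset
            shorter = sort w′ .proj₂ .proj₂ es λ z →
              trans (e′ z) (cong (fun w) (trans (sym (e z)) (sym (eval-evalᵖ js⁺ z))))
            ks = shorter .proj₁
            ks≗w : eval t n ks ≗ fun w
            ks≗w z = trans (shorter .proj₂ .proj₁ z) (trans (sym (w″≗ z)) (w″≗w z))
            ks≤es : length ks ℕ.≤ length es
            ks≤es = shorter .proj₂ .proj₂

open Equivalence using (to; from)

-- Parity

-- Keeps the number that `EvenCardinality` hides, so that sets whose sizes differ by one can be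
-- compared.
Card : {A : Set} → (A → Set) → ℕ → Set
Card P k = ∃[ xs ] Unique xs × (∀ x → x ∈ xs ⇔ P x) × length xs ≡ k

module _ {A : Set} where

  even⇒card : {P : A → Set} → EvenCardinality P → ∃[ k ] Card P k × 2 ∣ k
  even⇒card (xs , u , m , e) = length xs , (xs , u , m , refl) , e

  card⇒even : ∀ {P : A → Set} {k} → Card P k → 2 ∣ k → EvenCardinality P
  card⇒even (xs , u , m , refl) e = xs , u , m , e

  card-cong : ∀ {P Q : A → Set} {k} → (∀ x → P x ⇔ Q x) → Card P k → Card Q k
  card-cong P⇔Q (xs , u , m , l) =
    xs , u , (λ x → mk⇔ (P⇔Q x .to ∘ m x .to) (m x .from ∘ P⇔Q x .from)) , l

  even-cong : ∀ {P Q : A → Set} → (∀ x → P x ⇔ Q x) → EvenCardinality P → EvenCardinality Q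
  even-cong P⇔Q E = let k , C , e = even⇒card E in card⇒even (card-cong P⇔Q C) e

  card-unique : ∀ {P : A → Set} {j k} → Card P j → Card P k → j ≡ k
  card-unique (xs , u , m , refl) (ys , v , m′ , refl) = ↭-length (∼bag⇒↭ (unique∧set⇒bag u v λ {x} →
    mk⇔ (m′ x .from ∘ m x .to) (m x .from ∘ m′ x .to)))

  card-insert : ∀ {P : A → Set} {k q} → ¬ P q → Card P k → Card (λ x → x ≡ q ⊎ P x) (suc k)
  card-insert {P} {q = q} q∉ (xs , u , m , l) = q ∷ xs
    , All.tabulate (λ {x} x∈ q≡x → q∉ (subst P (sym q≡x) (m x .to x∈))) AllPairs.∷ u
    , (λ x → mk⇔ (λ { (here e) → inj₁ e ; (there x∈) → inj₂ (m x .to x∈) })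
                 (λ { (inj₁ e) → here e ; (inj₂ p) → there (m x .from p) }))
    , cong suc l

module _ {A B : Set} {f : A → B} (f-injective : ∀ {x y} → f x ≡ f y → x ≡ y)
         {P : A → Set} {Q : B → Set} (P⇔Q∘f : ∀ x → P x ⇔ Q (f x)) (Q⊆f : ∀ y → Q y → ∃[ x ] f x ≡ y) where

  card-map⁺ : ∀ {k} → Card P k → Card Q k
  card-map⁺ (xs , u , m , l) = List.map f xs , Unique.map⁺ f-injective u
    , (λ y → mk⇔ (λ y∈ → let x , x∈ , y≡ = ∈-map⁻ f y∈ in subst Q (sym y≡) (P⇔Q∘f x .to (m x .to x∈)))
                 (λ q → let x , fx≡y = Q⊆f y q
                        in subst (_∈ List.map f xs) fx≡y
                             (∈-map⁺ f (m x .from (P⇔Q∘f x .from (subst Q (sym fx≡y) q))))))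
    , trans (length-map f xs) l

  card-map⁻ : ∀ {k} → Card Q k → Card P k
  card-map⁻ (ys , u , m , refl) with preimage (All.tabulate λ {y} → m y .to)
    where
    preimage : ∀ {ys} → All.All Q ys → ∃[ xs ] List.map f xs ≡ ys
    preimage All.[] = [] , refl
    preimage (q All.∷ qs) =
      let x , e = Q⊆f _ q
          xs , es = preimage qs
      in x ∷ xs , cong₂ _∷_ e es
  ... | xs , refl = xs , Unique.map⁻ u
    , (λ x → mk⇔ (λ x∈ → P⇔Q∘f x .from (m (f x) .to (∈-map⁺ f x∈)))
                 (λ p → let x′ , x′∈ , e = ∈-map⁻ f (m (f x) .from (P⇔Q∘f x .to p))
                        in subst (_∈ xs) (sym (f-injective e)) x′∈))
    , sym (length-map f xs)

  even-map⁺ : EvenCardinality P → EvenCardinality Q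
  even-map⁺ E = let k , C , e = even⇒card E in card⇒even (card-map⁺ C) e

  even-map⁻ : EvenCardinality Q → EvenCardinality P
  even-map⁻ E = let k , C , e = even⇒card E in card⇒even (card-map⁻ C) e

parity : ∀ k → (2 ∣ k × ¬ 2 ∣ suc k) ⊎ (¬ 2 ∣ k × 2 ∣ suc k)
parity 0 = inj₁ (2 ∣0 , λ 2∣1 → contradiction (∣1⇒≡1 2∣1) λ ())
parity (suc k) with parity k
... | inj₁ (even , odd) = inj₂ (odd , ∣m∣n⇒∣m+n ∣-refl even)
... | inj₂ (odd , even) = inj₁ (even , λ e → odd (∣m+n∣m⇒∣n e ∣-refl))

module _ {A B : Set} {P : A → Set} {Q : B → Set} {k : ℕ} where

  -- Evenness of `k` is decided by `parity`, and uniqueness of the cardinality excludes an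
  -- enumeration of the other parity; hence all four implications hold constructively.
  card-suc⇒flip : Card P k → Card Q (suc k) →
                  (EvenCardinality P → ¬ EvenCardinality Q) × (¬ EvenCardinality P → EvenCardinality Q)
                × (EvenCardinality Q → ¬ EvenCardinality P) × (¬ EvenCardinality Q → EvenCardinality P)
  card-suc⇒flip C D with parity k
  ... | inj₁ (even , odd) = (λ _ → ¬Q) , contradiction (card⇒even C even) ,
        (λ e → contradiction e ¬Q) , λ _ → card⇒even C even
    where
    ¬Q : ¬ EvenCardinality Q
    ¬Q E = let _ , D′ , e = even⇒card E in odd (subst (2 ∣_) (card-unique D′ D) e)
  ... | inj₂ (odd , even) = (λ e → contradiction e ¬P) , (λ _ → card⇒even D even) ,
        (λ _ → ¬P) , contradiction (card⇒even D even)
    where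
    ¬P : ¬ EvenCardinality P
    ¬P E = let _ , C′ , e = even⇒card E in odd (subst (2 ∣_) (card-unique C′ C) e)

-- For `c` equal to `0ℤ` and `+ n` this unfolds to the conditions in `EvenAtZero` and `EvenAtN`, so
-- both parities share one theory.
Above : ℤ → (ℤ → ℤ) → ℤ → Set
Above c f i = i ≤ c × 1ℤ + c ≤ f i

Bounded : (ℤ → ℤ) → Set
Bounded f = ∃[ D ] ∀ i → f i ≤ i + + D

offset : ∀ {c i} → i ≤ c → ∃[ m ] i ≡ c - + m
offset {c} {i} i≤c = ℤ.∣ c - i ∣ , rearrange (+ ℤ.∣ c - i ∣) (0≤i⇒+∣i∣≡i (i≤j⇒0≤j-i i≤c))
  where
  rearrange : ∀ d → d ≡ c - i → i ≡ c - d
  rearrange d e = ≡-by e (solve (c ∷ i ∷ d ∷ []))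

offset-bound : ∀ c m d → 1ℤ + c ≤ c - m + d → m < d
offset-bound c m d p = <-by p (solve (c ∷ m ∷ d ∷ []))

-- A bound `D` on the rise leaves only the candidates `c - + m` with m < D.
above-finite : ∀ c {f} → Bounded f → ∃[ k ] Card (Above c f) k
above-finite c {f} (D , f≤) =
      _ , filter above? range , Unique.filter⁺ above? {xs = range} (Unique.map⁺ c--injective (Unique.upTo⁺ D))
  , (λ i → mk⇔ sound (complete i)) , refl
  where
  above? : ∀ i → Dec (1ℤ + c ≤ f i)
  above? i = 1ℤ + c ≤? f i
  range : List ℤ
  range = List.map (λ m → c - + m) (upTo D)
  c--injective : ∀ {l m} → c - + l ≡ c - + m → l ≡ m
  c--injective {l} {m} e = +-injective (aux (+ l) (+ m) e)
    where
    aux : ∀ x y → c - x ≡ c - y → x ≡ y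
    aux x y e = ≡-by (sym e) (solve (c ∷ x ∷ y ∷ []))
  sound : ∀ {i} → i ∈ filter above? range → Above c f i
  sound i∈ with ∈-filter⁻ above? {xs = range} i∈
  ... | i∈range , c<fi with ∈-map⁻ (λ m → c - + m) i∈range
  ... | m , _ , refl = i-j≤i c (+ m) , c<fi
  complete : ∀ i → Above c f i → i ∈ filter above? range
  complete i (i≤c , c<fi) with offset i≤c
  ... | m , refl = ∈-filter⁺ above?
        (∈-map⁺ (λ m → c - + m) (∈-upTo⁺ (drop‿+<+ (offset-bound c (+ m) (+ D) (≤-trans c<fi (f≤ _)))))) c<fi

above-preserved : ∀ {c f g} → (∀ z → g (g z) ≡ z) → (∀ {z} → z ≤ c → g z ≤ c) →
                  EvenCardinality (Above c f) → EvenCardinality (Above c (f ∘ g))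
above-preserved {c} {f} {g} gg g≤ = even-map⁺ {f = g} (involutive⇒injective gg)
  (λ x → mk⇔ (λ (x≤ , fx) → g≤ x≤ , subst (λ z → 1ℤ + c ≤ f z) (sym (gg x)) fx)
              (λ (gx≤ , fx) → subst (_≤ c) (gg x) (g≤ gx≤) , subst (λ z → 1ℤ + c ≤ f z) (gg x) fx))
  (λ y _ → g y , gg y)

-- The behaviour of `s₀ᶜ` at threshold 0 and of `sₙᶜ` at threshold n: a single pair crosses.
record Swaps (c : ℤ) (g : ℤ → ℤ) (p q : ℤ) : Set where
  field
    twice : ∀ z → g (g z) ≡ z
    p≤c : p ≤ c
    c<q : c < q
    gp≡q : g p ≡ q
    else : ∀ {z} → z ≢ p → z ≤ c → g z ≤ c

module _ {c : ℤ} {g : ℤ → ℤ} {p q : ℤ} (S : Swaps c g p q) where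

  open Swaps S

  -- The involution `g` carries the old set into the new one, and exactly `p` is added, because its
  -- value is now `f q`.
  above-insert : ∀ {f k} → c < f q → f p ≤ c → Card (Above c f) k → Card (Above c (f ∘ g)) (suc k)
  above-insert {f} c<fq fp≤c C =
        card-cong equiv (card-insert p∉
        (card-map⁺ {f = g} (involutive⇒injective twice)
        (λ x → mk⇔ (λ a → subst (Above c f) (sym (twice x)) a) (λ a → subst (Above c f) (twice x) a))
        (λ y _ → g y , twice y) C))
    where
    p∉ : ¬ Above c f (g p)
    p∉ (gp≤c , _) = <⇒≱ c<q (subst (_≤ c) gp≡q gp≤c)
    equiv : ∀ x → (x ≡ p ⊎ Above c f (g x)) ⇔ Above c (f ∘ g) x
    equiv x = mk⇔ fwd bwd
      where
      fwd : x ≡ p ⊎ Above c f (g x) → Above c (f ∘ g) x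
      fwd (inj₁ refl) = p≤c , i<j⇒suc[i]≤j (subst (λ z → c < f z) (sym gp≡q) c<fq)
      fwd (inj₂ (gx≤c , above)) = subst (_≤ c) (twice x) (else gx≢p gx≤c) , above
        where
        gx≢p : g x ≢ p
        gx≢p refl = <⇒≱ (suc[i]≤j⇒i<j above) fp≤c
      bwd : Above c (f ∘ g) x → x ≡ p ⊎ Above c f (g x)
      bwd (x≤c , above) with x ≟ p
      ... | yes x≡p = inj₁ x≡p
      ... | no x≢p = inj₂ (else x≢p x≤c , above)

  above-flip : ∀ {f} → Bounded f → Bounded (f ∘ g) → (c < f q × f p ≤ c) ⊎ (c < f p × f q ≤ c) →
               (EvenCardinality (Above c f) → ¬ EvenCardinality (Above c (f ∘ g)))
             × (¬ EvenCardinality (Above c f) → EvenCardinality (Above c (f ∘ g)))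
  above-flip {f} B B′ (inj₁ (c<fq , fp≤c)) =
    let _ , C = above-finite c B
        x , y , _ = card-suc⇒flip C (above-insert c<fq fp≤c C)
    in x , y
  -- Now composing with `g` removes a point, so the insertion is applied to `f ∘ g`, which a second
  -- `g` turns back into `f`.
  above-flip {f} B B′ (inj₂ (c<fp , fq≤c)) =
    let _ , C = above-finite c B′
        gq≡p = trans (cong g (sym gp≡q)) (twice p)
        _ , _ , x , y = card-suc⇒flip C (above-insert (subst (λ z → c < f z) (sym gq≡p) c<fp)
                                             (subst (λ z → f z ≤ c) (sym gp≡q) fq≤c) C)
        untwist : ∀ i → Above c (f ∘ g ∘ g) i ⇔ Above c f i
        untwist i = mk⇔ (λ (i≤c , a) → i≤c , subst (λ z → 1ℤ + c ≤ f z) (twice i) a)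
                        (λ (i≤c , a) → i≤c , subst (λ z → 1ℤ + c ≤ f z) (sym (twice i)) a)
    in x ∘ even-cong (λ i → mk⇔ (untwist i .from) (untwist i .to)) , λ odd → y (odd ∘ even-cong untwist)

-- Windows

module Windows (n : ℕ) (0<n : 0 ℕ.< n) where

  open Reflections (+ period n)
  open Roots (+ n) (+ period n) (period≡ n) (+<+ 0<n)

  N : ℤ
  N = + period n

  division : ∀ z {q r} → r ℕ.< period n → z ≡ + r + q * N → z /ℕ period n ≡ q × z %ℕ period n ≡ r
  division z {q} {r} r<N e = q≡ , +-injective (remainder-unique {q = z /ℕ period n} {q} q≡ e′)
    where
    e′ : + (z %ℕ period n) + z /ℕ period n * N ≡ + r + q * N
    e′ = trans (sym (a≡a%ℕn+[a/ℕn]*n z (period n))) e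
    q≡ : z /ℕ period n ≡ q
    q≡ = quotient-unique (+≤+ ℕ.z≤n) (+<+ (n%ℕd<d z (period n))) (+≤+ ℕ.z≤n) (+<+ r<N) e′

  n<period : n ℕ.< period n
  n<period = ℕ.s≤s (ℕ.m≤m+n n _)

  -- Here j stands for the index suc j of the window.
  data Position : ℤ → Set where
    multiple : ∀ k → Position (k * N)
    above    : ∀ k {j} → j ℕ.< n → Position (+ suc j + k * N)
    below    : ∀ k {j} → j ℕ.< n → Position (- (+ suc j) + k * N)

  position : ∀ z → Position z
  position z with z %ℕ period n in r≡ | a≡a%ℕn+[a/ℕn]*n z (period n)
  ... | 0 | e = subst Position (sym (trans e (+-identityˡ _))) (multiple (z /ℕ period n))
  ... | suc r | e with r ℕ.<? n
  ...   | yes r<n = subst Position (sym e) (above (z /ℕ period n) r<n)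
  -- A remainder above n is N minus an index of the window, which raises the quotient by one.
  ...   | no r≮n = subst Position (sym (trans e (flip (+ suc r) (+ suc j) (z /ℕ period n) N N≡)))
                     (below (1ℤ + z /ℕ period n) j<n)
    where
    suc-r≤ : suc r ℕ.≤ 2 ℕ.* n
    suc-r≤ = ℕ.s≤s⁻¹ (subst (ℕ._< period n) r≡ (n%ℕd<d z (period n)))
    j = 2 ℕ.* n ℕ.∸ suc r
    j<n : j ℕ.< n
    j<n = ℕ.+-cancelʳ-< (suc r) j n (subst (ℕ._< n ℕ.+ suc r) (sym (ℕ.m∸n+n≡m suc-r≤))
            (subst (ℕ._< n ℕ.+ suc r) (cong (n ℕ.+_) (sym (ℕ.+-identityʳ n)))
                  (ℕ.+-monoʳ-< n (ℕ.s≤s (ℕ.≮⇒≥ r≮n)))))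
    N≡ : N ≡ + suc j + + suc r
    N≡ = cong (+_ ∘ suc) (sym (ℕ.m∸n+n≡m suc-r≤))
    flip : ∀ r j q N → N ≡ j + r → r + q * N ≡ - j + (1ℤ + q) * N
    flip r j q N refl = solve (r ∷ j ∷ q ∷ [])

  ≤ᵇ-true : ∀ {a b} → a ℕ.≤ b → (a ℕ.≤ᵇ b) ≡ true
  ≤ᵇ-true {a} {b} p = dec-true (a ℕ.≤? b) p

  ≤ᵇ-false : ∀ {a b} → b ℕ.< a → (a ℕ.≤ᵇ b) ≡ false
  ≤ᵇ-false {a} {b} p = dec-false (a ℕ.≤? b) (ℕ.<⇒≱ p)

  2n∸n≡n : 2 ℕ.* n ℕ.∸ n ≡ n
  2n∸n≡n = trans (ℕ.m+n∸m≡n n (n ℕ.+ 0)) (ℕ.+-identityʳ n)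

  module _ (h : ℕ → ℤ) where

    private
      extend-zero : ∀ z {q} → z /ℕ period n ≡ q × z %ℕ period n ≡ 0 → extend n h z ≡ q * N
      extend-zero z (refl , r≡) with z %ℕ period n | r≡
      ... | _ | refl = refl

      extend-low : ∀ z {q r} → r ℕ.< n → z /ℕ period n ≡ q × z %ℕ period n ≡ suc r →
                   extend n h z ≡ q * N + h (suc r)
      extend-low z {r = r} r<n (refl , r≡) with z %ℕ period n | r≡
      ... | _ | refl rewrite ≤ᵇ-true r<n = refl

      extend-high : ∀ z {q r} → n ℕ.≤ r → z /ℕ period n ≡ q × z %ℕ period n ≡ suc r →
                    extend n h z ≡ (q + 1ℤ) * N - h (2 ℕ.* n ℕ.∸ r)
      extend-high z {r = r} n≤r (refl , r≡) with z %ℕ period n | r≡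
      ... | _ | refl rewrite ≤ᵇ-false (ℕ.s≤s n≤r) = refl

    extend-multiple : ∀ k → extend n h (k * N) ≡ k * N
    extend-multiple k = extend-zero (k * N) {k} (division (k * N) {k} (ℕ.s≤s ℕ.z≤n) (sym (+-identityˡ _)))

    extend-above : ∀ k {j} → j ℕ.< n → extend n h (+ suc j + k * N) ≡ h (suc j) + k * N
    extend-above k {j} j<n =
      trans (extend-low z {k} j<n (division z {k} (ℕ.<-≤-trans (ℕ.s≤s j<n) n<period) refl))
            (+-comm (k * N) (h (suc j)))
      where
      z = + suc j + k * N

    extend-below : ∀ k {j} → j ℕ.< n → extend n h (- (+ suc j) + k * N) ≡ - h (suc j) + k * N
    extend-below k {j} j<n = begin
      -- Division leaves a nonnegative remainder, here N minus the index, and so lowers the quotient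
      -- to `k - 1ℤ`.
      extend n h z                              ≡⟨ extend-high z {k - 1ℤ} n≤r
            (division z {k - 1ℤ} suc-r<N (flip (+ suc r) (+ suc j) k N N≡)) ⟩
      (k - 1ℤ + 1ℤ) * N - h (2 ℕ.* n ℕ.∸ r)     ≡⟨ cong (λ m → (k - 1ℤ + 1ℤ) * N - h m) (ℕ.m∸[m∸n]≡n suc-j≤) ⟩
      (k - 1ℤ + 1ℤ) * N - h (suc j)             ≡⟨ simplify (h (suc j)) k N ⟩
      - h (suc j) + k * N                       ∎
      where
      open ≡-Reasoning
      z = - (+ suc j) + k * N
      r = 2 ℕ.* n ℕ.∸ suc j
      suc-j≤ : suc j ℕ.≤ 2 ℕ.* n
      suc-j≤ = ℕ.≤-trans j<n (ℕ.m≤m+n n _)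
      n≤r : n ℕ.≤ r
      n≤r = subst (ℕ._≤ r) 2n∸n≡n (ℕ.∸-monoʳ-≤ (2 ℕ.* n) j<n)
      suc-r<N : suc r ℕ.< period n
      suc-r<N = ℕ.s≤s (ℕ.∸-monoʳ-< (ℕ.s≤s ℕ.z≤n) suc-j≤)
      N≡ : N ≡ + suc j + + suc r
      N≡ = cong (+_ ∘ suc) (sym (trans (ℕ.+-suc j r) (ℕ.m+[n∸m]≡n suc-j≤)))
      flip : ∀ r j q N → N ≡ j + r → - j + q * N ≡ r + (q - 1ℤ) * N
      flip r j q N refl = solve (r ∷ j ∷ q ∷ [])
      simplify : ∀ x k N → (k - 1ℤ + 1ℤ) * N - x ≡ - x + k * N
      simplify = solve-∀

    extend-mirrored : Mirrored N (extend n h)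
    extend-mirrored .shift x = by-position (position x)
      where
      next : ∀ a k N → a + k * N + N ≡ a + (1ℤ + k) * N
      next = solve-∀
      next₀ : ∀ k N → k * N + N ≡ (1ℤ + k) * N
      next₀ = solve-∀
      by-position : ∀ {x} → Position x → extend n h (x + N) ≡ extend n h x + N
      by-position (multiple k) = begin
        extend n h (k * N + N)                ≡⟨ cong (extend n h) (next₀ k N) ⟩
        extend n h ((1ℤ + k) * N)             ≡⟨ extend-multiple (1ℤ + k) ⟩
        (1ℤ + k) * N                          ≡⟨ next₀ k N ⟨
        k * N + N                             ≡⟨ cong (_+ N) (extend-multiple k) ⟨
        extend n h (k * N) + N                ∎
        where open ≡-Reasoning
      by-position (above k {j} p) = begin
        extend n h (+ suc j + k * N + N)      ≡⟨ cong (extend n h) (next (+ suc j) k N) ⟩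
        extend n h (+ suc j + (1ℤ + k) * N)   ≡⟨ extend-above (1ℤ + k) p ⟩
        h (suc j) + (1ℤ + k) * N              ≡⟨ next (h (suc j)) k N ⟨
        h (suc j) + k * N + N                 ≡⟨ cong (_+ N) (extend-above k p) ⟨
        extend n h (+ suc j + k * N) + N      ∎
        where open ≡-Reasoning
      by-position (below k {j} p) = begin
        extend n h (- (+ suc j) + k * N + N)      ≡⟨ cong (extend n h) (next (- (+ suc j)) k N) ⟩
        extend n h (- (+ suc j) + (1ℤ + k) * N)   ≡⟨ extend-below (1ℤ + k) p ⟩
        - h (suc j) + (1ℤ + k) * N                ≡⟨ next (- h (suc j)) k N ⟨
        - h (suc j) + k * N + N                   ≡⟨ cong (_+ N) (extend-below k p) ⟨
        extend n h (- (+ suc j) + k * N) + N      ∎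
        where open ≡-Reasoning
    extend-mirrored .mirror x = by-position (position x)
      where
      negate : ∀ a k N → - (a + k * N) ≡ - a + (- k) * N
      negate = solve-∀
      negate₋ : ∀ a k N → - (- a + k * N) ≡ a + (- k) * N
      negate₋ = solve-∀
      negate₀ : ∀ k N → - (k * N) ≡ (- k) * N
      negate₀ = solve-∀
      by-position : ∀ {x} → Position x → extend n h (- x) ≡ - extend n h x
      by-position (multiple k) = begin
        extend n h (- (k * N))      ≡⟨ cong (extend n h) (negate₀ k N) ⟩
        extend n h ((- k) * N)      ≡⟨ extend-multiple (- k) ⟩
        (- k) * N                   ≡⟨ negate₀ k N ⟨
        - (k * N)                   ≡⟨ cong -_ (extend-multiple k) ⟨
        - extend n h (k * N)        ∎
        where open ≡-Reasoning
      by-position (above k {j} p) = begin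
        extend n h (- (+ suc j + k * N))      ≡⟨ cong (extend n h) (negate (+ suc j) k N) ⟩
        extend n h (- (+ suc j) + (- k) * N)  ≡⟨ extend-below (- k) p ⟩
        - h (suc j) + (- k) * N               ≡⟨ negate (h (suc j)) k N ⟨
        - (h (suc j) + k * N)                 ≡⟨ cong -_ (extend-above k p) ⟨
        - extend n h (+ suc j + k * N)        ∎
        where open ≡-Reasoning
      by-position (below k {j} p) = begin
        extend n h (- (- (+ suc j) + k * N))  ≡⟨ cong (extend n h) (negate₋ (+ suc j) k N) ⟩
        extend n h (+ suc j + (- k) * N)      ≡⟨ extend-above (- k) p ⟩
        h (suc j) + (- k) * N                 ≡⟨ negate₋ (h (suc j)) k N ⟨
        - (- h (suc j) + k * N)               ≡⟨ cong -_ (extend-below k p) ⟨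
        - extend n h (- (+ suc j) + k * N)    ∎
        where open ≡-Reasoning

    extend-window : ∀ {j} → j ℕ.< n → extend n h (+ suc j) ≡ h (suc j)
    extend-window {j} j<n = begin
      extend n h (+ suc j)              ≡⟨ cong (extend n h) (+-identityʳ (+ suc j)) ⟨
      extend n h (+ suc j + 0ℤ * N)     ≡⟨ extend-above 0ℤ j<n ⟩
      h (suc j) + 0ℤ * N                ≡⟨ +-identityʳ (h (suc j)) ⟩
      h (suc j)                         ∎
      where open ≡-Reasoning

    -- Orbits and fixed points are stable under negation and translation, so `rest` has to be
    -- checked at 1, ..., n only.
    extend-reflects : ∀ {a b} → extend n h a ≡ b → extend n h b ≡ a →
      (∀ {j} → j ℕ.< n → (Orbit a (+ suc j) ⊎ Orbit b (+ suc j)) ⊎ h (suc j) ≡ + suc j) →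
      Reflects (extend n h) a b
    extend-reflects {a} {b} fa fb window .mirrored = extend-mirrored
    extend-reflects {a} {b} fa fb window .left = fa
    extend-reflects {a} {b} fa fb window .right = fb
    extend-reflects {a} {b} fa fb window .rest z = by-position (position z)
      where
      by-position : ∀ {z} → Position z → (Orbit a z ⊎ Orbit b z) ⊎ extend n h z ≡ z
      by-position (multiple k) = inj₂ (extend-multiple k)
      by-position (above k p) = map (map (orbit-shift k) (orbit-shift k))
        (λ e → trans (extend-above k p) (cong (_+ k * N) e)) (window p)
      by-position (below k p) = map (map (orbit-shift k ∘ orbit-neg) (orbit-shift k ∘ orbit-neg))
        (λ e → trans (extend-below k p) (cong (λ x → - x + k * N) e)) (window p)

  private
    i≤∣i∣ : ∀ i → i ≤ + ℤ.∣ i ∣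
    i≤∣i∣ (+ _) = ≤-refl
    i≤∣i∣ -[1+ _ ] = -≤+

    maximum : ∀ (D : ℕ → ℕ) m → ∃[ M ] ∀ {j} → j ℕ.< m → D j ℕ.≤ M
    maximum D 0 = 0 , λ ()
    maximum D (suc m) = M ℕ.⊔ D m , λ j<suc-m → by-cases (ℕ.m≤n⇒m<n∨m≡n (ℕ.s≤s⁻¹ j<suc-m))
      where
      M = maximum D m .proj₁
      by-cases : ∀ {j} → j ℕ.< m ⊎ j ≡ m → D j ℕ.≤ M ℕ.⊔ D m
      by-cases (inj₁ j<m) = ℕ.≤-trans (maximum D m .proj₂ j<m) (ℕ.m≤m⊔n M (D m))
      by-cases (inj₂ refl) = ℕ.m≤n⊔m M (D m)

  -- The displacement is periodic and odd, so its largest absolute value on 1, ..., n bounds it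
  -- everywhere; negated indices use the opposite sign.
  bounded : ∀ {f} → Mirrored N f → Bounded f
  bounded {f} F = M , λ z → by-position (position z)
    where
    D : ℕ → ℕ
    D j = ℤ.∣ f (+ suc j) - + suc j ∣
    M = maximum D n .proj₁
    ≤M : ∀ {j} → j ℕ.< n → f (+ suc j) - + suc j ≤ + M
    ≤M {j} p = ≤-trans (i≤∣i∣ _) (+≤+ (maximum D n .proj₂ p))
    -≤M : ∀ {j} → j ℕ.< n → - (f (+ suc j) - + suc j) ≤ + M
    -≤M {j} p = ≤-trans (i≤∣i∣ _)
          (≤-trans (≤-reflexive (cong +_ (∣-i∣≡∣i∣ (f (+ suc j) - + suc j)))) (+≤+ (maximum D n .proj₂ p)))
    rise : ∀ j fj k N M → fj - j ≤ M → fj + k * N ≤ j + k * N + M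
    rise j fj k N M p = ≤-by p (solve (j ∷ fj ∷ k ∷ N ∷ M ∷ []))
    fall : ∀ j fj k N M → - (fj - j) ≤ M → - fj + k * N ≤ - j + k * N + M
    fall j fj k N M p = ≤-by p (solve (j ∷ fj ∷ k ∷ N ∷ M ∷ []))
    by-position : ∀ {z} → Position z → f z ≤ z + + M
    by-position (multiple k) = subst (_≤ k * N + + M) (sym (fixes-multiple F k)) (i≤i+j (k * N) (+ M))
    by-position (above k {j} p) = subst (_≤ + suc j + k * N + + M) (sym (shift* F k (+ suc j)))
      (rise (+ suc j) (f (+ suc j)) k N (+ M) (≤M p))
    by-position (below k {j} p) = subst (_≤ - (+ suc j) + k * N + + M) (sym (mirror-shift* F k (+ suc j)))
      (fall (+ suc j) (f (+ suc j)) k N (+ M) (-≤M p))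

-- The generators

<-slack : ∀ k {a b c d} → a ≤ b → b - a + + k ≡ d - (1ℤ + c) → c < d
<-slack k p e = suc[i]≤j⇒i<j (≤-slack k p e)

-- The squared displacement of the window.

sumUpTo : (ℕ → ℕ) → ℕ → ℕ
sumUpTo h 0 = 0
sumUpTo h (suc m) = sumUpTo h m ℕ.+ h m

sum-cong : ∀ {h h′} m → (∀ {j} → j ℕ.< m → h′ j ≡ h j) → sumUpTo h′ m ≡ sumUpTo h m
sum-cong 0 e = refl
sum-cong (suc m) e = cong₂ ℕ._+_ (sum-cong m (e ∘ ℕ.m<n⇒m<1+n)) (e ℕ.≤-refl)

sum-decrease₁ : ∀ {h h′ p} m → p ℕ.< m → h′ p ℕ.< h p → (∀ {j} → j ℕ.< m → j ≢ p → h′ j ≡ h j) →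
                sumUpTo h′ m ℕ.< sumUpTo h m
sum-decrease₁ {h} {h′} {p} (suc m) p<suc-m h′p<hp e with p ℕ.≟ m
... | yes refl = ℕ.+-mono-≤-< (ℕ.≤-reflexive (sum-cong m λ j<m → e (ℕ.m<n⇒m<1+n j<m) (ℕ.<⇒≢ j<m))) h′p<hp
... | no p≢m = ℕ.+-mono-<-≤
      (sum-decrease₁ m (ℕ.≤∧≢⇒< (ℕ.s≤s⁻¹ p<suc-m) p≢m) h′p<hp (λ j<m → e (ℕ.m<n⇒m<1+n j<m)))
                 (ℕ.≤-reflexive (e ℕ.≤-refl (p≢m ∘ sym)))

sum-decrease₂ : ∀ {h h′ p} m → suc p ℕ.< m → h′ p ℕ.+ h′ (suc p) ℕ.< h p ℕ.+ h (suc p) →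
                (∀ {j} → j ℕ.< m → j ≢ p → j ≢ suc p → h′ j ≡ h j) →
                sumUpTo h′ m ℕ.< sumUpTo h m
sum-decrease₂ {h} {h′} {p} (suc m) p<m less e with suc p ℕ.≟ m
... | yes refl = subst₂ ℕ._<_ (sym (ℕ.+-assoc (sumUpTo h′ p) _ _)) (sym (ℕ.+-assoc (sumUpTo h p) _ _))
  (ℕ.+-mono-≤-< (ℕ.≤-reflexive (sum-cong p λ j<p →
    e (ℕ.m<n⇒m<1+n (ℕ.m<n⇒m<1+n j<p)) (ℕ.<⇒≢ j<p) (ℕ.<⇒≢ (ℕ.m<n⇒m<1+n j<p)))) less)
... | no sp≢m = ℕ.+-mono-<-≤ (sum-decrease₂ m sp<m less (λ j<m → e (ℕ.m<n⇒m<1+n j<m)))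
                  (ℕ.≤-reflexive (e ℕ.≤-refl (ℕ.<⇒≢ (ℕ.<-trans (ℕ.n<1+n p) sp<m) ∘ sym) (sp≢m ∘ sym)))
  where
  sp<m : suc p ℕ.< m
  sp<m = ℕ.≤∧≢⇒< (ℕ.s≤s⁻¹ p<m) sp≢m

square : ℤ → ℕ
square z = ℤ.∣ z ∣ ℕ.* ℤ.∣ z ∣

+square : ∀ z → + square z ≡ z * z
+square (+ n) = pos-* n n
+square -[1+ n ] = refl

square<₁ : ∀ {a c} → a * a < c * c → square a ℕ.< square c
square<₁ {a} {c} p = drop‿+<+ (subst₂ _<_ (sym (+square a)) (sym (+square c)) p)

square<₂ : ∀ {a b c d} → a * a + b * b < c * c + d * d →
           square a ℕ.+ square b ℕ.< square c ℕ.+ square d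
square<₂ {a} {b} {c} {d} p = drop‿+<+ (subst₂ _<_ (expand a b) (expand c d) p)
  where
  expand : ∀ a b → a * a + b * b ≡ + (square a ℕ.+ square b)
  expand a b = sym (trans (pos-+ (square a) (square b)) (cong₂ _+_ (+square a) (+square b)))

displacement : (ℤ → ℤ) → ℕ → ℕ
displacement f j = square (f (+ suc j) - + suc j)

-- At a descent w b < w a the squares of the values cancel, and the sum drops by 2 (b - a) (w a - w
-- b), or by half of this for central and half pairs. The coefficient is the number of copies of the
-- hypothesis here and in the next four inequalities; the slack is one less.
swap-shrinks : ∀ i x y → y < x →
  (y - i) * (y - i) + (x - (1ℤ + i)) * (x - (1ℤ + i)) < (x - i) * (x - i) + (y - (1ℤ + i)) * (y - (1ℤ + i))
swap-shrinks i x y p = <-slack 1 (↑ p ⊹ ↑ p) (solve (i ∷ x ∷ y ∷ []))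

square-firstC : ∀ x → x < - x → (- x - 1ℤ) * (- x - 1ℤ) < (x - 1ℤ) * (x - 1ℤ)
square-firstC x p = <-slack 1 (↑ p ⊹ ↑ p) (solve (x ∷ []))

square-firstD : ∀ x y → x < - y →
  (- y - 1ℤ) * (- y - 1ℤ) + (- x - + 2) * (- x - + 2) < (x - 1ℤ) * (x - 1ℤ) + (y - + 2) * (y - + 2)
square-firstD x y p = <-slack 5 (↑ p ⊹ ↑ p ⊹ ↑ p ⊹ ↑ p ⊹ ↑ p ⊹ ↑ p) (solve (x ∷ y ∷ []))

square-lastC : ∀ ν N x → N ≡ 1ℤ + (ν + ν) → N - x < x →
  (N - x - ν) * (N - x - ν) < (x - ν) * (x - ν)
square-lastC ν N x refl p = <-slack 0 (↑ p) (solve (ν ∷ x ∷ []))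

square-lastD : ∀ μ N x y → N ≡ 1ℤ + ((1ℤ + μ) + (1ℤ + μ)) → N - y < x →
  (N - y - μ) * (N - y - μ) + (N - x - (1ℤ + μ)) * (N - x - (1ℤ + μ)) < (x - μ) * (x - μ) +
        (y - (1ℤ + μ)) * (y - (1ℤ + μ))
square-lastD μ N x y refl p = <-slack 3 (↑ p ⊹ ↑ p ⊹ ↑ p ⊹ ↑ p) (solve (μ ∷ x ∷ y ∷ []))

≡ᵇ-true : ∀ a → (a ℕ.≡ᵇ a) ≡ true
≡ᵇ-true a = dec-true (a ℕ.≟ a) refl

≡ᵇ-false : ∀ {a b} → a ≢ b → (a ℕ.≡ᵇ b) ≡ false
≡ᵇ-false {a} {b} = dec-false (a ℕ.≟ b)

-- Rank at least 2 is common to the four types and provides the indices 2 and n - 1 on which `s₀ᴰ`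
-- and `sₙᴰ` act.
module Generators (m : ℕ) where

  n = suc (suc m)

  0<n : 0 ℕ.< n
  0<n = ℕ.s≤s ℕ.z≤n

  1<n : 1 ℕ.< n
  1<n = ℕ.s≤s (ℕ.s≤s ℕ.z≤n)

  open Windows n 0<n
  open Reflections (+ period n)
  open Roots (+ n) (+ period n) (period≡ n) (+<+ 0<n)

  Φ : (ℤ → ℤ) → ℕ
  Φ f = sumUpTo (displacement f) n

  s : ℕ → ℤ → ℤ
  s i = extend n (swapWindow i)

  firstC firstD lastC lastD : ℤ → ℤ
  firstC = extend n s₀ᶜ
  firstD = extend n s₀ᴰ
  lastC = extend n (sₙᶜ n)
  lastD = extend n (sₙᴰ n)

  swap-left : ∀ i → swapWindow i i ≡ + suc i
  swap-left i rewrite ≡ᵇ-true i = refl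

  swap-right : ∀ i → swapWindow i (suc i) ≡ + i
  swap-right i rewrite ≡ᵇ-false (ℕ.1+n≢n {i}) | ≡ᵇ-true i = refl

  swap-rest : ∀ {i j} → j ≢ i → j ≢ suc i → swapWindow i j ≡ + j
  swap-rest p q rewrite ≡ᵇ-false p | ≡ᵇ-false q = refl

  lastC-left : sₙᶜ n n ≡ + suc n
  lastC-left rewrite ≡ᵇ-true m = refl

  lastC-rest : ∀ {j} → j ≢ n → sₙᶜ n j ≡ + j
  lastC-rest p rewrite ≡ᵇ-false p = refl

  lastD-left : sₙᴰ n n ≡ + suc (suc n)
  lastD-left rewrite ≡ᵇ-true m = refl

  lastD-right : sₙᴰ n (suc m) ≡ + suc n
  lastD-right rewrite ≡ᵇ-false (ℕ.1+n≢n {m} ∘ sym) | ≡ᵇ-true m = refl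

  lastD-rest : ∀ {j} → j ≢ n → suc j ≢ n → sₙᴰ n j ≡ + j
  lastD-rest p q rewrite ≡ᵇ-false p | ≡ᵇ-false q = refl

  s-reflects : ∀ {i} → suc i ℕ.< n → Reflects (s (suc i)) (+ suc i) (+ suc (suc i))
  s-reflects {i} i<n = extend-reflects (swapWindow (suc i))
    (trans (extend-window (swapWindow (suc i)) (ℕ.<-trans (ℕ.n<1+n i) i<n)) (swap-left (suc i)))
    (trans (extend-window (swapWindow (suc i)) i<n) (swap-right (suc i)))
    (λ {j} _ → window j)
    where
    window : ∀ j → (Orbit (+ suc i) (+ suc j) ⊎ Orbit (+ suc (suc i)) (+ suc j))
                 ⊎ swapWindow (suc i) (suc j) ≡ + suc j
    window j with j ℕ.≟ i | j ℕ.≟ suc i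
    ... | yes refl | _ = inj₁ (inj₁ (plus 0ℤ (sym (+-identityʳ _))))
    ... | no _ | yes refl = inj₁ (inj₂ (plus 0ℤ (sym (+-identityʳ _))))
    ... | no p | no q = inj₂ (swap-rest (p ∘ ℕ.suc-injective) (q ∘ ℕ.suc-injective))

  firstC-reflects : Reflects firstC -1ℤ 1ℤ
  firstC-reflects = extend-reflects s₀ᶜ
    (trans (extend-mirrored s₀ᶜ .mirror 1ℤ) (cong -_ (extend-window s₀ᶜ 0<n)))
    (extend-window s₀ᶜ 0<n)
    (λ { {0} _ → inj₁ (inj₂ (plus 0ℤ refl)) ; {suc _} _ → inj₂ refl })

  firstD-reflects : Reflects firstD (- + 2) 1ℤ
  firstD-reflects = extend-reflects s₀ᴰ
    (trans (extend-mirrored s₀ᴰ .mirror (+ 2)) (cong -_ (extend-window s₀ᴰ 1<n)))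
    (extend-window s₀ᴰ 0<n)
    (λ { {0} _ → inj₁ (inj₂ (plus 0ℤ refl)) ; {1} _ → inj₁ (inj₁ (minus 0ℤ refl)) ; {suc (suc _)} _ →
          inj₂ refl })

  -- The values at n + 1 and n + 2, outside the window, come from w (N - x) = N - w x.
  N-n : + suc n ≡ N - + n
  N-n = aux (+ n) N (period≡ n)
    where
    aux : ∀ ν N → N ≡ 1ℤ + (ν + ν) → 1ℤ + ν ≡ N - ν
    aux ν N refl = solve (ν ∷ [])

  N-[n-1] : + suc (suc n) ≡ N - + suc m
  N-[n-1] = aux (+ suc m) N (period≡ n)
    where
    aux : ∀ μ N → N ≡ 1ℤ + ((1ℤ + μ) + (1ℤ + μ)) → 1ℤ + (1ℤ + (1ℤ + μ)) ≡ N - μ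
    aux μ N refl = solve (μ ∷ [])

  N-[n+1] : N - + suc n ≡ + n
  N-[n+1] = aux (+ n) N (period≡ n)
    where
    aux : ∀ ν N → N ≡ 1ℤ + (ν + ν) → N - (1ℤ + ν) ≡ ν
    aux ν N refl = solve (ν ∷ [])

  N-[n+2] : N - + suc (suc n) ≡ + suc m
  N-[n+2] = aux (+ suc m) N (period≡ n)
    where
    aux : ∀ μ N → N ≡ 1ℤ + ((1ℤ + μ) + (1ℤ + μ)) → N - (1ℤ + (1ℤ + (1ℤ + μ))) ≡ μ
    aux μ N refl = solve (μ ∷ [])

  beyond : ∀ {f} → Mirrored N f → f (+ suc n) ≡ N - f (+ n)
  beyond {f} F = trans (cong f N-n) (reflect F (+ n))

  beyond₂ : ∀ {f} → Mirrored N f → f (+ suc (suc n)) ≡ N - f (+ suc m)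
  beyond₂ {f} F = trans (cong f N-[n-1]) (reflect F (+ suc m))

  lastC-n : lastC (+ n) ≡ + suc n
  lastC-n = trans (extend-window (sₙᶜ n) ℕ.≤-refl) lastC-left

  lastC-reflects : Reflects lastC (+ n) (+ suc n)
  lastC-reflects = extend-reflects (sₙᶜ n) lastC-n
    (trans (beyond (extend-mirrored (sₙᶜ n))) (trans (cong (λ x → N - x) lastC-n) N-[n+1]))
    (λ {j} _ → window j)
    where
    window : ∀ j → (Orbit (+ n) (+ suc j) ⊎ Orbit (+ suc n) (+ suc j)) ⊎ sₙᶜ n (suc j) ≡ + suc j
    window j with suc j ℕ.≟ n
    ... | yes refl = inj₁ (inj₁ (plus 0ℤ (sym (+-identityʳ _))))
    ... | no p = inj₂ (lastC-rest p)

  lastD-n : lastD (+ n) ≡ + suc (suc n)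
  lastD-n = trans (extend-window (sₙᴰ n) ℕ.≤-refl) lastD-left

  lastD-reflects : Reflects lastD (+ suc m) (+ suc n)
  lastD-reflects = extend-reflects (sₙᴰ n) (trans (extend-window (sₙᴰ n) (ℕ.m<n⇒m<1+n (ℕ.n<1+n m))) lastD-right)
    (trans (beyond (extend-mirrored (sₙᴰ n))) (trans (cong (λ x → N - x) lastD-n) N-[n+2]))
    (λ {j} → window j)
    where
    window : ∀ j → j ℕ.< n → (Orbit (+ suc m) (+ suc j) ⊎ Orbit (+ suc n) (+ suc j)) ⊎ sₙᴰ n (suc j) ≡ + suc j
    window j j<n with suc j ℕ.≟ n | suc (suc j) ℕ.≟ n
    -- The index n equals -(n + 1) + N, so it lies in the orbit of the right end.
    ... | yes refl | _ =
          inj₁ (inj₂ (minus 1ℤ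
          (trans (sym N-[n+1]) (trans (+-comm N -[1+ n ]) (cong (λ x → -[1+ n ] + x) (sym (*-identityˡ N)))))))
    ... | no _ | yes refl = inj₁ (inj₁ (plus 0ℤ (sym (+-identityʳ _))))
    ... | no p | no q = inj₂ (lastD-rest p q)

  s-simple : ∀ {i} → suc i ℕ.< n → Simple (s (suc i)) (+ suc i) (+ suc (suc i))
  s-simple i<n = simple-adjacent (s-reflects i<n)

  firstC-simple : Simple firstC -1ℤ 1ℤ
  firstC-simple = simple-firstC firstC-reflects

  firstD-simple : Simple firstD (- + 2) 1ℤ
  firstD-simple = simple-firstD (+<+ 1<n) firstD-reflects

  lastC-simple : Simple lastC (+ n) (+ suc n)
  lastC-simple = simple-adjacent lastC-reflects

  lastD-simple : Simple lastD (+ suc m) (+ suc n)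
  lastD-simple = simple-lastD (+<+ 1<n) lastD-reflects

  suc-n<N : + suc n < N
  suc-n<N = +<+ (ℕ.s≤s
        (ℕ.s≤s (ℕ.s≤s (subst (ℕ._≤ m ℕ.+ (n ℕ.+ 0)) (ℕ.+-comm m 1) (ℕ.+-monoʳ-≤ m (ℕ.s≤s ℕ.z≤n))))))

  s-low : ∀ {i} → suc i ℕ.< n → Low (+ suc i) (+ suc (suc i))
  s-low i<n = -≤+ , +≤+ i<n

  s-high : ∀ {i} → suc i ℕ.< n → High (+ suc i) (+ suc (suc i))
  s-high i<n = +<+ (ℕ.s≤s ℕ.z≤n) , ≤-<-trans (+≤+ (ℕ.m≤n⇒m≤1+n i<n)) suc-n<N

  firstC-low : Low -1ℤ 1ℤ
  firstC-low = -≤- ℕ.z≤n , +≤+ 0<n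

  firstD-low : Low (- + 2) 1ℤ
  firstD-low = -≤- (ℕ.s≤s ℕ.z≤n) , +≤+ 0<n

  lastC-high : High (+ n) (+ suc n)
  lastC-high = +<+ 0<n , suc-n<N

  lastD-high : High (+ suc m) (+ suc n)
  lastD-high = +<+ (ℕ.s≤s ℕ.z≤n) , suc-n<N

-- Kinds of roots in each type; effect of the generators on displacement and parity.

Central HalfIntegral : AffineType → Set
Central C̃/C = ⊤
Central B̃/B = ⊥
Central B̃/D = ⊤
Central D̃/D = ⊥
HalfIntegral C̃/C = ⊤
HalfIntegral B̃/B = ⊤
HalfIntegral B̃/D = ⊥
HalfIntegral D̃/D = ⊥

Allowed : AffineType → Kind → Set
Allowed t generic = ⊤
Allowed t central = Central t
Allowed t half = HalfIntegral t

module Descents (m : ℕ) where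

  open Generators m
  open Windows n 0<n
  open Reflections (+ period n)
  open Roots (+ n) (+ period n) (period≡ n) (+<+ 0<n)

  Shrinks : (ℤ → ℤ) → ℤ → ℤ → Set
  Shrinks f a b = ∀ {w} → Mirrored N w → w b < w a → Φ (w ∘ f) ℕ.< Φ w

  private
    shrink₁ : ∀ {w f p X} → p ℕ.< n → w (f (+ suc p)) ≡ X →
              (X - + suc p) * (X - + suc p) < (w (+ suc p) - + suc p) * (w (+ suc p) - + suc p) →
              (∀ {j} → j ℕ.< n → j ≢ p → f (+ suc j) ≡ + suc j) → Φ (w ∘ f) ℕ.< Φ w
    shrink₁ {w} {f} {p} p<n refl less fixed =
      sum-decrease₁ n p<n (square<₁ {w (f (+ suc p)) - + suc p} {w (+ suc p) - + suc p} less) λ {j} j<n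
            j≢p → cong (λ z → square (w z - + suc j)) (fixed j<n j≢p)

    shrink₂ : ∀ {w f p X Y} → suc p ℕ.< n → w (f (+ suc p)) ≡ X → w (f (+ suc (suc p))) ≡ Y →
              (X - + suc p) * (X - + suc p) + (Y - + suc (suc p)) * (Y - + suc (suc p))
                < (w (+ suc p) - + suc p) * (w (+ suc p) - + suc p)
                + (w (+ suc (suc p)) - + suc (suc p)) * (w (+ suc (suc p)) - + suc (suc p)) →
              (∀ {j} → j ℕ.< n → j ≢ p → j ≢ suc p → f (+ suc j) ≡ + suc j) → Φ (w ∘ f) ℕ.< Φ w
    shrink₂ {w} {f} {p} p<n refl refl less fixed =
      sum-decrease₂ n p<n 
        (square<₂ {w (f (+ suc p)) - + suc p} {w (f (+ suc (suc p))) - + suc (suc p)}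
                  {w (+ suc p) - + suc p} {w (+ suc (suc p)) - + suc (suc p)} less)
        λ {j} j<n p q → cong (λ z → square (w z - + suc j)) (fixed j<n p q)

  s-shrinks : ∀ {i} → suc i ℕ.< n → Shrinks (s (suc i)) (+ suc i) (+ suc (suc i))
  s-shrinks {i} i<n {w} W d = shrink₂ {w} {s (suc i)} i<n
    (cong w (s-reflects i<n .left)) (cong w (s-reflects i<n .right))
    (swap-shrinks (+ suc i) (w (+ suc i)) (w (+ suc (suc i))) d)
    λ j<n j≢i j≢suc-i → trans (extend-window (swapWindow (suc i)) j<n)
                          (swap-rest (j≢i ∘ ℕ.suc-injective) (j≢suc-i ∘ ℕ.suc-injective))

  firstC-shrinks : Shrinks firstC -1ℤ 1ℤ
  firstC-shrinks {w} W d = shrink₁ {w} {firstC} 0<n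
    (trans (cong w (firstC-reflects .right)) (W .mirror 1ℤ))
    (square-firstC (w 1ℤ) (subst (w 1ℤ <_) (W .mirror 1ℤ) d))
    λ { {0} _ p → contradiction refl p ; {suc _} j<n _ → extend-window s₀ᶜ j<n }

  firstD-shrinks : Shrinks firstD (- + 2) 1ℤ
  firstD-shrinks {w} W d = shrink₂ {w} {firstD} 1<n
    (trans (cong w (firstD-reflects .right)) (W .mirror (+ 2)))
    (trans (cong w (extend-window s₀ᴰ 1<n)) (W .mirror 1ℤ))
    (square-firstD (w 1ℤ) (w (+ 2)) (subst (w 1ℤ <_) (W .mirror (+ 2)) d))
    λ { {0} _ p _ → contradiction refl p ; {1} _ _ p → contradiction refl p ; {suc (suc _)} j<n _ _ →
          extend-window s₀ᴰ j<n }

  lastC-shrinks : Shrinks lastC (+ n) (+ suc n)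
  lastC-shrinks {w} W d = shrink₁ {w} {lastC} {suc m} ℕ.≤-refl
    (trans (cong w lastC-n) (beyond W))
    (square-lastC (+ n) N (w (+ n)) (period≡ n) (subst (_< w (+ n)) (beyond W) d))
    λ j<n j≢ → trans (extend-window (sₙᶜ n) j<n) (lastC-rest (j≢ ∘ ℕ.suc-injective))

  lastD-shrinks : Shrinks lastD (+ suc m) (+ suc n)
  lastD-shrinks {w} W d = shrink₂ {w} {lastD} {m} ℕ.≤-refl
    (trans (cong w (lastD-reflects .left)) (beyond W))
    (trans (cong w lastD-n) (beyond₂ W))
    (square-lastD (+ suc m) N (w (+ suc m)) (w (+ n)) (period≡ n) (subst (_< w (+ suc m)) (beyond W) d))
    λ j<n p q → trans (extend-window (sₙᴰ n) j<n)
          (lastD-rest (q ∘ ℕ.suc-injective) (p ∘ ℕ.suc-injective ∘ ℕ.suc-injective))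

  Even₀ Evenₙ : (ℤ → ℤ) → Set
  Even₀ w = EvenCardinality (Above 0ℤ w)
  Evenₙ w = EvenCardinality (Above (+ n) w)

  above-cong : ∀ {c v w} → v ≗ w → EvenCardinality (Above c v) → EvenCardinality (Above c w)
  above-cong {c} e = even-cong λ i → mk⇔ (λ (p , q) → p , subst (1ℤ + c ≤_) (e i) q)
                                         (λ (p , q) → p , subst (1ℤ + c ≤_) (sym (e i)) q)

  Parity : ((ℤ → ℤ) → Set) → (ℤ → ℤ) → Set
  Parity E f = ∀ {w} → Mirrored N w → Injective w → E w → E (w ∘ f)

  Flips : ((ℤ → ℤ) → Set) → (ℤ → ℤ) → Set
  Flips E f = ∀ {w} → Mirrored N w → Injective w → (E w → ¬ E (w ∘ f)) × (¬ E w → E (w ∘ f))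

  high⇒even₀ : ∀ {f a b} → Simple f a b → High a b → Parity Even₀ f
  high⇒even₀ S H _ _ = above-preserved (involutive (S .reflects)) (high-preserves S H)

  low⇒evenₙ : ∀ {f a b} → Simple f a b → Low a b → Parity Evenₙ f
  low⇒evenₙ S L _ _ = above-preserved (involutive (S .reflects)) (low-preserves S L)

  -- The values of `w` at 1 and -1 are opposite and nonzero, so exactly one of them is positive.
  firstC-flips : Flips Even₀ firstC
  firstC-flips {w} W inj = above-flip swaps (bounded W) (bounded (∘-mirrored W (extend-mirrored s₀ᶜ))) one-above
    where
    swaps : Swaps 0ℤ firstC -1ℤ 1ℤ
    swaps = record
      { twice = involutive firstC-reflects ; p≤c = -≤+ ; c<q = +<+ (ℕ.s≤s ℕ.z≤n) ; gp≡q = firstC-reflects .left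
      ; else = λ z≢-1 z≤0 → ≮⇒≥ λ 0<fz → z≢-1 (crosses-0 firstC-simple z≤0 0<fz) }
    one-above : (0ℤ < w 1ℤ × w -1ℤ ≤ 0ℤ) ⊎ (0ℤ < w -1ℤ × w 1ℤ ≤ 0ℤ)
    one-above with <-cmp 0ℤ (w 1ℤ)
    ... | tri< p _ _ = inj₁ (p , subst (_≤ 0ℤ) (sym (W .mirror 1ℤ)) (neg-mono-≤ (<⇒≤ p)))
    ... | tri≈ _ e _ = contradiction (inj (trans (fixes-0 W) e)) λ ()
    ... | tri> _ _ p = inj₂ (subst (0ℤ <_) (sym (W .mirror 1ℤ)) (neg-mono-< p) , <⇒≤ p)

  -- The values of `w` at n and n + 1 sum to 2n + 1, so exactly one of them exceeds n.
  lastC-flips : Flips Evenₙ lastC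
  lastC-flips {w} W inj =
        above-flip swaps (bounded W) (bounded (∘-mirrored W (extend-mirrored (sₙᶜ n)))) one-above
    where
    swaps : Swaps (+ n) lastC (+ n) (+ suc n)
    swaps = record
      { twice = involutive lastC-reflects ; p≤c = ≤-refl ; c<q = +<+ ℕ.≤-refl ; gp≡q = lastC-n
      ; else = λ z≢n z≤n → ≮⇒≥ λ n<fz → z≢n (crosses-ν lastC-simple z≤n n<fz) }
    image-above : ∀ ν N x → N ≡ 1ℤ + (ν + ν) → x ≤ ν → ν < N - x
    image-above ν N x refl p = <-by p (solve (ν ∷ x ∷ []))
    image-below : ∀ ν N x → N ≡ 1ℤ + (ν + ν) → ν < x → N - x ≤ ν
    image-below ν N x refl p = ≤-by (↑ p) (solve (ν ∷ x ∷ []))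
    one-above : (+ n < w (+ suc n) × w (+ n) ≤ + n) ⊎ (+ n < w (+ n) × w (+ suc n) ≤ + n)
    one-above with w (+ n) ≤? + n
    ... | yes p = inj₁ (subst (+ n <_) (sym (beyond W)) (image-above (+ n) N (w (+ n)) (period≡ n) p) , p)
    ... | no ¬p = inj₂ (≰⇒> ¬p , subst (_≤ + n) (sym (beyond W))
          (image-below (+ n) N (w (+ n)) (period≡ n) (≰⇒> ¬p)))

  -- Since f = u ∘ g ∘ u, the parity changes twice.
  conjugate-parity : ∀ {c f g u a b} → Mirrored N u → (∀ z → u (u z) ≡ z) →
    Flips (EvenCardinality ∘ Above c) u → Parity (EvenCardinality ∘ Above c) g →
    Reflects g a b → Reflects f (u a) (u b) → Parity (EvenCardinality ∘ Above c) f
  conjugate-parity {c} {f} {g} {u} U uu flips keeps G F {w} W inj even =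
    above-cong {c} f≗ugu
          (flips (∘-mirrored (∘-mirrored W U) (G .mirrored)) (λ e → g-inj (u-inj (inj e))) .proj₂ odd₂)
    where
    u-inj : Injective u
    u-inj = involutive⇒injective uu
    g-inj : Injective g
    g-inj = involutive⇒injective (involutive G)
    odd₁ : ¬ EvenCardinality (Above c (w ∘ u))
    odd₁ = flips W inj .proj₁ even
    -- `keeps` preserves evenness only; as `g` is an involution, it preserves oddness as well.
    odd₂ : ¬ EvenCardinality (Above c (w ∘ u ∘ g))
    odd₂ e = odd₁ (above-cong {c} (λ z → cong (w ∘ u) (involutive G z))
      (keeps (∘-mirrored (∘-mirrored W U) (G .mirrored)) (λ e → g-inj (u-inj (inj e))) e))
    f≗ugu : w ∘ u ∘ g ∘ u ≗ w ∘ f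
    f≗ugu z = cong w (trans (sym (conjugate U u-inj G F (u z))) (cong f (uu z)))

  -- `s₀ᴰ` is the conjugate of `s₁` by `s₀ᶜ`, which takes the pair (1, 2) to (-1, 2).
  firstD-even₀ : Parity Even₀ firstD
  firstD-even₀ = conjugate-parity (extend-mirrored s₀ᶜ) (involutive firstC-reflects)
    firstC-flips (high⇒even₀ (s-simple 1<n) (s-high 1<n)) (s-reflects 1<n)
    (subst₂ (Reflects firstD) (sym (extend-window s₀ᶜ 0<n)) (trans firstD[-1] (sym (extend-window s₀ᶜ 1<n)))
      (reflects-moved firstD-reflects λ e → contradiction (trans (sym firstD[-1]) e) λ ()))
    where
    firstD[-1] : firstD -1ℤ ≡ + 2
    firstD[-1] = trans (extend-mirrored s₀ᴰ .mirror 1ℤ) (cong -_ (extend-window s₀ᴰ 0<n))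

  -- `sₙᴰ` is the conjugate by `sₙᶜ` of the swap of n - 1 and n, whose pair becomes (n - 1, n + 1).
  lastD-evenₙ : Parity Evenₙ lastD
  lastD-evenₙ = conjugate-parity (extend-mirrored (sₙᶜ n)) (involutive lastC-reflects)
    lastC-flips (low⇒evenₙ (s-simple ℕ.≤-refl) (s-low ℕ.≤-refl)) (s-reflects ℕ.≤-refl)
    (subst₂ (Reflects lastD)
          (sym (trans (extend-window (sₙᶜ n) (ℕ.m<n⇒m<1+n (ℕ.n<1+n m)))
          (lastC-rest (ℕ.<⇒≢ (ℕ.n<1+n (suc m)))))) (sym lastC-n) lastD-reflects)

-- Sorted permutations

module Rigidity (m : ℕ) where

  open Generators m
  open Windows n 0<n
  open Descents m
  open Reflections (+ period n)
  open Roots (+ n) (+ period n) (period≡ n) (+<+ 0<n)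

  mirrored-ext : ∀ {v w} → Mirrored N v → Mirrored N w →
                 (∀ {j} → j ℕ.< n → v (+ suc j) ≡ w (+ suc j)) → v ≗ w
  mirrored-ext {v} {w} V W window z = by-position (position z)
    where
    by-position : ∀ {z} → Position z → v z ≡ w z
    by-position (multiple k) = trans (fixes-multiple V k) (sym (fixes-multiple W k))
    by-position (above k {j} p) = trans (shift* V k (+ suc j))
      (trans (cong (_+ k * N) (window p)) (sym (shift* W k (+ suc j))))
    by-position (below k {j} p) = trans (mirror-shift* V k (+ suc j))
      (trans (cong (λ x → - x + k * N) (window p)) (sym (mirror-shift* W k (+ suc j))))

  Chain : (ℤ → ℤ) → Set
  Chain w = ∀ {i} → suc i ℕ.< n → w (+ suc i) < w (+ suc (suc i))

  Increasing : (ℤ → ℤ) → Set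
  Increasing w = Chain w × w (+ n) < w (+ suc n)

  -- As w (n + 1) = N - w n, the last ascent means w n ≤ n, and n increasing integers between 1 and
  -- n leave no choice.
  rigid : ∀ {w} → Mirrored N w → 0ℤ < w 1ℤ → Increasing w → w ≗ id
  rigid {w} W 0<w1 (chain , last) = mirrored-ext W id-mirrored λ {j} j<n →
    ≤-antisym (upper (ℕ.∸-monoˡ-≤ 1 j<n)) (lower j<n)
    where
    lower : ∀ {j} → j ℕ.< n → + suc j ≤ w (+ suc j)
    lower {0} _ = i<j⇒suc[i]≤j 0<w1
    lower {suc j} j<n = ≤-trans (+-monoʳ-≤ 1ℤ (lower (ℕ.<-trans (ℕ.n<1+n j) j<n))) (i<j⇒suc[i]≤j (chain j<n))
    top : w (+ n) ≤ + n
    top = doubled≤ (subst (w (+ n) <_) (beyond W) last)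
    descend : ∀ d {j} → j ℕ.+ d ≡ suc m → w (+ suc j) ≤ + suc j
    descend 0 {j} e = subst (λ j → w (+ suc j) ≤ + suc j) (sym (trans (sym (ℕ.+-identityʳ j)) e)) top
    descend (suc d) {j} e =
          predecessor _ _ (≤-trans (i<j⇒suc[i]≤j (chain j<n)) (descend d (trans (sym (ℕ.+-suc j d)) e)))
      where
      j<n : suc j ℕ.< n
      j<n = ℕ.s≤s (subst (suc j ℕ.≤_) e (subst (suc j ℕ.≤_) (sym (ℕ.+-suc j d)) (ℕ.s≤s (ℕ.m≤m+n j d))))
      predecessor : ∀ x y → 1ℤ + x ≤ 1ℤ + y → x ≤ y
      predecessor x y p = ≤-by p (solve (x ∷ y ∷ []))
    upper : ∀ {j} → j ℕ.≤ suc m → w (+ suc j) ≤ + suc j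
    upper {j} j≤ = descend (suc m ℕ.∸ j) (ℕ.m+[n∸m]≡n j≤)

  -- For permutations: every bead of 𝒜 w is a bead of 𝒜 v.
  Image : (ℤ → ℤ) → (ℤ → ℤ) → Set
  Image v w = ∀ z → z < N → ∃[ y ] y < N × v y ≡ w z

  -- Preservation of x ≤ 0 becomes preservation of x ≥ N under x ↦ N - x, and an involution then
  -- preserves the complement too.
  high-preserves-N : ∀ {f a b} → Simple f a b → High a b → ∀ {z} → z < N → f z < N
  high-preserves-N {f} S H {z} z<N = ≰⇒> λ N≤fz →
        <⇒≱ z<N (subst (N ≤_) (involutive (S .reflects) z) (back N≤fz))
    where
    below-0 : ∀ {x} N → N ≤ x → N - x ≤ 0ℤ
    below-0 {x} N p = ≤-by p (solve (x ∷ N ∷ []))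
    above-N : ∀ {x} N → N - x ≤ 0ℤ → N ≤ x
    above-N {x} N p = ≤-by p (solve (x ∷ N ∷ []))
    back : ∀ {y} → N ≤ y → N ≤ f y
    back {y} N≤y = above-N N
          (subst (_≤ 0ℤ) (reflect (S .reflects .mirrored) y) (high-preserves S H (below-0 N N≤y)))

  reflect-suc : ∀ {a b} → a ℕ.+ suc b ≡ 2 ℕ.* n → N - + suc b ≡ + suc a
  reflect-suc {a} {b} e = aux (+ suc b) (+ a) N (cong (+_ ∘ suc) (sym e))
    where
    aux : ∀ b a N → N ≡ 1ℤ + (a + b) → N - b ≡ 1ℤ + a
    aux b a N refl = solve (a ∷ b ∷ [])

  increasing⇒step : ∀ {w} → Mirrored N w → Increasing w → ∀ {i} → suc i ℕ.< 2 ℕ.* n →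
                    w (+ suc i) < w (+ suc (suc i))
  increasing⇒step {w} W (chain , last) {i} i<2n with ℕ.<-cmp (suc i) n
  ... | tri< i<n _ _ = chain i<n
  ... | tri≈ _ refl _ = last
  -- Beyond the middle, an ascent is the mirror image under x ↦ N - x of one among 1, ..., n.
  ... | tri> _ _ n<suc-i = subst₂ _<_ (image i≡) (image suc-i≡) (neg-shift N (chain j<n))
    where
    j = 2 ℕ.* n ℕ.∸ suc (suc i)
    suc-i≡ : suc i ℕ.+ suc j ≡ 2 ℕ.* n
    suc-i≡ = trans (ℕ.+-suc (suc i) j) (ℕ.m+[n∸m]≡n i<2n)
    i≡ : i ℕ.+ suc (suc j) ≡ 2 ℕ.* n
    i≡ = trans (ℕ.+-suc i (suc j)) suc-i≡
    n≤i : n ℕ.≤ i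
    n≤i = ℕ.s≤s⁻¹ n<suc-i
    j<n : suc j ℕ.< n
    j<n = ℕ.+-cancelˡ-≤ n (suc (suc j)) n (ℕ.≤-trans (ℕ.+-monoˡ-≤ (suc (suc j)) n≤i)
            (ℕ.≤-reflexive (trans i≡ (cong (n ℕ.+_) (ℕ.+-identityʳ n)))))
    image : ∀ {a b} → a ℕ.+ suc b ≡ 2 ℕ.* n → N - w (+ suc b) ≡ w (+ suc a)
    image {a} {b} e = trans (sym (reflect W (+ suc b))) (cong w (reflect-suc e))
    neg-shift : ∀ N {x y} → x < y → N - y < N - x
    neg-shift N {x} {y} p = <-by (↑ p) (solve (x ∷ y ∷ N ∷ []))

  increasing⇒monotone : ∀ {w} → Mirrored N w → Increasing w → ∀ {i j} → i ℕ.≤ j → j ℕ.< 2 ℕ.* n →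
                        w (+ suc i) ≤ w (+ suc j)
  increasing⇒monotone W I {j = 0} ℕ.z≤n _ = ≤-refl
  increasing⇒monotone W I {j = suc j} i≤j j<2n with ℕ.m≤n⇒m<n∨m≡n i≤j
  ... | inj₂ refl = ≤-refl
  ... | inj₁ i<j = ≤-trans (increasing⇒monotone W I (ℕ.s≤s⁻¹ i<j) (ℕ.<-trans (ℕ.n<1+n j) j<2n))
                          (<⇒≤ (increasing⇒step W I j<2n))

  increasing⇒reflects-< : ∀ {w} → Mirrored N w → Increasing w → ∀ {x y} → 0ℤ < x → x < N → 0ℤ < y → y < N →
                          w x < w y → x < y
  increasing⇒reflects-< W I {+ suc i} {+ suc j} 0<x (+<+ x<N) 0<y (+<+ y<N) wx<wy =
    +<+ (ℕ.s≤s (ℕ.≰⇒> λ j≤i → <⇒≱ wx<wy (increasing⇒monotone W I j≤i (ℕ.s≤s⁻¹ x<N))))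
  increasing⇒reflects-< W I {+ 0} (+<+ ())
  increasing⇒reflects-< W I {+ suc _} {+ 0} _ _ (+<+ ())

  inverse : MirroredPermutation n → ℤ → ℤ
  inverse w y = w .bijective .proj₂ y .proj₁

  fun-inverse : ∀ w y → fun w (inverse w y) ≡ y
  fun-inverse w y = w .bijective .proj₂ y .proj₂ refl

  inverse-fun : ∀ w x → inverse w (fun w x) ≡ x
  inverse-fun w x = injective-fun w (fun-inverse w (fun w x))

  inverse-mirrored : ∀ w → Mirrored N (inverse w)
  inverse-mirrored w .shift y = injective-fun w (trans (fun-inverse w (y + N))
    (trans (cong (_+ N) (sym (fun-inverse w y))) (sym (mirrored-fun w .shift (inverse w y)))))
  inverse-mirrored w .mirror y = injective-fun w (trans (fun-inverse w (- y))
    (trans (cong -_ (sym (fun-inverse w y))) (sym (mirrored-fun w .mirror (inverse w y)))))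

  -- One inclusion of beads suffices: v⁻¹ w keeps z < N, and by the symmetry z ↦ N - z it also keeps
  -- z > 0.
  increasing-unique : ∀ (v w : MirroredPermutation n) → Increasing (fun v) → Increasing (fun w) →
        Image (fun v) (fun w) → fun v ≗ fun w
  increasing-unique v w I J image z =
        trans (cong (fun v) (sym (rigid U (keeps-positive (+<+ (ℕ.s≤s ℕ.z≤n))) u-increasing z)))
        (fun-inverse v (fun w z))
    where
    u : ℤ → ℤ
    u = inverse v ∘ fun w
    U : Mirrored N u
    U = ∘-mirrored (inverse-mirrored v) (mirrored-fun w)
    u<N : ∀ {z} → z < N → u z < N
    u<N {z} z<N = let y , y<N , vy≡wz = image z z<N
                  in subst (_< N) (trans (sym (inverse-fun v y)) (cong (inverse v) vy≡wz)) y<N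
    flip : ∀ N {x} → 0ℤ < x → N - x < N
    flip N {x} p = <-by (↑ p) (solve (x ∷ N ∷ []))
    unflip : ∀ N {x} → N - x < N → 0ℤ < x
    unflip N {x} p = <-by (↑ p) (solve (x ∷ N ∷ []))
    keeps-positive : ∀ {z} → 0ℤ < z → 0ℤ < u z
    keeps-positive {z} 0<z = unflip N (subst (_< N) (reflect U z) (u<N (flip N 0<z)))
    in-window : ∀ {i} → suc i ℕ.≤ suc n → + suc i < N
    in-window p = +<+ (ℕ.≤-trans (ℕ.s≤s p)
          (ℕ.s≤s (ℕ.s≤s (ℕ.s≤s (ℕ.≤-trans (ℕ.≤-reflexive (ℕ.+-comm 1 m)) (ℕ.+-monoʳ-≤ m (ℕ.s≤s ℕ.z≤n)))))))
    step : ∀ {i} → suc i ℕ.≤ n → fun w (+ suc i) < fun w (+ suc (suc i)) → u (+ suc i) < u (+ suc (suc i))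
    step p less = increasing⇒reflects-< (mirrored-fun v) I
      (keeps-positive (+<+ (ℕ.s≤s ℕ.z≤n))) (u<N (in-window (ℕ.m≤n⇒m≤1+n p)))
      (keeps-positive (+<+ (ℕ.s≤s ℕ.z≤n))) (u<N (in-window (ℕ.s≤s p)))
      (subst₂ _<_ (sym (fun-inverse v _)) (sym (fun-inverse v _)) less)
    u-increasing : Increasing u
    u-increasing = (λ i<n → step (ℕ.<⇒≤ i<n) (J .proj₁ i<n)) , step ℕ.≤-refl (J .proj₂)

  even-id : ∀ c → EvenCardinality (Above c id)
  even-id c = [] , AllPairs.[] , (λ i → mk⇔ (λ ()) λ (p , q) → contradiction p (<⇒≱ (suc[i]≤j⇒i<j q))) , 2 ∣0

  module _ {w : ℤ → ℤ} (W : Mirrored N w) (chain : Chain w) where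

    lastC-fixes : ∀ {j} → j ℕ.< n → suc j ≢ n → lastC (+ suc j) ≡ + suc j
    lastC-fixes j<n p = trans (extend-window (sₙᶜ n) j<n) (lastC-rest p)

    increasing-lastC : w (+ suc m) < w (+ suc n) → w (+ suc n) < w (+ n) → Increasing (w ∘ lastC)
    increasing-lastC d e = chain′ , subst₂ _<_ (cong w (sym lastC-n)) (cong w (sym (lastC-reflects .right))) e
      where
      chain′ : Chain (w ∘ lastC)
      chain′ {i} i<n with suc (suc i) ℕ.≟ n
      ... | yes refl = subst₂ _<_ (cong w (sym (lastC-fixes (ℕ.<-trans (ℕ.n<1+n i) i<n) (ℕ.<⇒≢ i<n))))
            (cong w (sym lastC-n)) d
      ... | no p = subst₂ _<_ (cong w (sym (lastC-fixes (ℕ.<-trans (ℕ.n<1+n i) i<n) (ℕ.<⇒≢ i<n))))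
            (cong w (sym (lastC-fixes i<n p))) (chain i<n)

    firstC-fixes : ∀ {j} → suc j ℕ.< n → firstC (+ suc (suc j)) ≡ + suc (suc j)
    firstC-fixes = extend-window s₀ᶜ

    increasing-firstC : w (- + 2) < w 1ℤ → w (+ n) < w (+ suc n) → Increasing (w ∘ firstC)
    increasing-firstC d e = chain′ , subst₂ _<_ (cong w (sym firstC-n)) (cong w (sym firstC-suc-n)) e
      where
      firstC-n : firstC (+ n) ≡ + n
      firstC-n = firstC-fixes ℕ.≤-refl
      firstC-suc-n : firstC (+ suc n) ≡ + suc n
      firstC-suc-n = trans (beyond (extend-mirrored s₀ᶜ)) (trans (cong (λ x → N - x) firstC-n) (sym N-n))
      chain′ : Chain (w ∘ firstC)
      -- Negating w (-2) < w 1 gives - w 1 < w 2, the first ascent after the change of sign.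
      chain′ {0} i<n = subst₂ _<_ (sym (trans (cong w (firstC-reflects .right)) (W .mirror 1ℤ)))
        (cong w (sym (firstC-fixes i<n)))
        (subst (- w 1ℤ <_) (neg-involutive (w (+ 2))) (neg-mono-< (subst (_< w 1ℤ) (W .mirror (+ 2)) d)))
      chain′ {suc i} i<n =
            subst₂ _<_ (cong w (sym (firstC-fixes (ℕ.<-trans (ℕ.n<1+n _) i<n))))
            (cong w (sym (firstC-fixes i<n))) (chain i<n)

-- Uniform treatment of the four types.

firstLeft : AffineType → ℤ
firstLeft C̃/C = -1ℤ
firstLeft B̃/B = - + 2
firstLeft B̃/D = -1ℤ
firstLeft D̃/D = - + 2

module Assembly (m : ℕ) where

  open Generators m
  open Windows n 0<n
  open Descents m
  open Rigidity m
  open Reflections (+ period n)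
  open Roots (+ n) (+ period n) (period≡ n) (+<+ 0<n)

  lastLeft : AffineType → ℤ
  lastLeft C̃/C = + n
  lastLeft B̃/B = + n
  lastLeft B̃/D = + suc m
  lastLeft D̃/D = + suc m

  -- `even₀` is claimed only in types without `s₀ᶜ` as a generator and `evenₙ` only in those without
  -- `sₙᶜ`, which are the types whose group imposes that parity.
  record LetterData (t : AffineType) (f : ℤ → ℤ) (a b : ℤ) : Set where
    field
      simple  : Simple f a b
      kind    : Kind
      root    : IsRoot kind a b
      allowed : Allowed t kind
      obeys   : ∀ κ → Allowed t κ → Obeys f κ
      even₀   : ¬ Central t → Parity Even₀ f
      evenₙ   : ¬ HalfIntegral t → Parity Evenₙ f
      shrinks : Shrinks f a b

  open LetterData

  s-data : ∀ t {i} → suc i ℕ.< n → LetterData t (s (suc i)) (+ suc i) (+ suc (suc i))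
  s-data t i<n = record
    { simple = s-simple i<n ; kind = generic
    ; root = root-adjacent (+<+ (ℕ.s≤s ℕ.z≤n)) (+<+ i<n) ; allowed = tt
    ; obeys = λ { generic _ → obeys-generic (s-simple i<n)
                ; central _ → obeys-central-high (s-simple i<n) (s-high i<n)
                ; half _ → obeys-half-low (s-simple i<n) (s-low i<n) }
    ; even₀ = λ _ → high⇒even₀ (s-simple i<n) (s-high i<n)
    ; evenₙ = λ _ → low⇒evenₙ (s-simple i<n) (s-low i<n)
    ; shrinks = s-shrinks i<n }

  firstC-data : ∀ t → Central t → LetterData t firstC -1ℤ 1ℤ
  firstC-data t C = record
    { simple = firstC-simple ; kind = central ; root = refl ; allowed = C
    ; obeys = λ { generic _ → obeys-generic firstC-simple
                ; central _ → obeys-central firstC-simple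
                ; half _ → obeys-half-low firstC-simple firstC-low }
    ; even₀ = λ ¬C → contradiction C ¬C
    ; evenₙ = λ _ → low⇒evenₙ firstC-simple firstC-low
    ; shrinks = firstC-shrinks }

  firstD-data : ∀ t → ¬ Central t → LetterData t firstD (- + 2) 1ℤ
  firstD-data t ¬C = record
    { simple = firstD-simple ; kind = generic ; root = root-firstD (+<+ 1<n) ; allowed = tt
    ; obeys = λ { generic _ → obeys-generic firstD-simple
                ; central C → contradiction C ¬C
                ; half _ → obeys-half-low firstD-simple firstD-low }
    ; even₀ = λ _ → firstD-even₀
    ; evenₙ = λ _ → low⇒evenₙ firstD-simple firstD-low
    ; shrinks = firstD-shrinks }

  lastC-data : ∀ t → HalfIntegral t → LetterData t lastC (+ n) (+ suc n)
  lastC-data t H = record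
    { simple = lastC-simple ; kind = half ; root = N-n ; allowed = H
    ; obeys = λ { generic _ → obeys-generic lastC-simple
                ; central _ → obeys-central-high lastC-simple lastC-high
                ; half _ → obeys-half lastC-simple }
    ; even₀ = λ _ → high⇒even₀ lastC-simple lastC-high
    ; evenₙ = λ ¬H → contradiction H ¬H
    ; shrinks = lastC-shrinks }

  lastD-data : ∀ t → ¬ HalfIntegral t → LetterData t lastD (+ suc m) (+ suc n)
  lastD-data t ¬H = record
    { simple = lastD-simple ; kind = generic ; root = root-lastD (+<+ 1<n) ; allowed = tt
    ; obeys = λ { generic _ → obeys-generic lastD-simple
                ; central _ → obeys-central-high lastD-simple lastD-high
                ; half H → contradiction H ¬H }
    ; even₀ = λ _ → high⇒even₀ lastD-simple lastD-high
    ; evenₙ = λ _ → lastD-evenₙ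
    ; shrinks = lastD-shrinks }

  first-data : ∀ t → LetterData t (extend n (firstWindow t)) (firstLeft t) 1ℤ
  first-data C̃/C = firstC-data C̃/C tt
  first-data B̃/B = firstD-data B̃/B id
  first-data B̃/D = firstC-data B̃/D tt
  first-data D̃/D = firstD-data D̃/D id

  last-data : ∀ t → LetterData t (extend n (lastWindow t n)) (lastLeft t) (+ suc n)
  last-data C̃/C = lastC-data C̃/C tt
  last-data B̃/B = lastC-data B̃/B tt
  last-data B̃/D = lastD-data B̃/D id
  last-data D̃/D = lastD-data D̃/D id

  rootLeft rootRight : AffineType → Fin (suc n) → ℤ
  rootLeft t Fin.zero = firstLeft t
  rootLeft t (Fin.suc k) = if toℕ k ℕ.≡ᵇ suc m then lastLeft t else + suc (toℕ k)
  rootRight t Fin.zero = 1ℤ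
  rootRight t (Fin.suc k) = + suc (suc (toℕ k))

  rootLeft-last : ∀ t {k} → toℕ k ≡ suc m → rootLeft t (Fin.suc k) ≡ lastLeft t
  rootLeft-last t k≡ rewrite k≡ | ≡ᵇ-true m = refl

  rootLeft-middle : ∀ t {k i} → toℕ k ≡ i → i ≢ suc m → rootLeft t (Fin.suc k) ≡ + suc i
  rootLeft-middle t refl k≢ rewrite ≡ᵇ-false k≢ = refl

  letter : ∀ t i → LetterData t (generator t n i) (rootLeft t i) (rootRight t i)
  letter t Fin.zero = first-data t
  letter t (Fin.suc k) with toℕ k ℕ.≟ suc m
  ... | yes k≡ rewrite k≡ | ≡ᵇ-true m = last-data t
  ... | no k≢ rewrite ≡ᵇ-false k≢ = s-data t (ℕ.s≤s (ℕ.≤∧≢⇒< (ℕ.s≤s⁻¹ (toℕ<n k)) k≢))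

  module _ (t : AffineType) where

    rootDatum : Words.RootDatum t n 0<n
    rootDatum = record
      { a = rootLeft t ; b = rootRight t
      ; kind = λ i → letter t i .kind
      ; simple = λ i → letter t i .simple
      ; root = λ i → letter t i .root
      ; obeys = λ i j → letter t j .obeys (letter t i .kind) (letter t i .allowed) }

    open Words.RootDatum rootDatum using (generatorᵖ; Descent; Sorted)

    Φ-descent : ∀ w i → Descent (fun w) i → Φ (fun (w ∙ generatorᵖ i)) ℕ.< Φ (fun w)
    Φ-descent w i = letter t i .shrinks (mirrored-fun w)

  group-∙ : ∀ t (w : MirroredPermutation n) i → InAffineGroup t w →
        InAffineGroup t (w ∙ Words.RootDatum.generatorᵖ (rootDatum t) i)
  group-∙ C̃/C w i _ = tt
  group-∙ B̃/B w i e = letter B̃/B i .even₀ id (mirrored-fun w) (injective-fun w) e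
  group-∙ B̃/D w i e = letter B̃/D i .evenₙ id (mirrored-fun w) (injective-fun w) e
  group-∙ D̃/D w i (e , e′) = letter D̃/D i .even₀ id (mirrored-fun w) (injective-fun w) e
                            , letter D̃/D i .evenₙ id (mirrored-fun w) (injective-fun w) e′

  group-cong : ∀ t {v w : MirroredPermutation n} → fun v ≗ fun w → InAffineGroup t v → InAffineGroup t w
  group-cong C̃/C v≗w _ = tt
  group-cong B̃/B v≗w e = above-cong {0ℤ} v≗w e
  group-cong B̃/D v≗w e = above-cong {+ n} v≗w e
  group-cong D̃/D v≗w (e , e′) = above-cong {0ℤ} v≗w e , above-cong {+ n} v≗w e′

  -- In the types /D the last ascent reads w (n - 1) < w (n + 1), which x ↦ N - x turns into w n < w
  -- (n + 2).
  Ends : AffineType → (ℤ → ℤ) → Set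
  Ends t w = Chain w × w (lastLeft t) < w (+ suc n)

  module _ (t : AffineType) (w : MirroredPermutation n) where

    open Words.RootDatum (rootDatum t) using (Descent; Sorted)

    ascent : ∀ i → ¬ Descent (fun w) i → fun w (rootLeft t i) < fun w (rootRight t i)
    ascent i ¬d = ≤∧≢⇒< (≮⇒≥ ¬d) (<⇒≢ (letter t i .simple .ordered) ∘ injective-fun w)

    sorted⇒ends : Sorted (fun w) → Ends t (fun w)
    sorted⇒ends sorted = chain , last
      where
      at : ∀ {i} (p : i ℕ.< n) → fun w (rootLeft t (Fin.suc (fromℕ< p))) < fun w (+ suc (suc i))
      at p = subst (λ j → fun w (rootLeft t (Fin.suc (fromℕ< p))) < fun w (+ suc (suc j))) (toℕ-fromℕ< p)
            (ascent (Fin.suc (fromℕ< p)) (sorted (fromℕ< p)))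
      chain : Chain (fun w)
      chain {i} p = subst (λ z → fun w z < fun w (+ suc (suc i))) left≡ (at (ℕ.<-trans (ℕ.n<1+n i) p))
        where
        left≡ : rootLeft t (Fin.suc (fromℕ< (ℕ.<-trans (ℕ.n<1+n i) p))) ≡ + suc i
        left≡ = rootLeft-middle t (toℕ-fromℕ< _) (ℕ.<⇒≢ (ℕ.s≤s⁻¹ p))
      last : fun w (lastLeft t) < fun w (+ suc n)
      last = subst (λ z → fun w z < fun w (+ suc n)) left≡ (at {suc m} ℕ.≤-refl)
        where
        left≡ : rootLeft t (Fin.suc (fromℕ< {suc m} ℕ.≤-refl)) ≡ lastLeft t
        left≡ = rootLeft-last t (toℕ-fromℕ< {suc m} {n} ℕ.≤-refl)

  letter-high : ∀ t k → High (rootLeft t (Fin.suc k)) (rootRight t (Fin.suc k))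
  letter-high t k with toℕ k ℕ.≟ suc m
  ... | yes k≡ rewrite k≡ | ≡ᵇ-true m = last-high t
    where
    last-high : ∀ t → High (lastLeft t) (+ suc n)
    last-high C̃/C = lastC-high
    last-high B̃/B = lastC-high
    last-high B̃/D = lastD-high
    last-high D̃/D = lastD-high
  ... | no k≢ rewrite ≡ᵇ-false k≢ = s-high (ℕ.s≤s (ℕ.≤∧≢⇒< (ℕ.s≤s⁻¹ (toℕ<n k)) k≢))

  -- All letters of the parabolic subgroup are high. Consequently the beads depend on the coset
  -- only.
  parabolic-preserves-N : ∀ t is {z} → z < N → eval t n (List.map Fin.suc is) z < N
  parabolic-preserves-N t [] z<N = z<N
  parabolic-preserves-N t (i ∷ is) z<N =
    high-preserves-N (letter t (Fin.suc i) .simple) (letter-high t i) (parabolic-preserves-N t is z<N)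

  lastCᵖ : MirroredPermutation n
  lastCᵖ = reflectionᵖ lastC-reflects

  module _ (w : MirroredPermutation n) where

    private
      W : Mirrored N (fun w)
      W = mirrored-fun w

    -- In the types /D the values at n and n + 1 come in either order; `sₙᶜ`, which lies outside the
    -- group there, exchanges them.
    normalise-end : Chain (fun w) → fun w (+ suc m) < fun w (+ suc n) →
                    Increasing (fun w) ⊎ Increasing (fun w ∘ lastC)
    normalise-end chain d with <-cmp (fun w (+ n)) (fun w (+ suc n))
    ... | tri< p _ _ = inj₁ (chain , p)
    ... | tri≈ _ e _ = contradiction (injective-fun w e) (<⇒≢ (+<+ (ℕ.n<1+n n)))
    ... | tri> _ _ p = inj₂ (increasing-lastC W chain d p)

    -- Where `s₀ᴰ` replaces `s₀ᶜ`, the value w 1 may be negative; changing its sign then keeps the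
    -- window increasing.
    rigid-up-to-firstC : Increasing (fun w) → fun w (- + 2) < fun w 1ℤ → fun w ≗ id ⊎ fun w ∘ firstC ≗ id
    rigid-up-to-firstC I d with <-cmp 0ℤ (fun w 1ℤ)
    ... | tri< p _ _ = inj₁ (rigid W p I)
    ... | tri≈ _ e _ = contradiction (injective-fun w (trans (fixes-0 W) e)) λ ()
    ... | tri> _ _ p = inj₂ (rigid (∘-mirrored W (extend-mirrored s₀ᶜ))
      (subst (0ℤ <_) (sym (trans (cong (fun w) (firstC-reflects .right)) (W .mirror 1ℤ))) (neg-mono-< p))
      (increasing-firstC W (I .proj₁) d (I .proj₂)))

    ¬firstC-identity : Even₀ (fun w) → ¬ fun w ∘ firstC ≗ id
    ¬firstC-identity even e =
          firstC-flips W (injective-fun w) .proj₁ even (above-cong {0ℤ} (sym ∘ e) (even-id 0ℤ))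

    ¬lastC-identity : Evenₙ (fun w) → ¬ fun w ∘ lastC ≗ id
    ¬lastC-identity even e =
          lastC-flips W (injective-fun w) .proj₁ even (above-cong {+ n} (sym ∘ e) (even-id (+ n)))

  positive-start : ∀ (w : MirroredPermutation n) → fun w -1ℤ < fun w 1ℤ → 0ℤ < fun w 1ℤ
  positive-start w d = central>0 (subst (_< fun w 1ℤ) (mirrored-fun w .mirror 1ℤ) d)

  -- Each of `s₀ᶜ` and `sₙᶜ` that is not a generator leaves one further candidate besides the
  -- identity, and the matching parity excludes it.
  ends⇒identity : ∀ t → minRank t ℕ.≤ n → ∀ (w : MirroredPermutation n) → InAffineGroup t w →
                  fun w (firstLeft t) < fun w 1ℤ → Ends t (fun w) → fun w ≗ id
  ends⇒identity C̃/C _ w _ d I = rigid (mirrored-fun w) (positive-start w d) I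
  ends⇒identity B̃/B _ w even d I with rigid-up-to-firstC w I d
  ... | inj₁ e = e
  ... | inj₂ e = contradiction e (¬firstC-identity w even)
  ends⇒identity B̃/D _ w even d (chain , last) with normalise-end w chain last
  ... | inj₁ I = rigid (mirrored-fun w) (positive-start w d) I
  ... | inj₂ I = contradiction (rigid (mirrored-fun (w ∙ lastCᵖ))
      (subst (λ z → 0ℤ < fun w z) (sym (lastC-fixes (mirrored-fun w) chain 0<n λ ())) (positive-start w d)) I)
      (¬lastC-identity w even)
  ends⇒identity D̃/D (ℕ.s≤s (ℕ.s≤s 1<m)) w (even₀ , evenₙ) d (chain , last) with normalise-end w chain last
  ... | inj₁ I = [ id , (λ e → contradiction e (¬firstC-identity w even₀)) ]′ (rigid-up-to-firstC w I d)
  ... | inj₂ I = [ (λ e → contradiction e (¬lastC-identity w evenₙ))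
                 , (λ e → contradiction e (¬firstC-identity (w ∙ lastCᵖ)
                     (high⇒even₀ lastC-simple lastC-high (mirrored-fun w) (injective-fun w) even₀))) ]′
                 (rigid-up-to-firstC (w ∙ lastCᵖ) I
                       (subst₂ (λ y z → fun w y < fun w z) (sym lastC[-2]) (sym lastC[1]) d))
    where
    lastC[1] : lastC 1ℤ ≡ 1ℤ
    lastC[1] = lastC-fixes (mirrored-fun w) chain 0<n λ ()
    lastC[-2] : lastC (- + 2) ≡ - + 2
    -- The rank puts 2 strictly below n, so `sₙᶜ` fixes it.
    lastC[-2] = trans (extend-mirrored (sₙᶜ n) .mirror (+ 2)) (cong -_
      (lastC-fixes (mirrored-fun w) chain 1<n (ℕ.<⇒≢ (ℕ.s≤s (ℕ.s≤s (ℕ.<-trans (ℕ.n<1+n 0) 1<m))))))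

  image-lastCˡ : ∀ {v w : ℤ → ℤ} → Image v w → Image (v ∘ lastC) w
  image-lastCˡ {v} image z z<N =
    let y , y<N , e = image z z<N
    in lastC y , high-preserves-N lastC-simple lastC-high y<N , trans (cong v (involutive lastC-reflects y)) e

  image-lastCʳ : ∀ {v w : ℤ → ℤ} → Image v w → Image v (w ∘ lastC)
  image-lastCʳ image z z<N = image (lastC z) (high-preserves-N lastC-simple lastC-high z<N)

  -- If only one of the two needs `sₙᶜ`, they differ by it and cannot both be even at n. `Ends`
  -- agrees on the two types /D, so this serves both.
  chain-unique : ∀ (v w : MirroredPermutation n) → Evenₙ (fun v) → Evenₙ (fun w) → Ends D̃/D (fun v) →
        Ends D̃/D (fun w) →
                 Image (fun v) (fun w) → fun v ≗ fun w
  chain-unique v w ev ew (c , l) (c′ , l′) image with normalise-end v c l | normalise-end w c′ l′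
  ... | inj₁ I | inj₁ J = increasing-unique v w I J image
  ... | inj₁ I | inj₂ J = contradiction
      (above-cong {+ n} (increasing-unique v (w ∙ lastCᵖ) I J (image-lastCʳ {w = fun w} image)) ev)
      (lastC-flips (mirrored-fun w) (injective-fun w) .proj₁ ew)
  ... | inj₂ I | inj₁ J = contradiction
      (above-cong {+ n} (sym ∘ increasing-unique (v ∙ lastCᵖ) w I J (image-lastCˡ {v = fun v} image)) ew)
      (lastC-flips (mirrored-fun v) (injective-fun v) .proj₁ ev)
  ... | inj₂ I | inj₂ J = λ z → trans (cong (fun v) (sym (involutive lastC-reflects z)))
      (trans (increasing-unique (v ∙ lastCᵖ) (w ∙ lastCᵖ) I J
            (image-lastCˡ {v = fun v} {fun w ∘ lastC} (image-lastCʳ {w = fun w} image)) (lastC z))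
      (cong (fun w) (involutive lastC-reflects z)))

  ends-unique : ∀ t (v w : MirroredPermutation n) → InAffineGroup t v → InAffineGroup t w →
        Ends t (fun v) → Ends t (fun w) →
                Image (fun v) (fun w) → fun v ≗ fun w
  ends-unique C̃/C v w _ _ = increasing-unique v w
  ends-unique B̃/B v w _ _ = increasing-unique v w
  ends-unique B̃/D v w = chain-unique v w
  ends-unique D̃/D v w (_ , e) (_ , e′) = chain-unique v w e e′

  module _ (t : AffineType) (rank : minRank t ℕ.≤ n) where

    open Words.RootDatum (rootDatum t)

    group-identity : ∀ (w : MirroredPermutation n) → InAffineGroup t w → (∀ i → ¬ Descent (fun w) i) →
          fun w ≗ id
    group-identity w G-w none = ends⇒identity t rank w G-w (ascent t w Fin.zero (none Fin.zero))
      (sorted⇒ends t w (none ∘ Fin.suc))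

    sorted-unique : ∀ (v w : MirroredPermutation n) → InAffineGroup t v → InAffineGroup t w →
          Sorted (fun v) → Sorted (fun w) →
                    Image (fun v) (fun w) → fun v ≗ fun w
    sorted-unique v w G-v G-w S-v S-w =
      ends-unique t v w G-v G-w (sorted⇒ends t v S-v) (sorted⇒ends t w S-w)

    -- Members of a coset share their beads, so uniqueness for a given abacus implies uniqueness in
    -- the coset.
    coset-unique : ∀ (v w : MirroredPermutation n) → InAffineGroup t v → InAffineGroup t w →
          Sorted (fun v) → Sorted (fun w) → ∀ is →
                   fun w ≗ fun v ∘ eval t n (List.map Fin.suc is) → fun w ≗ fun v
    coset-unique v w G-v G-w S-v S-w is e z = sym (sorted-unique v w G-v G-w S-v S-w
      (λ z z<N → eval t n (List.map Fin.suc is) z , parabolic-preserves-N t is z<N , sym (e z)) z)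

    sorted⇒minimalRep : ∀ (w : MirroredPermutation n) → InAffineGroup t w → Sorted (fun w) →
          IsMinimalRep t n (fun w)
    sorted⇒minimalRep = sorted⇒minimal Φ (Φ-descent t) (InAffineGroup t) (group-∙ t)
          (λ {v} {w} → group-cong t {v} {w})
      group-identity coset-unique

    group-∙* : ∀ (w : MirroredPermutation n) is → InAffineGroup t w → InAffineGroup t (w ∙ evalᵖ is)
    group-∙* = G-∙* Φ (Φ-descent t) (InAffineGroup t) (group-∙ t) (λ {v} {w} → group-cong t {v} {w})
      group-identity coset-unique

-- Abaci

bool-ext : ∀ {a b : Bool} → (a ≡ true → b ≡ true) → (b ≡ true → a ≡ true) → a ≡ b
bool-ext {true} f g = sym (f refl)
bool-ext {false} {true} f g = g refl
bool-ext {false} {false} f g = refl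

module Abaci (m : ℕ) where

  open Generators m
  open Windows n 0<n
  open Descents m
  open Rigidity m
  open Assembly m
  open Reflections (+ period n)
  open Roots (+ n) (+ period n) (period≡ n) (+<+ 0<n)

  residue : Fin (2 ℕ.* n) → ℤ
  residue i = + suc (toℕ i)

  residue>0 : ∀ i → 0ℤ < residue i
  residue>0 i = +<+ (ℕ.s≤s ℕ.z≤n)

  residue<N : ∀ i → residue i < N
  residue<N i = +<+ (ℕ.s≤s (toℕ<n i))

  residue-opposite : ∀ i → residue (opposite i) ≡ N - residue i
  residue-opposite i = aux (residue i) (residue (opposite i)) N (cong (+_ ∘ suc) (sym sum≡))
    where
    sum≡ : toℕ i ℕ.+ suc (toℕ (opposite i)) ≡ 2 ℕ.* n
    sum≡ = trans (ℕ.+-suc (toℕ i) _) (trans (cong (suc (toℕ i) ℕ.+_) (opposite-prop i)) (ℕ.m+[n∸m]≡n (toℕ<n i)))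
    aux : ∀ r r′ N → N ≡ r + r′ → r′ ≡ N - r
    aux r r′ N refl = solve (r ∷ r′ ∷ [])

  label-level : ∀ l k i → label n (l + k , i) ≡ label n (l , i) + k * N
  label-level l k i = aux l k N (residue i)
    where
    aux : ∀ l k N r → (l + k) * N + r ≡ l * N + r + k * N
    aux = solve-∀

  label-opposite : ∀ l i → label n (- l , opposite i) ≡ N - label n (l , i)
  label-opposite l i = trans (cong (_+_ (- l * N)) (residue-opposite i)) (aux l N (residue i))
    where
    aux : ∀ l N r → - l * N + (N - r) ≡ N - (l * N + r)
    aux = solve-∀

  label-injective : ∀ {e e′} → label n e ≡ label n e′ → e ≡ e′
  label-injective {l , i} {l′ , i′} eq =
        cong₂ _,_ l≡ (toℕ-injective (ℕ.suc-injective (+-injective (remainder-unique l≡ eq′))))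
    where
    eq′ : residue i + l * N ≡ residue i′ + l′ * N
    eq′ = trans (+-comm (residue i) (l * N)) (trans eq (+-comm (l′ * N) (residue i′)))
    l≡ : l ≡ l′
    l≡ = quotient-unique (<⇒≤ (residue>0 i)) (residue<N i) (<⇒≤ (residue>0 i′)) (residue<N i′) eq′

  label-notMultiple : ∀ e → NotMultiple (label n e)
  label-notMultiple (l , i) k eq =
        between⇒notMultiple (residue>0 i) (residue<N i) (k - l) (aux k l N (residue i) eq)
    where
    aux : ∀ k l N r → l * N + r ≡ k * N → r ≡ (k - l) * N
    aux k l N r e = ≡-by e (solve (k ∷ l ∷ N ∷ r ∷ []))

  data Located : ℤ → Set where
    multiple : ∀ k → Located (k * N)
    entry    : ∀ e → Located (label n e)

  locate : ∀ z → Located z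
  locate z with z %ℕ period n in r≡ | a≡a%ℕn+[a/ℕn]*n z (period n)
  ... | 0 | eq = subst Located (sym (trans eq (+-identityˡ _))) (multiple (z /ℕ period n))
  ... | suc r | eq = subst Located
        (sym (trans eq (trans (+-comm (+ suc r) (z /ℕ period n * N))
        (cong (λ r → z /ℕ period n * N + + suc r) (sym (toℕ-fromℕ< r<2n))))))
                       (entry (z /ℕ period n , fromℕ< r<2n))
    where
    r<2n : r ℕ.< 2 ℕ.* n
    r<2n = ℕ.s≤s⁻¹ (subst (ℕ._< period n) r≡ (n%ℕd<d z (period n)))

  private
    level≤ : ∀ l l′ i → l ≤ l′ → label n (l , i) ≤ label n (l′ , i)
    level≤ l l′ i p = +-monoˡ-≤ (residue i) (*-monoʳ-≤-nonNeg N p)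

    level≤⁻ : ∀ l l′ i → label n (l , i) ≤ label n (l′ , i) → l ≤ l′
    level≤⁻ l l′ i p = *-cancelʳ-≤-pos l l′ N (aux (l * N) (l′ * N) (residue i) p)
      where
      aux : ∀ x y r → x + r ≤ y + r → x ≤ y
      aux x y r p = ≤-by p (solve (x ∷ y ∷ r ∷ []))

    level< : ∀ l l′ i → l ≤ l′ → l ≢ l′ → label n (l , i) < label n (l′ , i)
    level< l l′ i p l≢ = ≤∧≢⇒< (level≤ l l′ i p) λ e → l≢ (cong proj₁ (label-injective e))

  -- Equivalent to IsAbacusOf n w a, without reference to lowest beads.
  BeadsOf : MirroredPermutation n → Abacus n → Set
  BeadsOf w a = ∀ e → (a e ≡ true → inverse w (label n e) < N) × (inverse w (label n e) < N → a e ≡ true)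

  𝒜 : MirroredPermutation n → Abacus n
  𝒜 w e = does (inverse w (label n e) <? N)

  beadsOf-𝒜 : ∀ w → BeadsOf w (𝒜 w)
  beadsOf-𝒜 w e with inverse w (label n e) <? N
  ... | yes p = (λ _ → p) , λ _ → refl
  ... | no ¬p = (λ ()) , λ p → contradiction p ¬p

  beadsOf-unique : ∀ {w a b} → BeadsOf w a → BeadsOf w b → a ≗ b
  beadsOf-unique A B e = bool-ext (B e .proj₂ ∘ A e .proj₁) (A e .proj₂ ∘ B e .proj₁)

  beadsOf-≗ : ∀ {w a b} → a ≗ b → BeadsOf w b → BeadsOf w a
  beadsOf-≗ a≗b B e = (λ p → B e .proj₁ (trans (sym (a≗b e)) p)) , λ p → trans (a≗b e) (B e .proj₂ p)

  beadsOf-cong : ∀ {v w a} → fun v ≗ fun w → BeadsOf v a → BeadsOf w a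
  beadsOf-cong {v} {w} v≗w B e = (λ p → subst (_< N) inverse≡ (B e .proj₁ p)) , λ p →
        B e .proj₂ (subst (_< N) (sym inverse≡) p)
    where
    inverse≡ : inverse v (label n e) ≡ inverse w (label n e)
    inverse≡ = injective-fun w (trans (sym (v≗w _)) (trans (fun-inverse v _) (sym (fun-inverse w _))))

  -- Records which window value lies on runner `i`, and at which level.
  Based : MirroredPermutation n → Fin (2 ℕ.* n) → ℤ → Fin (2 ℕ.* n) → Set
  Based w i l j = label n (l , i) ≡ fun w (residue j)

  module _ {w : MirroredPermutation n} {i : Fin (2 ℕ.* n)} {l : ℤ} {j : Fin (2 ℕ.* n)}
           (based : Based w i l j) where

    -- Along a runner w⁻¹ advances in steps of N through a residue between 0 and N, so it stays
    -- below N exactly up to level `l`.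
    inverse-label : ∀ l′ → inverse w (label n (l′ , i)) ≡ residue j + (l′ - l) * N
    inverse-label l′ = trans (cong (inverse w) label≡) (inverse-fun w _)
      where
      difference : ∀ l l′ → l′ ≡ l + (l′ - l)
      difference = solve-∀
      label≡ : label n (l′ , i) ≡ fun w (residue j + (l′ - l) * N)
      label≡ = trans (cong (λ l → label n (l , i)) (difference l l′)) (trans (label-level l (l′ - l) i)
        (trans (cong (_+ (l′ - l) * N) based) (sym (shift* (mirrored-fun w) (l′ - l) (residue j)))))

    based-bead : ∀ l′ → l′ ≤ l → inverse w (label n (l′ , i)) < N
    based-bead l′ p = subst (_< N) (sym (inverse-label l′))
          (≤-<-trans (below-residue (residue j) ((l′ - l) * N) nonpositive) (residue<N j))
      where
      nonpositive : (l′ - l) * N ≤ 0ℤ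
      nonpositive = *-monoʳ-≤-nonNeg N (i≤j⇒i-j≤0 p)
      below-residue : ∀ r d → d ≤ 0ℤ → r + d ≤ r
      below-residue r d p = ≤-by p (solve (r ∷ d ∷ []))

    based-bead⁻ : ∀ l′ → inverse w (label n (l′ , i)) < N → l′ ≤ l
    based-bead⁻ l′ p = cancel l l′
          (multiple<N (l′ - l)
          (above-residue (residue j) ((l′ - l) * N) (residue>0 j) (subst (_< N) (inverse-label l′) p)))
      where
      above-residue : ∀ r d → 0ℤ < r → r + d < N → d < N
      above-residue r d p q = <-trans d<r+d q
        where
        d<r+d : d < r + d
        d<r+d = <-by (↑ p) (solve (r ∷ d ∷ []))
      cancel : ∀ l l′ → l′ - l ≤ 0ℤ → l′ ≤ l
      cancel l l′ p = ≤-by p (solve (l ∷ l′ ∷ []))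

  based : ∀ w i → ∃[ l ] ∃[ j ] Based w i l j
  based w i with inverse w (label n (0ℤ , i)) in eq
  ... | y with locate y
  ...   | multiple k =
        contradiction (trans (sym (fun-inverse w (label n (0ℤ , i))))
        (trans (cong (fun w) eq) (fixes-multiple (mirrored-fun w) k)))
                         (label-notMultiple (0ℤ , i) k)
  -- The entry of runner `i` at level 0 comes from level `q` of runner `j`; shifting both by `- q`
  -- levels brings the source into the window.
  ...   | entry (q , j) = - q , j , (begin
      label n (- q , i)                        ≡⟨ cong (λ l → label n (l , i)) (+-identityˡ (- q)) ⟨
      label n (0ℤ + - q , i)                   ≡⟨ label-level 0ℤ (- q) i ⟩
      label n (0ℤ , i) + - q * N               ≡⟨ cong (_+ - q * N) (fun-inverse w (label n (0ℤ , i))) ⟨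
      fun w (inverse w (label n (0ℤ , i))) + - q * N   ≡⟨ cong (λ y → fun w y + - q * N) eq ⟩
      fun w (label n (q , j)) + - q * N        ≡⟨ shift* (mirrored-fun w) (- q) _ ⟨
      fun w (label n (q , j) + - q * N)        ≡⟨ cong (fun w) (aux q N (residue j)) ⟩
      fun w (residue j)                        ∎)
    where
    open ≡-Reasoning
    aux : ∀ q N r → q * N + r + - q * N ≡ r
    aux = solve-∀

  based-lowest : ∀ {w a i l j} → BeadsOf w a → Based w i l j → Lowest n a i l
  based-lowest {w} {i = i} {l} {j} B b = B (l , i) .proj₂ (based-bead {w} {i} {l} {j} b l ≤-refl)
    , λ l′ bead → level≤ l′ l i (based-bead⁻ {w} {i} {l} {j} b l′ (B (l′ , i) .proj₁ bead))

  beadsOf-flush : ∀ {w a} → BeadsOf w a → Flush n a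
  beadsOf-flush {w} B i l l′ bead gap less =
    let k , j , b = based w i
        l′≤k = ≤-trans (level≤⁻ l′ l i (<⇒≤ less)) (based-bead⁻ {w} {i} {k} {j} b l (B (l , i) .proj₁ bead))
    in contradiction (trans (sym (B (l′ , i) .proj₂ (based-bead {w} {i} {k} {j} b l′ l′≤k))) gap) λ ()

  beadsOf⇒isAbacusOf : ∀ {w a} → BeadsOf w a → IsAbacusOf n w a
  beadsOf⇒isAbacusOf {w} B = beadsOf-flush {w} B , λ i →
    let l , j , b = based w i in l , based-lowest {w} {j = j} B b , j , b

  flush-bead : ∀ {a i l l′} → Flush n a → Lowest n a i l → l′ ≤ l → a (l′ , i) ≡ true
  flush-bead {a} {i} {l} {l′} flush (bead , _) l′≤l with a (l′ , i) in eq
  ... | true = refl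
  ... | false = contradiction (level< l′ l i l′≤l λ { refl → contradiction (trans (sym bead) eq) λ () })
        (flush i l l′ bead eq)

  isAbacusOf⇒beadsOf : ∀ {w a} → IsAbacusOf n w a → BeadsOf w a
  isAbacusOf⇒beadsOf {w} (flush , lowest) (l′ , i) =
    let l , L , j , b = lowest i
    in (λ bead → based-bead {w} {i} {l} {j} b l′ (level≤⁻ l′ l i (L .proj₂ l′ bead)))
     , λ p → flush-bead flush L (based-bead⁻ {w} {i} {l} {j} b l′ p)

  -- Applying x ↦ N - x to the lowest bead of runner `i` gives the window value on the opposite
  -- runner.
  beadsOf-balanced : ∀ {w a} → BeadsOf w a → Balanced n a
  beadsOf-balanced {w} B i =
    let l , j , b = based w i
        b′ : Based w (opposite i) (- l) (opposite j)
        b′ = trans (label-opposite l i) (trans (cong (λ x → N - x) b)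
               (trans (sym (reflect (mirrored-fun w) (residue j))) (cong (fun w) (sym (residue-opposite j)))))
    in l , - l , based-lowest {w} {j = j} B b , based-lowest {w} {j = opposite j} B b′
     , trans (cong (_+_ (label n (l , i))) (label-opposite l i)) (aux (label n (l , i)) N)
    where
    aux : ∀ x N → x + (N - x) ≡ N
    aux = solve-∀

  module _ {w : MirroredPermutation n} {a : Abacus n} (B : BeadsOf w a) where

    private
      -- A gap before N has w⁻¹ at least N and label below N; x ↦ N - x turns this into a point at
      -- most 0 with value at least 1.
      crossing : Entry n → ℤ
      crossing e = N - inverse w (label n e)

      crossing-injective : ∀ {e e′} → crossing e ≡ crossing e′ → e ≡ e′
      crossing-injective {e} {e′} eq = label-injective (trans (sym (fun-inverse w (label n e)))
        (trans (cong (fun w) (aux N (inverse w (label n e)) (inverse w (label n e′)) eq))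
              (fun-inverse w (label n e′))))
        where
        aux : ∀ N x y → N - x ≡ N - y → x ≡ y
        aux N x y e = ≡-by (sym e) (solve (N ∷ x ∷ y ∷ []))

      fun-crossing : ∀ e → fun w (crossing e) ≡ N - label n e
      fun-crossing e = trans (reflect (mirrored-fun w) _) (cong (λ x → N - x) (fun-inverse w (label n e)))

      gap⇒ : ∀ {e} → a e ≡ false → N ≤ inverse w (label n e)
      gap⇒ {e} gap = ≮⇒≥ λ p → contradiction (trans (sym (B e .proj₂ p)) gap) λ ()

      gap⇐ : ∀ {e} → N ≤ inverse w (label n e) → a e ≡ false
      gap⇐ {e} p with a e in eq
      ... | true = contradiction (B e .proj₁ eq) (≤⇒≯ p)
      ... | false = refl

      N≤⇒ : ∀ {x} N → N ≤ x → N - x ≤ 0ℤ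
      N≤⇒ {x} N p = ≤-by p (solve (N ∷ x ∷ []))

      N≤⇐ : ∀ {x} N → N - x ≤ 0ℤ → N ≤ x
      N≤⇐ {x} N p = ≤-by p (solve (N ∷ x ∷ []))

      <N⇒ : ∀ {x} N → x < N → 1ℤ ≤ N - x
      <N⇒ {x} N p = ≤-by (↑ p) (solve (N ∷ x ∷ []))

      <N⇐ : ∀ {x} N → 1ℤ ≤ N - x → x < N
      <N⇐ {x} N p = <-by p (solve (N ∷ x ∷ []))

      gap⇔above : ∀ e → (a e ≡ false × label n e < N) ⇔ Above 0ℤ (fun w) (crossing e)
      gap⇔above e = mk⇔
        (λ (gap , less) → N≤⇒ N (gap⇒ gap) , subst (1ℤ ≤_) (sym (fun-crossing e)) (<N⇒ N less))
        (λ (p , q) → gap⇐ (N≤⇐ N p) , <N⇐ N (subst (1ℤ ≤_) (fun-crossing e) q))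

      above⊆crossing : ∀ x → Above 0ℤ (fun w) x → ∃[ e ] crossing e ≡ x
      above⊆crossing x (x≤0 , 1≤wx) with fun w (N - x) in eq
      ... | y with locate y
      -- Multiples of N carry no label, but `w` fixes them, so they cannot pass from x ≤ 0 to w x ≥
      -- 1.
      ...   | multiple k = contradiction (≤-trans 1≤wx (≤-trans (≤-reflexive wx≡x) x≤0)) λ { (+≤+ ()) }
        where
        N-x≡ : N - x ≡ k * N
        N-x≡ = injective-fun w (trans eq (sym (fixes-multiple (mirrored-fun w) k)))
        x≡ : x ≡ (1ℤ - k) * N
        x≡ = aux x k N N-x≡
          where
          aux : ∀ x k N → N - x ≡ k * N → x ≡ (1ℤ - k) * N
          aux x k N e = ≡-by (sym e) (solve (x ∷ k ∷ N ∷ []))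
        wx≡x : fun w x ≡ x
        wx≡x = trans (cong (fun w) x≡) (trans (fixes-multiple (mirrored-fun w) (1ℤ - k)) (sym x≡))
      ...   | entry e = e , trans
            (cong (λ y → N - y) (trans (cong (inverse w) (sym eq)) (inverse-fun w (N - x)))) (aux N x)
        where
        aux : ∀ N x → N - (N - x) ≡ x
        aux = solve-∀

    evenGaps⇒evenAtZero : EvenGaps n a → EvenAtZero w
    evenGaps⇒evenAtZero = even-map⁺ {f = crossing} crossing-injective gap⇔above above⊆crossing

    evenAtZero⇒evenGaps : EvenAtZero w → EvenGaps n a
    evenAtZero⇒evenGaps = even-map⁻ {f = crossing} crossing-injective gap⇔above above⊆crossing

  -- Translations of the runners and realisation of balanced abaci.

  module Translation (level : Fin (2 ℕ.* n) → ℤ) where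

    translateLocated : ∀ {z} → Located z → ℤ
    translateLocated (multiple k) = k * N
    translateLocated (entry (q , i)) = label n (q + level i , i)

    translate : ℤ → ℤ
    translate z = translateLocated (locate z)

    translate-multiple : ∀ k → translate (k * N) ≡ k * N
    translate-multiple k = at (locate (k * N)) refl
      where
      at : ∀ {z} (p : Located z) → z ≡ k * N → translateLocated p ≡ k * N
      at (multiple _) eq = eq
      at (entry e) eq = contradiction eq (label-notMultiple e k)

    translate-entry : ∀ q i → translate (label n (q , i)) ≡ label n (q + level i , i)
    translate-entry q i = at (locate (label n (q , i))) refl
      where
      at : ∀ {z} (p : Located z) → z ≡ label n (q , i) → translateLocated p ≡ label n (q + level i , i)
      at (multiple k) eq = contradiction (sym eq) (label-notMultiple (q , i) k)
      at (entry e) eq = cong (λ (q , i) → label n (q + level i , i)) (label-injective {e} {q , i} eq)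

    module _ (antisymmetric : ∀ i → level (opposite i) ≡ - level i) where

      translate-mirrored : Mirrored N translate
      translate-mirrored .shift x = at (locate x)
        where
        next : ∀ k N → k * N + N ≡ (1ℤ + k) * N
        next = solve-∀
        next-entry : ∀ q N r → q * N + r + N ≡ (1ℤ + q) * N + r
        next-entry = solve-∀
        next-level : ∀ q l N r → (1ℤ + q + l) * N + r ≡ (q + l) * N + r + N
        next-level = solve-∀
        at : ∀ {x} → Located x → translate (x + N) ≡ translate x + N
        at (multiple k) = begin
          translate (k * N + N)      ≡⟨ cong translate (next k N) ⟩
          translate ((1ℤ + k) * N)   ≡⟨ translate-multiple (1ℤ + k) ⟩
          (1ℤ + k) * N               ≡⟨ next k N ⟨
          k * N + N                  ≡⟨ cong (_+ N) (translate-multiple k) ⟨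
          translate (k * N) + N      ∎
          where open ≡-Reasoning
        at (entry (q , i)) = begin
          translate (label n (q , i) + N)      ≡⟨ cong translate (next-entry q N (residue i)) ⟩
          translate (label n (1ℤ + q , i))     ≡⟨ translate-entry (1ℤ + q) i ⟩
          label n (1ℤ + q + level i , i)       ≡⟨ next-level q (level i) N (residue i) ⟩
          label n (q + level i , i) + N        ≡⟨ cong (_+ N) (translate-entry q i) ⟨
          translate (label n (q , i)) + N      ∎
          where open ≡-Reasoning
      translate-mirrored .mirror x = at (locate x)
        where
        negate : ∀ k N → - (k * N) ≡ (- k) * N
        negate = solve-∀
        -- Level `- q` of the opposite runner holds N minus the label, so one more N has to be taken
        -- off.
        negate-entry : ∀ q i → label n (- q - 1ℤ , opposite i) ≡ - label n (q , i)
        negate-entry q i = trans (label-level (- q) -1ℤ (opposite i))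
          (trans (cong (_+ -1ℤ * N) (label-opposite q i)) (cancel (label n (q , i)) N))
          where
          cancel : ∀ x N → N - x + -1ℤ * N ≡ - x
          cancel = solve-∀
        levels : ∀ q l → - q - 1ℤ + - l ≡ - (q + l) - 1ℤ
        levels = solve-∀
        at : ∀ {x} → Located x → translate (- x) ≡ - translate x
        at (multiple k) = begin
          translate (- (k * N))      ≡⟨ cong translate (negate k N) ⟩
          translate ((- k) * N)      ≡⟨ translate-multiple (- k) ⟩
          (- k) * N                  ≡⟨ negate k N ⟨
          - (k * N)                  ≡⟨ cong -_ (translate-multiple k) ⟨
          - translate (k * N)        ∎
          where open ≡-Reasoning
        at (entry (q , i)) = begin
          translate (- label n (q , i))                        ≡⟨ cong translate (negate-entry q i) ⟨
          translate (label n (- q - 1ℤ , opposite i))          ≡⟨ translate-entry (- q - 1ℤ) (opposite i) ⟩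
          label n (- q - 1ℤ + level (opposite i) , opposite i) ≡⟨ cong (λ l → label n (l , opposite i))
                (trans (cong (_+_ (- q - 1ℤ)) (antisymmetric i)) (levels q (level i))) ⟩
          label n (- (q + level i) - 1ℤ , opposite i)          ≡⟨ negate-entry (q + level i) i ⟩
          - label n (q + level i , i)                          ≡⟨ cong -_ (translate-entry q i) ⟨
          - translate (label n (q , i))                        ∎
          where open ≡-Reasoning

  translate-inverse : ∀ {v w} → (∀ i → v i + w i ≡ 0ℤ) → ∀ z →
        Translation.translate w (Translation.translate v z) ≡ z
  translate-inverse {v} {w} v+w≡0 z = at (locate z)
    where
    open Translation
    at : ∀ {z} → Located z → translate w (translate v z) ≡ z
    at (multiple k) = trans (cong (translate w) (translate-multiple v k)) (translate-multiple w k)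
    at (entry (q , i)) =
          trans (cong (translate w) (translate-entry v q i)) (trans (translate-entry w (q + v i) i)
      (cong (λ l → label n (l , i))
            (trans (+-assoc q (v i) (w i)) (trans (cong (_+_ q) (v+w≡0 i)) (+-identityʳ q)))))

  translation : (level : Fin (2 ℕ.* n) → ℤ) → (∀ i → level (opposite i) ≡ - level i) → MirroredPermutation n
  fun (translation level anti) = Translation.translate level
  bijective (translation level anti) =
      (λ {x} {y} e → trans (sym (undo x)) (trans (cong (translate (λ i → - level i)) e) (undo y)))
    , λ y → translate (λ i → - level i) y , λ { refl → translate-inverse (λ i → +-inverseˡ (level i)) y }
    where
    open Translation
    undo : ∀ x → translate (λ i → - level i) (translate level x) ≡ x
    undo = translate-inverse (λ i → +-inverseʳ (level i))
  MirroredPermutation.shift (translation level anti) =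
        Mirrored.shift (Translation.translate-mirrored level anti)
  MirroredPermutation.mirror (translation level anti) =
        Mirrored.mirror (Translation.translate-mirrored level anti)

  lowest-unique : ∀ {a i l l′} → Lowest n a i l → Lowest n a i l′ → l ≡ l′
  lowest-unique {i = i} {l} {l′} (bead , low) (bead′ , low′) =
    ≤-antisym (level≤⁻ l l′ i (low′ l bead)) (level≤⁻ l′ l i (low l′ bead′))

  -- Balance makes the lowest levels on opposite runners negatives of each other, which is what the
  -- mirror symmetry of the translation requires.
  balanced⇒translation : ∀ {a} → Flush n a → Balanced n a → ∃[ w ] BeadsOf w a
  balanced⇒translation {a} flush balanced =
        w , isAbacusOf⇒beadsOf {w} {a} (flush , λ i → level i , lowest i , i , based-at i)
    where
    level : Fin (2 ℕ.* n) → ℤ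
    level i = balanced i .proj₁
    lowest : ∀ i → Lowest n a i (level i)
    lowest i = balanced i .proj₂ .proj₂ .proj₁
    antisymmetric : ∀ i → level (opposite i) ≡ - level i
    antisymmetric i = label-level≡
          (trans (aux (label n (level i , i)) (label n (level (opposite i) , opposite i)) N sum≡)
          (sym (label-opposite (level i) i)))
      where
      opposite≡ : balanced i .proj₂ .proj₁ ≡ level (opposite i)
      opposite≡ = lowest-unique {a} {opposite i} (balanced i .proj₂ .proj₂ .proj₂ .proj₁) (lowest (opposite i))
      sum≡ : label n (level i , i) + label n (level (opposite i) , opposite i) ≡ N
      sum≡ = trans (cong (λ l → label n (level i , i) + label n (l , opposite i)) (sym opposite≡))
            (balanced i .proj₂ .proj₂ .proj₂ .proj₂)
      aux : ∀ x y N → x + y ≡ N → y ≡ N - x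
      aux x y N refl = solve (x ∷ y ∷ [])
      label-level≡ : ∀ {l l′ j} → label n (l , j) ≡ label n (l′ , j) → l ≡ l′
      label-level≡ e = cong proj₁ (label-injective e)
    w : MirroredPermutation n
    w = translation level antisymmetric
    based-at : ∀ i → label n (level i , i) ≡ fun w (residue i)
    based-at i = sym (trans (cong (fun w) (sym (+-identityˡ (residue i))))
      (trans (Translation.translate-entry level 0ℤ i) (cong (λ l → label n (l , i)) (+-identityˡ (level i)))))

  beadsOf-∙ : ∀ {w a} p → (∀ {z} → z < N → fun p z < N) → (∀ {z} → fun p z < N → z < N) →
              BeadsOf w a → BeadsOf (w ∙ p) a
  beadsOf-∙ {w} p keeps reflects-N B e =
      (λ bead → reflects-N (subst (_< N) (sym inverse≡) (B e .proj₁ bead)))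
    , λ q → B e .proj₂ (subst (_< N) inverse≡ (keeps q))
    where
    inverse≡ : fun p (inverse (w ∙ p) (label n e)) ≡ inverse w (label n e)
    inverse≡ = injective-fun w (trans (fun-inverse (w ∙ p) (label n e)) (sym (fun-inverse w (label n e))))

  beadsOf-lastC : ∀ {w a} → BeadsOf w a → BeadsOf (w ∙ lastCᵖ) a
  beadsOf-lastC {w} = beadsOf-∙ {w} lastCᵖ keeps λ {z} p → subst (_< N) (involutive lastC-reflects z) (keeps p)
    where
    keeps : ∀ {z} → z < N → lastC z < N
    keeps = high-preserves-N lastC-simple lastC-high

  beadsOf-parabolic : ∀ t {w a} is → BeadsOf w a →
        BeadsOf (w ∙ Words.RootDatum.evalᵖ (rootDatum t) (List.map Fin.suc is)) a
  beadsOf-parabolic t {w} [] B = beadsOf-cong {w} {w ∙ Words.RootDatum.evalᵖ (rootDatum t) []} (λ _ → refl) B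
  beadsOf-parabolic t {w} {a} (i ∷ is) B = beadsOf-cong {(w ∙ g) ∙ evalᵖ (List.map Fin.suc is)}
      {w ∙ evalᵖ (Fin.suc i ∷ List.map Fin.suc is)} (λ _ → refl)
    (beadsOf-parabolic t {w ∙ g} is (beadsOf-∙ {w} g keeps
      (λ {z} p → subst (_< N) (involutive (letter t (Fin.suc i) .Assembly.LetterData.simple .reflects) z)
            (keeps p)) B))
    where
    open Words.RootDatum (rootDatum t) using (generatorᵖ; evalᵖ)
    g = generatorᵖ (Fin.suc i)
    keeps : ∀ {z} → z < N → fun g z < N
    keeps = high-preserves-N (letter t (Fin.suc i) .Assembly.LetterData.simple) (letter-high t i)

  -- Deciding the parity allows a constructive choice between `w` and its product with `sₙᶜ`.
  even? : ∀ {c f} → Bounded f → Dec (EvenCardinality (Above c f))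
  even? {c} {f} B with above-finite c {f} B
  ... | k , C with 2 ∣? k
  ...   | yes e = yes (card⇒even C e)
  ...   | no o = no λ E → let _ , D , e = even⇒card E in o (subst (2 ∣_) (card-unique D C) e)

  adjust-evenₙ : ∀ (w : MirroredPermutation n) → Evenₙ (fun w) ⊎ Evenₙ (fun w ∘ lastC)
  adjust-evenₙ w with even? {+ n} {fun w} (bounded (mirrored-fun w))
  ... | yes e = inj₁ e
  ... | no o = inj₂ (lastC-flips (mirrored-fun w) (injective-fun w) .proj₂ o)

  Realisation : (MirroredPermutation n → Set) → Abacus n → Set
  Realisation P a = ∃[ w ] P w × BeadsOf w a

  -- `sₙᶜ` repairs the parity at n at no cost to the beads, so this parity puts no condition on the
  -- abacus.
  realise-evenₙ : ∀ {a} → ∃[ w ] BeadsOf w a → Realisation (Evenₙ ∘ fun) a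
  realise-evenₙ {a} (w , B) =
        [ (λ e → w , e , B) , (λ e → w ∙ lastCᵖ , e , beadsOf-lastC {w} {a} B) ]′ (adjust-evenₙ w)

  -- Evenness at 0 is read off the beads, so it holds even after the parity at n has been corrected.
  realise-even₀ : ∀ {a P} → EvenGaps n a → Realisation P a → Realisation (λ w → EvenAtZero w × P w) a
  realise-even₀ {a} even (w , p , B) = w , (evenGaps⇒evenAtZero {w} {a} B even , p) , B

  realise : ∀ t {a} → IsAdmissible t n a → Realisation (InAffineGroup t) a
  realise C̃/C {a} (flush , balanced) = trivial (balanced⇒translation {a} flush balanced)
    where
    trivial : ∃[ w ] BeadsOf w a → Realisation (λ _ → ⊤) a
    trivial (w , B) = w , tt , B
  realise B̃/B {a} (flush , balanced , even) = even-only (balanced⇒translation {a} flush balanced)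
    where
    even-only : ∃[ w ] BeadsOf w a → Realisation EvenAtZero a
    even-only (w , B) = w , evenGaps⇒evenAtZero {w} {a} B even , B
  realise B̃/D {a} (flush , balanced) = realise-evenₙ (balanced⇒translation {a} flush balanced)
  realise D̃/D {a} (flush , balanced , even) =
    realise-even₀ {a} {EvenAtN} even (realise-evenₙ (balanced⇒translation {a} flush balanced))

  admissible : ∀ t w → InAffineGroup t w → IsAdmissible t n (𝒜 w)
  admissible C̃/C w _ = beadsOf-flush {w} {𝒜 w} (beadsOf-𝒜 w) , beadsOf-balanced {w} {𝒜 w} (beadsOf-𝒜 w)
  admissible B̃/B w e = beadsOf-flush {w} {𝒜 w} (beadsOf-𝒜 w) , beadsOf-balanced {w} {𝒜 w} (beadsOf-𝒜 w)
                     , evenAtZero⇒evenGaps {w} {𝒜 w} (beadsOf-𝒜 w) e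
  admissible B̃/D w _ = beadsOf-flush {w} {𝒜 w} (beadsOf-𝒜 w) , beadsOf-balanced {w} {𝒜 w} (beadsOf-𝒜 w)
  admissible D̃/D w (e , _) = beadsOf-flush {w} {𝒜 w} (beadsOf-𝒜 w) , beadsOf-balanced {w} {𝒜 w} (beadsOf-𝒜 w)
                           , evenAtZero⇒evenGaps {w} {𝒜 w} (beadsOf-𝒜 w) e

  𝒜-image : ∀ v w → 𝒜 v ≗ 𝒜 w → Image (fun v) (fun w)
  𝒜-image v w 𝒜v≗𝒜w z z<N with fun w z in eq
  ... | y with locate y
  -- The abacus says nothing about multiples of N, but `v` and `w` both fix them.
  ...   | multiple k = k * N , subst (_< N) z≡ z<N , fixes-multiple (mirrored-fun v) k
    where
    z≡ : z ≡ k * N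
    z≡ = injective-fun w (trans eq (sym (fixes-multiple (mirrored-fun w) k)))
  ...   | entry e = inverse v (label n e)
    , beadsOf-𝒜 v e .proj₁
          (trans (𝒜v≗𝒜w e) (beadsOf-𝒜 w e .proj₂
          (subst (_< N) (trans (sym (inverse-fun w z)) (cong (inverse w) eq)) z<N)))
    , fun-inverse v (label n e)

  module _ (t : AffineType) (rank : minRank t ℕ.≤ n) where

    open Words.RootDatum (rootDatum t)

    -- Sorting multiplies by parabolic letters only, which affects neither membership in the group
    -- nor the beads.
    realise-minimal : ∀ {a} → IsAdmissible t n a →
      ∃[ w ] InAffineGroup t w × IsMinimalRep t n (fun w) × BeadsOf w a
    realise-minimal admitted =
      let w , G , B = realise t admitted
          is , sorted , _ = sort Φ (Φ-descent t) w
          is⁺ = List.map Fin.suc is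
          G′ = group-∙* t rank w is⁺ G
      in w ∙ evalᵖ is⁺ , G′
       , sorted⇒minimalRep t rank (w ∙ evalᵖ is⁺) G′
           (λ i d → sorted i (subst₂ _<_ (cong (fun w) (eval-evalᵖ is⁺ _)) (cong (fun w) (eval-evalᵖ is⁺ _)) d))
       , beadsOf-parabolic t {w} is B

    abacusBijection : Bijection (MinimalReps t n) (AdmissibleAbaci t n)
    abacusBijection = record
      { to = λ (w , G , _) → 𝒜 w , admissible t w G
      ; cong = λ {(v , _)} {(w , _)} v≗w →
          beadsOf-unique {w} (beadsOf-cong {v} {w} v≗w (beadsOf-𝒜 v)) (beadsOf-𝒜 w)
      ; bijective =
          (λ {(v , G , M)} {(w , G′ , M′)} e →
             sorted-unique t rank v w G G′ (minimal⇒sorted M) (minimal⇒sorted M′) (𝒜-image v w e))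
        , λ (a , admitted) →
            let w , G , M , B = realise-minimal admitted
            in (w , G , M) , λ {(v , _)} v≗w →
                 beadsOf-unique {w} (beadsOf-cong {v} {w} v≗w (beadsOf-𝒜 v)) B
      }

    -- A flush abacus is determined by its lowest beads, so their description agrees with the one
    -- through w⁻¹.
    isAbacusOf⇔ : ∀ w a → IsAbacusOf n w a ⇔ a ≗ 𝒜 w
    isAbacusOf⇔ w a = mk⇔
      (λ A → beadsOf-unique {w} (isAbacusOf⇒beadsOf {w} A) (beadsOf-𝒜 w))
      (λ a≗ → beadsOf⇒isAbacusOf {w} (beadsOf-≗ {w} a≗ (beadsOf-𝒜 w)))

-- The bijection in all four types.

2≤minRank : ∀ t {n} → minRank t ℕ.≤ n → 2 ℕ.≤ n
2≤minRank C̃/C = id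
2≤minRank B̃/B = ℕ.<⇒≤
2≤minRank B̃/D = ℕ.<⇒≤
2≤minRank D̃/D = ℕ.<⇒≤ ∘ ℕ.<⇒≤

lemma3p6 : (t : AffineType) (n : ℕ) → minRank t ℕ.≤ n →
    Σ[ 𝒜 ∈ Bijection (MinimalReps t n) (AdmissibleAbaci t n) ]
    ((w : Setoid.Carrier (MinimalReps t n)) (a : Abacus n) →
    IsAbacusOf n (proj₁ w) a ⇔ a ≗ proj₁ (Bijection.to 𝒜 w))
lemma3p6 t 0 rank = contradiction (2≤minRank t rank) λ ()
lemma3p6 t 1 rank = contradiction (2≤minRank t rank) λ { (ℕ.s≤s ()) }
lemma3p6 t (suc (suc m)) rank =
  Abaci.abacusBijection m t rank , λ w a → Abaci.isAbacusOf⇔ m t rank (proj₁ w) a
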